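{- $$\sum_{n=0}^{\infty} (M_e(5n+4) - M_o(5n+4))q^n = \frac{5(q;q^2)_{\infty}^2(q^5;q^5)_{\infty}(q^{10};q^{10})_{\infty}^2}{(q^2;q^2)_{\infty}^2}.$$
   Context: For $|q|<1$ write $(z;q)_\infty=\prod_{j\geq 0}(1-zq^j)$. $M_e(n)$ (resp. $M_o(n)$) denotes the number of partitions of $n$ with even (resp. odd) Andrews–Garvan crank, where the crank counts $M(m,n)$ are defined by $\sum_{m,n}M(m,n)a^mq^n=\frac{(q;q)_\infty}{(aq;q)_\infty(q/a;q)_\infty}$; equivalently $\sum_{n\geq 0}(M_e(n)-M_o(n))q^n=\frac{(q;q)_\infty}{(-q;q)_\infty^2}$. -}

module Defs where

open import Algebra.Bundles.Raw using (RawRing)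
import Algebra.Definitions.RawSemiring as RawSemiringDefs
open import Data.Bool.Base using (Bool; if_then_else_; not)
open import Data.Fin.Base using (toℕ)
open import Data.Integer.Base as ℤ using (ℤ; +_; -[1+_]; _⊖_; ∣_∣; 0ℤ; 1ℤ; -1ℤ)
import Data.Integer.Properties as ℤ
open import Data.List.Base using (List; []; _∷_; _++_; map; cartesianProductWith)
open import Data.Nat.Base as ℕ using (ℕ; suc; _∸_; _≡ᵇ_; NonZero)
open import Data.Nat.Divisibility using (_∣?_)
open import Data.Product.Base using (_×_; _,_)
open import Level using (0ℓ)
open import Relation.Binary.PropositionalEquality.Core using (_≡_)
open import Relation.Nullary.Decidable.Core using (does)

module PowerSeries {c ℓ} (R : RawRing c ℓ) where

  private
    module R where
      open RawRing R public
      open RawSemiringDefs rawSemiring public using (sum)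

  -- The ring R[[q]]; a series is its sequence of coefficients.
  rawRing : RawRing c ℓ
  rawRing = record
    { Carrier = ℕ → R.Carrier
    ; _≈_     = λ f g → ∀ n → f n R.≈ g n
    ; _+_     = λ f g n → f n R.+ g n
    ; _*_     = λ f g n → R.sum {suc n} λ i → f (toℕ i) R.* g (n ∸ toℕ i)
    ; -_      = λ f n → R.- f n
    ; 0#      = λ _ → R.0#
    ; 1#      = λ n → if n ≡ᵇ 0 then R.1# else R.0#
    }

  open RawRing rawRing public using (Carrier; _≈_; _+_; _*_; -_; 0#; 1#)
  open RawSemiringDefs (RawRing.rawSemiring rawRing) public using (product; _^_)

  monomial : R.Carrier → ℕ → Carrier
  monomial r k n = if n ≡ᵇ k then r else R.0#

  constant : R.Carrier → Carrier
  constant r = monomial r 0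

  infix 9 q^_

  q^_ : ℕ → Carrier
  q^ k = monomial R.1# k

  -- ⟨ z ⨾q^ k ⟩∞ is (z; q^k)_∞ = ∏_{j ≥ 0} (1 - z q^{kj}).  As k ≥ 1, the
  -- factors with j > n are 1 modulo q^{n+1}, so the coefficient of q^n in the
  -- infinite product is its coefficient in the product over 0 ≤ j ≤ n.
  ⟨_⨾q^_⟩∞ : Carrier → (k : ℕ) → .{{NonZero k}} → Carrier
  ⟨ z ⨾q^ k ⟩∞ n = product {suc n} (λ j → 1# + - (z * q^ (k ℕ.* toℕ j))) n

  -- The reciprocal ∑_{k ≥ 0} (1 - f)^k of a series f with constant term 1 (it
  -- is not meaningful for other f).  As (1 - f)^k is divisible by q^k, only
  -- the terms with k ≤ n contribute to the coefficient of q^n.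
  infix 8 _⁻¹

  _⁻¹ : Carrier → Carrier
  (f ⁻¹) n = R.sum {suc n} λ k → ((1# + - f) ^ toℕ k) n

  infixl 7 _/_

  _/_ : Carrier → Carrier → Carrier
  f / g = f * g ⁻¹

module Laurent where

  -- The ring ℤ[a, a⁻¹].  A Laurent polynomial is a formal sum of terms
  -- (c , e) standing for c a^e; exponents may repeat, so equality is
  -- equality of all coefficients.
  Polynomial : Set
  Polynomial = List (ℤ × ℤ)

  coeff : Polynomial → ℤ → ℤ
  coeff []            m = 0ℤ
  coeff ((c , e) ∷ p) m = (if does (e ℤ.≟ m) then c else 0ℤ) ℤ.+ coeff p m

  rawRing : RawRing 0ℓ 0ℓ
  rawRing = record
    { Carrier = Polynomial
    ; _≈_     = λ p r → ∀ m → coeff p m ≡ coeff r m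
    ; _+_     = _++_
    ; _*_     = cartesianProductWith λ (c , e) (d , f) → (c ℤ.* d , e ℤ.+ f)
    ; -_      = map λ (c , e) → (ℤ.- c , e)
    ; 0#      = []
    ; 1#      = (1ℤ , 0ℤ) ∷ []
    }

  a^_ : ℤ → Polynomial
  a^ e = (1ℤ , e) ∷ []

module ℤ[[q]] = PowerSeries ℤ.+-*-rawRing

module Crank where

  open PowerSeries Laurent.rawRing
  open RawSemiringDefs (RawRing.rawSemiring ℤ.+-*-rawRing) using (sum)
  open Laurent using (a^_; coeff)

  -- (q; q)_∞ / ((aq; q)_∞ (q/a; q)_∞) in ℤ[a, a⁻¹][[q]].
  generatingFunction : Carrier
  generatingFunction =
    ⟨ q^ 1 ⨾q^ 1 ⟩∞ /
      (⟨ monomial (a^ 1ℤ) 1 ⨾q^ 1 ⟩∞ * ⟨ monomial (a^ -1ℤ) 1 ⨾q^ 1 ⟩∞)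

  M : ℤ → ℕ → ℤ
  M m n = coeff (generatingFunction n) m

  -- ∑ M(m, n) over the m selected by P.  The range -n ≤ m ≤ n contains every
  -- m with M(m, n) ≠ 0, since each power of a^{±1} in the generating function
  -- comes with at least the same power of q.
  countWhere : (ℤ → Bool) → ℕ → ℤ
  countWhere P n = sum {suc (2 ℕ.* n)} λ i →
    let m = toℕ i ⊖ n in if P m then M m n else 0ℤ

  even : ℤ → Bool
  even m = does (2 ∣? ∣ m ∣)

  Mₑ Mₒ : ℕ → ℤ
  Mₑ = countWhere even
  Mₒ = countWhere λ m → not (even m)

{-# OPTIONS --safe #-}
-- Write f_k = (q^k; q^k)_∞ and J_i = (q^i, q^(10-i), q^10; q^10)_∞.  At a = -1 the generating function
-- of the crank is G = f₁³/f₂² = φ²/f₁, where φ = φ(-q) = f₁²/f₂; let ψ = ψ(q) = f₂²/f₁, so f₁³ = φ²ψ.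
--
-- Put k = q J₁J₂/(J₃J₄) and ρ = J₁J₄/(J₂J₃).  Three instances of the addition formula for theta
-- functions, which follows from the Jacobi triple product, express 1 - k, 1 + k and 1 + k - k² as
-- quotients of the J_i.  Hence, with x = q ρ(q⁵) and k̄ = k(q⁵), one has k̄ (1 - k̄)² = x⁵ (1 + k̄)²,
-- and splitting the series of φ and ψ by residues modulo 5 makes φ/φ(-q²⁵) and ψ/ψ(q²⁵)
-- rational functions of x and k̄.  The cube root of φ²ψ is then f₁ = f₂₅ (1 - x - x²)/ρ(q⁵), and
-- q x f₂₅ G/φ(-q²⁵)² becomes a polynomial in x of degree 4 with coefficients rational in k̄.  The
-- powers q^(5n+4) of G come from its term in x, whose coefficient is
-- 5k̄/(1 + k̄ - k̄²) = 5 q⁵ ψ(q²⁵)²/ψ(q⁵)².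
module Submission where

open import Defs
open import Algebra.Bundles using (CommutativeRing)
open import Algebra.Bundles.Raw using (RawRing)
import Algebra.Definitions.RawSemiring as RawSemiringDefs
import Algebra.Properties.AbelianGroup as AbelianGroupProperties
import Algebra.Properties.Semiring.Exp as Exp
import Algebra.Solver.Ring as RingSolver
open import Algebra.Solver.Ring.AlmostCommutativeRing using (_-Raw-AlmostCommutative⟶_; fromCommutativeRing)
open import Algebra.Structures using (IsCommutativeRing)
open import Data.Bool.Base as Bool using (Bool; true; false; if_then_else_; not)
open import Data.Empty using (⊥)
open import Data.Fin.Base using (Fin; zero; suc; toℕ; fromℕ<)
import Data.Fin.Properties as Fin
open import Data.Integer.Base as ℤ using (ℤ; +_; -[1+_]; _⊖_; ∣_∣; 0ℤ; 1ℤ; -1ℤ)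
import Data.Integer.DivMod as ℤ
import Data.Integer.Properties as ℤ
import Data.Integer.Solver as ℤSolver
open import Data.List.Base using (List; []; _∷_; _++_; map; applyUpTo; cartesianProduct)
import Data.List.Membership.DecPropositional as DecMembership
open import Data.List.Membership.Propositional using (_∈_; _∉_)
open import Data.List.Membership.Propositional.Properties using (∈-∃++; ∈-++⁺ˡ; ∈-++⁺ʳ; ∈-map⁺; ∈-map⁻; ∈-cartesianProduct⁺; ∈-applyUpTo⁺)
open import Data.List.Relation.Binary.Permutation.Propositional using (↭-sym)
open import Data.List.Relation.Binary.Permutation.Propositional.Properties using (shift; All-resp-↭; ∈-resp-↭)
open import Data.List.Relation.Unary.All as All using (All; []; _∷_)
import Data.List.Relation.Unary.All.Properties as All
open import Data.List.Relation.Unary.AllPairs using ([]; _∷_)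
open import Data.List.Relation.Unary.Any using (here; there)
open import Data.List.Relation.Unary.Unique.Propositional using (Unique)
import Data.List.Relation.Unary.Unique.Propositional.Properties as Unique
open import Data.Maybe.Base as Maybe using (Maybe)
open import Data.Nat.Base as ℕ using (ℕ; zero; suc; _≤_; _<_; z≤n; s≤s; NonZero; _∸_)
open import Data.Nat.Divisibility using (_∣?_; ∣m+n∣m⇒∣n; ∣m∣n⇒∣m+n; ∣-refl)
import Data.Nat.Properties as ℕ
import Data.Nat.Solver as ℕSolver
open import Data.Product.Base using (∃; _×_; _,_; proj₁; proj₂)
open import Data.Product.Properties using (≡-dec)
open import Data.Sum.Base using (_⊎_; inj₁; inj₂; [_,_]′)
open import Data.Sum.Properties using (inj₁-injective; inj₂-injective)
open import Function.Base using (_∘_; id; case_of_)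
open import Function.Bundles using (mk⇔)
open import Level using (0ℓ)
open import Relation.Binary.Bundles using (Setoid)
open import Relation.Binary.Definitions using (DecidableEquality)
import Relation.Binary.PropositionalEquality as ≡
import Relation.Binary.Reasoning.Setoid as SetoidReasoning
open import Relation.Nullary.Decidable using (yes; no; dec⇒maybe; does; does-⇔)
open import Relation.Nullary.Negation using (contradiction)
open ≡ using (_≡_; _≢_)

-- With R the Rogers-Ramanujan continued fraction, R(q) = q^(1/5) ρ(q), so x = R(q⁵), and k = R(q)
-- R(q²)² is Ramanujan's parameter. The obstacle is the division by f₁ in φ²/f₁. The dissection of
-- f₁ is extracted from those of φ and ψ: the expression for f₁³ is a perfect cube modulo the
-- modular equation, and cube roots with constant term 1 are unique, because y² + yz + z² then has
-- constant term 3. There remains 1/(1 - x - x²). Its norm over series in q⁵ is 1 - 11x⁵ - x¹⁰,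
-- which the modular equation turns into (1 + k̄ - k̄²)(1 - 4k̄ - k̄²)²/(1 + k̄)⁴; the squared
-- factor is absorbed by φ², so only 1 + k̄ - k̄² stays as a denominator. As k̄ is a series in q⁵
-- and x^i is q^i times such a series, a polynomial in x of degree at most 4 displays the residue
-- classes of exponents. Quotients are cleared throughout: an identity is multiplied by cancellable
-- series and written as an explicit linear combination of known relations.

-- Congruences modulo powers of q, cancellation and infinite products

record AdicRing : Set₁ where
  field
    commutativeRing : CommutativeRing 0ℓ 0ℓ
    fromℤ           : ℤ.+-*-rawRing -Raw-AlmostCommutative⟶ fromCommutativeRing commutativeRing

  open CommutativeRing commutativeRing public hiding (zero)
  open _-Raw-AlmostCommutative⟶_ fromℤ public using (⟦_⟧; 1-homo)
  open Exp semiring public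

  field
    q         : Carrier
    q-cancel  : ∀ {x y} → q * x ≈ q * y → x ≈ y
    separated : ∀ {x y} → (∀ N → ∃ λ z → x ≈ y + q ^ N * z) → x ≈ y

module IntegerSolver (R : CommutativeRing 0ℓ 0ℓ)
                     (ι : ℤ.+-*-rawRing -Raw-AlmostCommutative⟶ fromCommutativeRing R) where

  open CommutativeRing R using (_≈_; reflexive)
  open _-Raw-AlmostCommutative⟶_ ι using (⟦_⟧)

  coefficient≟ : ∀ a b → Maybe (⟦ a ⟧ ≈ ⟦ b ⟧)
  coefficient≟ a b = Maybe.map (λ e → reflexive (≡.cong ⟦_⟧ e)) (dec⇒maybe (a ℤ.≟ b))

  open RingSolver ℤ.+-*-rawRing (fromCommutativeRing R) ι coefficient≟ public
    using (solve; _:=_; _:+_; _:*_; _:-_; :-_; _:^_; con; Polynomial)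

  -- con 1ℤ would evaluate to the image of 1ℤ, which need not be 1# judgmentally.
  𝟙 : ∀ {n} → Polynomial n
  𝟙 = con 0ℤ :^ 0

module Adic (A : AdicRing) where

  open AdicRing A
  open IntegerSolver commutativeRing fromℤ public

  open SetoidReasoning setoid

  infix 4 _≈_mod_

  record _≈_mod_ (x y : Carrier) (N : ℕ) : Set where
    constructor _by_
    field
      quotient : Carrier
      equality : x ≈ y + q ^ N * quotient

  mod-separated : ∀ {x y} → (∀ N → x ≈ y mod N) → x ≈ y
  mod-separated e = separated λ N → let z by x≈ = e N in z , x≈

  ≈⇒mod : ∀ {x y} N → x ≈ y → x ≈ y mod N
  ≈⇒mod N x≈y = 0# by trans x≈y (sym (trans (+-congˡ (zeroʳ _)) (+-identityʳ _)))

  mod-refl : ∀ {x N} → x ≈ x mod N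
  mod-refl {N = N} = ≈⇒mod N refl

  mod-sym : ∀ {x y N} → x ≈ y mod N → y ≈ x mod N
  mod-sym {x} {y} {N} (z by x≈) = (- z) by trans
    (solve 3 (λ y Q z → y := y :+ Q :* z :+ Q :* :- z) refl y (q ^ N) z)
    (+-congʳ (sym x≈))

  mod-trans : ∀ {x y z N} → x ≈ y mod N → y ≈ z mod N → x ≈ z mod N
  mod-trans {x} {y} {z} {N} (s by x≈) (t by y≈) = (t + s) by trans x≈ (trans (+-congʳ y≈)
    (solve 4 (λ z Q s t → z :+ Q :* t :+ Q :* s := z :+ Q :* (t :+ s)) refl z (q ^ N) s t))

  mod-setoid : ℕ → Setoid 0ℓ 0ℓ
  mod-setoid N = record
    { Carrier       = Carrier
    ; _≈_           = _≈_mod N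
    ; isEquivalence = record { refl = mod-refl ; sym = mod-sym ; trans = mod-trans }
    }

  mod-+ : ∀ {x y u v N} → x ≈ y mod N → u ≈ v mod N → x + u ≈ y + v mod N
  mod-+ {x} {y} {u} {v} {N} (s by x≈) (t by u≈) = (s + t) by trans (+-cong x≈ u≈)
    (solve 5 (λ y v Q s t → y :+ Q :* s :+ (v :+ Q :* t) := y :+ v :+ Q :* (s :+ t)) refl y v (q ^ N) s t)

  mod-* : ∀ {x y u v N} → x ≈ y mod N → u ≈ v mod N → x * u ≈ y * v mod N
  mod-* {x} {y} {u} {v} {N} (s by x≈) (t by u≈) = (y * t + s * v + q ^ N * s * t) by trans (*-cong x≈ u≈)
    (solve 5 (λ y v Q s t → (y :+ Q :* s) :* (v :+ Q :* t) := y :* v :+ Q :* (y :* t :+ s :* v :+ Q :* s :* t))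
      refl y v (q ^ N) s t)

  mod-‿- : ∀ {x y N} → x ≈ y mod N → - x ≈ - y mod N
  mod-‿- {x} {y} {N} (s by x≈) = (- s) by trans (-‿cong x≈)
    (solve 3 (λ y Q s → :- (y :+ Q :* s) := :- y :+ Q :* :- s) refl y (q ^ N) s)

  mod-≤ : ∀ {x y M N} → M ≤ N → x ≈ y mod N → x ≈ y mod M
  mod-≤ {x} {y} {M} {N} M≤N (s by x≈) = (q ^ (N ∸ M) * s) by trans x≈ (+-congˡ (begin
    q ^ N * s                   ≡⟨ ≡.cong (λ n → q ^ n * s) (≡.sym (ℕ.m+[n∸m]≡n M≤N)) ⟩
    q ^ (M ℕ.+ (N ∸ M)) * s     ≈⟨ *-congʳ (^-homo-* q M (N ∸ M)) ⟩
    q ^ M * q ^ (N ∸ M) * s     ≈⟨ *-assoc _ _ _ ⟩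
    q ^ M * (q ^ (N ∸ M) * s)   ∎))

  mod-0 : ∀ {x y} → x ≈ y mod 0
  mod-0 {x} {y} = (x - y) by solve 2 (λ x y → x := y :+ 𝟙 :* (x :- y)) refl x y

  q^≈0 : ∀ {N n} → N ≤ n → q ^ n ≈ 0# mod N
  q^≈0 {N} {n} N≤n = mod-≤ N≤n (1# by trans (sym (*-identityʳ _)) (sym (+-identityˡ _)))

  *-≈0ˡ : ∀ {x N} → x ≈ 0# mod N → ∀ y → x * y ≈ 0# mod N
  *-≈0ˡ x≈0 y = mod-trans (mod-* x≈0 (mod-refl {y})) (≈⇒mod _ (zeroˡ y))

  *-≈0ʳ : ∀ {x N} → x ≈ 0# mod N → ∀ y → y * x ≈ 0# mod N
  *-≈0ʳ x≈0 y = mod-trans (mod-* (mod-refl {y}) x≈0) (≈⇒mod _ (zeroʳ y))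

  q*-mod : ∀ {x N} → x ≈ 0# mod N → q * x ≈ 0# mod suc N
  q*-mod {x} {N} (s by x≈) = s by trans (*-congˡ (trans x≈ (+-identityˡ _)))
    (trans (sym (*-assoc _ _ _)) (sym (+-identityˡ _)))

  -- Quotients of theta series are handled by clearing denominators and cancelling such factors
  -- again.
  Regular : Carrier → Set
  Regular u = ∀ {x y} → u * x ≈ u * y → x ≈ y

  regular-* : ∀ {u v} → Regular u → Regular v → Regular (u * v)
  regular-* cancelᵤ cancelᵥ e = cancelᵥ (cancelᵤ (trans (sym (*-assoc _ _ _)) (trans e (*-assoc _ _ _))))

  regular-^ : ∀ {u} → Regular u → ∀ n → Regular (u ^ n)
  regular-^ cancel zero    e = trans (sym (*-identityˡ _)) (trans e (*-identityˡ _))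
  regular-^ cancel (suc n) = regular-* cancel (regular-^ cancel n)

  regular-q : Regular q
  regular-q = q-cancel

  Principal : Carrier → Set
  Principal u = u ≈ 1# mod 1

  principal-* : ∀ {u v} → Principal u → Principal v → Principal (u * v)
  principal-* u≈1 v≈1 = mod-trans (mod-* u≈1 v≈1) (≈⇒mod 1 (*-identityˡ 1#))

  principal-^ : ∀ {u} → Principal u → ∀ n → Principal (u ^ n)
  principal-^ u≈1 zero    = mod-refl
  principal-^ u≈1 (suc n) = principal-* u≈1 (principal-^ u≈1 n)

  -- Writing u = 1 + q s gives x = u x - q s x, so divisibility of x by `q ^ M` improves to
  -- `q ^ suc M` as long as M < N.
  principal-vanish : ∀ {u x N} → Principal u → u * x ≈ 0# mod N → x ≈ 0# mod N
  principal-vanish {u} {x} {N} (s by u≈) ux≈0 = go N ℕ.≤-refl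
    where
    x≈ : x ≈ u * x + q * (- s * x)
    x≈ = sym (trans (+-congʳ (*-congʳ u≈))
      (solve 3 (λ q s x → (𝟙 :+ q :^ 1 :* s) :* x :+ q :* (:- s :* x) := x) refl q s x))

    go : ∀ M → M ≤ N → x ≈ 0# mod M
    go zero    _    = mod-0
    go (suc M) sM≤N = mod-trans (≈⇒mod _ x≈) (mod-trans
      (mod-+ (mod-≤ sM≤N ux≈0) (q*-mod (*-≈0ʳ (go M (ℕ.<⇒≤ sM≤N)) (- s))))
      (≈⇒mod _ (+-identityʳ 0#)))

  minus≈0 : ∀ {x y N} → x - y ≈ 0# mod N → x ≈ y mod N
  minus≈0 {x} {y} {N} e = mod-trans (≈⇒mod N (solve 2 (λ x y → x := x :- y :+ y) refl x y))
    (mod-trans (mod-+ e (mod-refl {y})) (≈⇒mod N (+-identityˡ y)))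

  principal-cancel-mod : ∀ {u x y N} → Principal u → u * x ≈ u * y mod N → x ≈ y mod N
  principal-cancel-mod {u} {x} {y} {N} pu e = minus≈0 (principal-vanish pu (mod-trans
    (≈⇒mod N (solve 3 (λ u x y → u :* (x :- y) := u :* x :- u :* y) refl u x y))
    (mod-trans (mod-+ e (mod-refl { - (u * y)})) (≈⇒mod N (-‿inverseʳ (u * y))))))

  principal⇒regular : ∀ {u} → Principal u → Regular u
  principal⇒regular pu e = mod-separated λ N → principal-cancel-mod pu (≈⇒mod N e)

  ∏< : ℕ → (ℕ → Carrier) → Carrier
  ∏< zero    t = 1#
  ∏< (suc n) t = ∏< n t * t n

  ∏-cong : ∀ n {s t} → (∀ j → s j ≈ t j) → ∏< n s ≈ ∏< n t
  ∏-cong zero    e = refl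
  ∏-cong (suc n) e = *-cong (∏-cong n e) (e n)

  ∏-cons : ∀ n t → ∏< (suc n) t ≈ t 0 * ∏< n (t ∘ suc)
  ∏-cons zero    t = *-comm _ _
  ∏-cons (suc n) t = trans (*-congʳ (∏-cons n t)) (*-assoc _ _ _)

  ∏-* : ∀ n s t → ∏< n (λ j → s j * t j) ≈ ∏< n s * ∏< n t
  ∏-* zero    s t = sym (*-identityˡ 1#)
  ∏-* (suc n) s t = trans (*-congʳ (∏-* n s t))
    (solve 4 (λ a b c d → a :* b :* (c :* d) := a :* c :* (b :* d)) refl (∏< n s) (∏< n t) (s n) (t n))

  ∏-const : ∀ n x → ∏< n (λ _ → x) ≈ x ^ n
  ∏-const zero    x = refl
  ∏-const (suc n) x = trans (*-congʳ (∏-const n x)) (*-comm _ _)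

  1^n≈1 : ∀ n → 1# ^ n ≈ 1#
  1^n≈1 zero    = refl
  1^n≈1 (suc n) = trans (*-identityˡ _) (1^n≈1 n)

  ^-distrib-* : ∀ x y n → (x * y) ^ n ≈ x ^ n * y ^ n
  ^-distrib-* x y zero    = sym (*-identityˡ 1#)
  ^-distrib-* x y (suc n) = trans (*-congˡ (^-distrib-* x y n))
    (solve 4 (λ a b c d → a :* b :* (c :* d) := a :* c :* (b :* d)) refl x y (x ^ n) (y ^ n))

  ∏-+ : ∀ m n t → ∏< (m ℕ.+ n) t ≈ ∏< m t * ∏< n (λ j → t (m ℕ.+ j))
  ∏-+ m zero    t = trans (reflexive (≡.cong (λ k → ∏< k t) (ℕ.+-identityʳ m))) (sym (*-identityʳ _))
  ∏-+ m (suc n) t = trans (reflexive (≡.cong (λ k → ∏< k t) (ℕ.+-suc m n)))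
    (trans (*-congʳ (∏-+ m n t)) (*-assoc _ _ _))

  ∏-stable : ∀ {M N} t → M ≤ N → (∀ j → M ≤ j → t j ≈ 1# mod M) → ∏< N t ≈ ∏< M t mod M
  ∏-stable {M} {N} t M≤N t≈1 = ≡.subst (λ n → ∏< n t ≈ ∏< M t mod M) (ℕ.m+[n∸m]≡n M≤N) (go (N ∸ M))
    where
    go : ∀ n → ∏< (M ℕ.+ n) t ≈ ∏< M t mod M
    go n = mod-trans (≈⇒mod M (∏-+ M n t)) (mod-trans (mod-* (mod-refl {∏< M t}) (ones n)) (≈⇒mod M (*-identityʳ _)))
      where
      ones : ∀ n → ∏< n (λ j → t (M ℕ.+ j)) ≈ 1# mod M
      ones zero    = mod-refl
      ones (suc n) = mod-trans (mod-* (ones n) (t≈1 (M ℕ.+ n) (ℕ.m≤m+n M n))) (≈⇒mod M (*-identityˡ 1#))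

  -- The rate of convergence is built in: n factors already fix the product modulo `q ^ n`, as they
  -- do for 1 - z q^(kj) with k ≥ 1.
  HasProduct : (ℕ → Carrier) → Carrier → Set
  HasProduct t p = ∀ n → ∏< n t ≈ p mod n

  product-unique : ∀ {s t x y} → (∀ j → s j ≈ t j) → HasProduct s x → HasProduct t y → x ≈ y
  product-unique e hx hy = mod-separated λ N →
    mod-trans (mod-sym (hx N)) (mod-trans (≈⇒mod N (∏-cong N e)) (hy N))

  product-principal : ∀ {t x} → HasProduct t x → t 0 ≈ 1# mod 1 → Principal x
  product-principal hx t₀≈1 = mod-trans (mod-sym (hx 1)) (mod-trans (≈⇒mod 1 (*-identityˡ _)) t₀≈1)

-- Unconditional q-adic sums over arbitrary index types

unique-shift : ∀ {A : Set} {x : A} ys {zs} → Unique (ys ++ x ∷ zs) → Unique (x ∷ ys ++ zs)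
unique-shift []       u         = u
unique-shift (y ∷ ys) (y∉ ∷ u) with y≢x ∷ y∉′ ← All-resp-↭ (shift _ ys _) y∉ | x∉ ∷ u′ ← unique-shift ys u =
  (≡.≢-sym y≢x ∷ x∉) ∷ y∉′ ∷ u′

module Sums (A : AdicRing) where
  open AdicRing A
  open Adic A

  private
    variable
      I I′ : Set
      s t : Carrier

  ∑ : (I → Carrier) → List I → Carrier
  ∑ f []       = 0#
  ∑ f (i ∷ is) = f i + ∑ f is

  ∑-++ : ∀ (f : I → Carrier) is js → ∑ f (is ++ js) ≈ ∑ f is + ∑ f js
  ∑-++ f []       js = sym (+-identityˡ _)
  ∑-++ f (i ∷ is) js = trans (+-congˡ (∑-++ f is js)) (sym (+-assoc _ _ _))

  ∑-map : ∀ (f : I → Carrier) (h : I′ → I) is → ∑ f (map h is) ≈ ∑ (f ∘ h) is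
  ∑-map f h []       = refl
  ∑-map f h (i ∷ is) = +-congˡ (∑-map f h is)

  ∑-cong : ∀ {f g : I → Carrier} → (∀ i → f i ≈ g i) → ∀ is → ∑ f is ≈ ∑ g is
  ∑-cong e []       = refl
  ∑-cong e (i ∷ is) = +-cong (e i) (∑-cong e is)

  ∑-scale : ∀ c (f : I → Carrier) is → ∑ (λ i → c * f i) is ≈ c * ∑ f is
  ∑-scale c f []       = sym (zeroʳ c)
  ∑-scale c f (i ∷ is) = trans (+-congˡ (∑-scale c f is)) (sym (distribˡ _ _ _))

  ∑-cartesianProduct : ∀ (f : I → Carrier) (g : I′ → Carrier) is js →
    ∑ (λ (i , j) → f i * g j) (cartesianProduct is js) ≈ ∑ f is * ∑ g js
  ∑-cartesianProduct f g []       js = sym (zeroˡ _)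
  ∑-cartesianProduct f g (i ∷ is) js = trans (∑-++ _ (map (i ,_) js) _) (trans
    (+-cong (trans (∑-map _ (i ,_) js) (∑-scale (f i) g js)) (∑-cartesianProduct f g is js))
    (sym (distribʳ _ _ _)))

  ∑-vanish : ∀ {N} (f : I → Carrier) is → (∀ i → i ∈ is → f i ≈ 0# mod N) → ∑ f is ≈ 0# mod N
  ∑-vanish f []       f≈0 = mod-refl
  ∑-vanish f (i ∷ is) f≈0 = mod-trans
    (mod-+ (f≈0 i (here ≡.refl)) (∑-vanish f is (λ j j∈is → f≈0 j (there j∈is)))) (≈⇒mod _ (+-identityʳ 0#))

  -- The index type carries no order. A finite duplicate-free set of indices suffices modulo
  -- `q ^ N`, so that sums can be reindexed along any bijection.
  record Truncation (f : I → Carrier) (s : Carrier) (N : ℕ) : Set where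
    field
      support   : List I
      unique    : Unique support
      vanishing : ∀ i → i ∉ support → f i ≈ 0# mod N
      total     : ∑ f support ≈ s mod N

  open Truncation

  HasSum : (I → Carrier) → Carrier → Set
  HasSum f s = ∀ N → Truncation f s N

  module _ {I : Set} (_≟_ : DecidableEquality I) where
    open DecMembership _≟_ using (_∈?_)

    -- Two supports may differ only in negligible indices. The head of the first list is either
    -- negligible or can be moved to the front of the second and cancelled there.
    ∑-agree : ∀ {N} (f : I → Carrier) is js → Unique is → Unique js →
      (∀ i → i ∈ is → i ∈ js ⊎ f i ≈ 0# mod N) → (∀ j → j ∈ js → j ∈ is ⊎ f j ≈ 0# mod N) →
      ∑ f is ≈ ∑ f js mod N
    ∑-agree f [] js _ _ _ ⊇ = mod-sym (∑-vanish f js λ j j∈js → [ (λ ()) , id ]′ (⊇ j j∈js))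
    ∑-agree {N} f (i ∷ is) js (i∉is ∷ uis) ujs ⊆ ⊇ with i ∈? js
    ... | no i∉js = mod-trans (mod-+ ([ (λ i∈js → contradiction i∈js i∉js) , id ]′ (⊆ i (here ≡.refl)))
          (∑-agree f is js uis ujs (λ j j∈is → ⊆ j (there j∈is)) ⊇′)) (≈⇒mod N (+-identityˡ _))
      where
      ⊇′ : ∀ j → j ∈ js → j ∈ is ⊎ f j ≈ 0# mod N
      ⊇′ j j∈js with ⊇ j j∈js
      ... | inj₁ (here ≡.refl)  = contradiction j∈js i∉js
      ... | inj₁ (there j∈is)   = inj₁ j∈is
      ... | inj₂ fj≈0           = inj₂ fj≈0
    ... | yes i∈js with ys , zs , ≡.refl ← ∈-∃++ i∈js
                   with i∉yz ∷ uyz ← unique-shift ys ujs =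
        mod-trans (mod-+ (mod-refl {f i}) (∑-agree f is (ys ++ zs) uis uyz ⊆′ ⊇′)) (≈⇒mod N (begin
          f i + ∑ f (ys ++ zs)       ≈⟨ +-congˡ (∑-++ f ys zs) ⟩
          f i + (∑ f ys + ∑ f zs)    ≈⟨ solve 3 (λ a b c → a :+ (b :+ c) := b :+ (a :+ c)) refl _ _ _ ⟩
          ∑ f ys + (f i + ∑ f zs)    ≈⟨ sym (∑-++ f ys (i ∷ zs)) ⟩
          ∑ f (ys ++ i ∷ zs)         ∎))
      where
      open SetoidReasoning setoid
      ⊆′ : ∀ j → j ∈ is → j ∈ ys ++ zs ⊎ f j ≈ 0# mod N
      ⊆′ j j∈is with ⊆ j (there j∈is)
      ... | inj₂ fj≈0 = inj₂ fj≈0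
      ... | inj₁ j∈js with ∈-resp-↭ (shift i ys zs) j∈js
      ...   | here ≡.refl = contradiction ≡.refl (All.lookup i∉is j∈is)
      ...   | there j∈yz  = inj₁ j∈yz
      ⊇′ : ∀ j → j ∈ ys ++ zs → j ∈ is ⊎ f j ≈ 0# mod N
      ⊇′ j j∈yz with ⊇ j (∈-resp-↭ (↭-sym (shift i ys zs)) (there j∈yz))
      ... | inj₁ (here ≡.refl) = contradiction ≡.refl (All.lookup i∉yz j∈yz)
      ... | inj₁ (there j∈is)  = inj₁ j∈is
      ... | inj₂ fj≈0          = inj₂ fj≈0

    -- The source of all identities between theta series below: one family of terms is summed in two
    -- ways.
    sum-unique : ∀ {f : I → Carrier} → HasSum f s → HasSum f t → s ≈ t
    sum-unique {f = f} hs ht = mod-separated λ N → mod-trans (mod-sym (total (hs N))) (mod-trans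
      (∑-agree f (support (hs N)) (support (ht N)) (unique (hs N)) (unique (ht N))
        (λ i _ → covers (ht N) i) (λ i _ → covers (hs N) i))
      (total (ht N)))
      where
      covers : ∀ {N u} (τ : Truncation f u N) i → i ∈ support τ ⊎ f i ≈ 0# mod N
      covers τ i with i ∈? support τ
      ... | yes i∈ = inj₁ i∈
      ... | no  i∉ = inj₂ (vanishing τ i i∉)

    sum-* : ∀ {I′ : Set} {f : I → Carrier} {g : I′ → Carrier} →
      HasSum f s → HasSum g t → HasSum (λ (i , j) → f i * g j) (s * t)
    sum-* {f = f} {g} hs ht N = record
      { support   = cartesianProduct is js
      ; unique    = Unique.cartesianProduct⁺ (unique (hs N)) (unique (ht N))
      ; vanishing = λ (i , j) ij∉ → case i ∈? is of λ where
          (yes i∈is) → *-≈0ʳ (vanishing (ht N) j (λ j∈js → ij∉ (∈-cartesianProduct⁺ i∈is j∈js))) (f i)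
          (no  i∉is) → *-≈0ˡ (vanishing (hs N) i i∉is) (g j)
      ; total     = mod-trans (≈⇒mod N (∑-cartesianProduct f g is js)) (mod-* (total (hs N)) (total (ht N)))
      }
      where
      is = support (hs N)
      js = support (ht N)

  sum-cong : ∀ {f g : I → Carrier} → (∀ i → f i ≈ g i) → s ≈ t → HasSum f s → HasSum g t
  sum-cong e s≈t hs N = record
    { support   = support (hs N)
    ; unique    = unique (hs N)
    ; vanishing = λ i i∉ → mod-trans (≈⇒mod N (sym (e i))) (vanishing (hs N) i i∉)
    ; total     = mod-trans (≈⇒mod N (∑-cong (sym ∘ e) (support (hs N)))) (mod-trans (total (hs N)) (≈⇒mod N s≈t))
    }

  sum-scale : ∀ c {f : I → Carrier} → HasSum f s → HasSum (λ i → c * f i) (c * s)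
  sum-scale c {f} hs N = record
    { support   = support (hs N)
    ; unique    = unique (hs N)
    ; vanishing = λ i i∉ → *-≈0ʳ (vanishing (hs N) i i∉) c
    ; total     = mod-trans (≈⇒mod N (∑-scale c f (support (hs N)))) (mod-* mod-refl (total (hs N)))
    }

  sum-reindex : ∀ {f : I → Carrier} (h : I′ → I) → (∀ {i j} → h i ≡ h j → i ≡ j) → (∀ i → ∃ λ j → h j ≡ i) →
    HasSum (f ∘ h) s → HasSum f s
  sum-reindex {f = f} h injective surjective hs N = record
    { support   = map h (support (hs N))
    ; unique    = Unique.map⁺ injective (unique (hs N))
    ; vanishing = λ i i∉ → case surjective i of λ where
        (j , ≡.refl) → vanishing (hs N) j (λ j∈ → i∉ (∈-map⁺ h j∈))
    ; total     = mod-trans (≈⇒mod N (∑-map f h (support (hs N)))) (total (hs N))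
    }

  sum-⊎ : ∀ {f : I ⊎ I′ → Carrier} → HasSum (f ∘ inj₁) s → HasSum (f ∘ inj₂) t → HasSum f (s + t)
  sum-⊎ {f = f} hs ht N = record
    { support   = map inj₁ is ++ map inj₂ js
    ; unique    = Unique.++⁺ (Unique.map⁺ inj₁-injective (unique (hs N))) (Unique.map⁺ inj₂-injective (unique (ht N)))
                    λ (k∈₁ , k∈₂) → disjoint (∈-map⁻ inj₁ k∈₁) (∈-map⁻ inj₂ k∈₂)
    ; vanishing = λ where
        (inj₁ i) i∉ → vanishing (hs N) i (λ i∈ → i∉ (∈-++⁺ˡ (∈-map⁺ inj₁ i∈)))
        (inj₂ j) j∉ → vanishing (ht N) j (λ j∈ → j∉ (∈-++⁺ʳ _ (∈-map⁺ inj₂ j∈)))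
    ; total     = mod-trans (≈⇒mod N (∑-++ f (map inj₁ is) _)) (mod-+
        (mod-trans (≈⇒mod N (∑-map f inj₁ is)) (total (hs N)))
        (mod-trans (≈⇒mod N (∑-map f inj₂ js)) (total (ht N))))
    }
    where
    is = support (hs N)
    js = support (ht N)
    disjoint : ∀ {k} → ∃ (λ i → i ∈ is × k ≡ inj₁ i) → ∃ (λ j → j ∈ js × k ≡ inj₂ j) → ⊥
    disjoint (_ , _ , ≡.refl) (_ , _ , ())

  ∑Fin : ∀ d → (Fin d → Carrier) → Carrier
  ∑Fin zero    s = 0#
  ∑Fin (suc d) s = s zero + ∑Fin d (s ∘ suc)

  sum-Fin : ∀ d {f : Fin d × I → Carrier} {s : Fin d → Carrier} →
    (∀ r → HasSum (λ i → f (r , i)) (s r)) → HasSum f (∑Fin d s)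
  sum-Fin zero    hs N = record
    { support = [] ; unique = [] ; vanishing = λ { (() , _) } ; total = mod-refl }
  sum-Fin {I} (suc d) {f} hs = sum-reindex h
    (λ { {inj₁ _} {inj₁ _} ≡.refl → ≡.refl ; {inj₂ _} {inj₂ _} ≡.refl → ≡.refl })
    (λ { (zero , i) → inj₁ i , ≡.refl ; (suc r , i) → inj₂ (r , i) , ≡.refl })
    (sum-⊎ (hs zero) (sum-Fin d (λ r → hs (suc r))))
    where
    h : I ⊎ Fin d × I → Fin (suc d) × I
    h (inj₁ i)       = zero , i
    h (inj₂ (r , i)) = suc r , i

-- The finite triple product through Gaussian binomials

module ℕS = ℕSolver.+-*-Solver

-- The binomial coefficient n(n-1)/2, so that `triangle 1` is 0.
triangle : ℕ → ℕ
triangle zero    = 0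
triangle (suc n) = triangle n ℕ.+ n

triangle-+ : ∀ m n → triangle (m ℕ.+ n) ≡ triangle m ℕ.+ triangle n ℕ.+ m ℕ.* n
triangle-+ zero    n = ≡.sym (ℕ.+-identityʳ _)
triangle-+ (suc m) n = ≡.trans (≡.cong (ℕ._+ (m ℕ.+ n)) (triangle-+ m n))
  (solve 4 (λ m n s t → s :+ t :+ m :* n :+ (m :+ n) := s :+ m :+ t :+ (n :+ m :* n)) ≡.refl m n (triangle m) (triangle n))
  where open ℕS

2*triangle : ∀ n → triangle n ℕ.+ triangle n ℕ.+ n ≡ n ℕ.* n
2*triangle zero    = ≡.refl
2*triangle (suc n) = ≡.trans
  (solve 2 (λ n s → s :+ n :+ (s :+ n) :+ (con 1 :+ n) := s :+ s :+ n :+ (con 1 :+ n :+ n)) ≡.refl n (triangle n))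
  (≡.trans (≡.cong (ℕ._+ (1 ℕ.+ n ℕ.+ n)) (2*triangle n))
    (solve 1 (λ n → n :* n :+ (con 1 :+ n :+ n) := (con 1 :+ n) :* (con 1 :+ n)) ≡.refl n))
  where open ℕS

n≤triangle : ∀ n → n ≤ triangle (suc n)
n≤triangle n = ℕ.m≤n+m n (triangle n)

module TripleProduct (A : AdicRing) where
  open AdicRing A
  open Adic A
  open Sums A
  open SetoidReasoning setoid

  -- Keeping both summands a and b of N avoids the truncated subtraction N - a.
  antidiagonal : ℕ → (ℕ → ℕ → Carrier) → Carrier
  antidiagonal zero    h = h 0 0
  antidiagonal (suc N) h = h 0 (suc N) + antidiagonal N (λ a b → h (suc a) b)

  antidiagonal-snoc : ∀ N h → antidiagonal (suc N) h ≈ antidiagonal N (λ a b → h a (suc b)) + h (suc N) 0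
  antidiagonal-snoc zero    h = refl
  antidiagonal-snoc (suc N) h = trans (+-congˡ (antidiagonal-snoc N (λ a b → h (suc a) b))) (sym (+-assoc _ _ _))

  antidiagonal-cong : ∀ N {h h′} → (∀ a b → a ℕ.+ b ≡ N → h a b ≈ h′ a b) → antidiagonal N h ≈ antidiagonal N h′
  antidiagonal-cong zero    e = e 0 0 ≡.refl
  antidiagonal-cong (suc N) e = +-cong (e 0 (suc N) ≡.refl)
    (antidiagonal-cong N (λ a b a+b≡N → e (suc a) b (≡.cong suc a+b≡N)))

  antidiagonal-cong-mod : ∀ {M} N {h h′} → (∀ a b → a ℕ.+ b ≡ N → h a b ≈ h′ a b mod M) →
    antidiagonal N h ≈ antidiagonal N h′ mod M
  antidiagonal-cong-mod zero    e = e 0 0 ≡.refl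
  antidiagonal-cong-mod (suc N) e = mod-+ (e 0 (suc N) ≡.refl)
    (antidiagonal-cong-mod N (λ a b a+b≡N → e (suc a) b (≡.cong suc a+b≡N)))

  antidiagonal-+ : ∀ N h h′ → antidiagonal N (λ a b → h a b + h′ a b) ≈ antidiagonal N h + antidiagonal N h′
  antidiagonal-+ zero    h h′ = refl
  antidiagonal-+ (suc N) h h′ = trans (+-congˡ (antidiagonal-+ N _ _))
    (solve 4 (λ a b c d → a :+ b :+ (c :+ d) := a :+ c :+ (b :+ d)) refl _ _ _ _)

  antidiagonal-scale : ∀ N c h → antidiagonal N (λ a b → c * h a b) ≈ c * antidiagonal N h
  antidiagonal-scale zero    c h = refl
  antidiagonal-scale (suc N) c h = trans (+-congˡ (antidiagonal-scale N c _)) (sym (distribˡ _ _ _))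

  antidiagonal-∑ : ∀ N {I : Set} (f : I → Carrier) (g : ℕ → I) →
    antidiagonal N (λ a _ → f (g a)) ≈ ∑ f (applyUpTo g (suc N))
  antidiagonal-∑ zero    f g = sym (+-identityʳ _)
  antidiagonal-∑ (suc N) f g = +-congˡ (antidiagonal-∑ N f (g ∘ suc))

  module Gaussian (p : Carrier) where

    -- The Gaussian binomial coefficient of a + b over a in base p. The q-Pascal rule defines it
    -- without division.
    gaussian : ℕ → ℕ → Carrier
    gaussian a       zero    = 1#
    gaussian zero    (suc b) = 1#
    gaussian (suc a) (suc b) = gaussian (suc a) b + p ^ suc b * gaussian a (suc b)

    gaussian-0 : ∀ b → gaussian 0 b ≈ 1#
    gaussian-0 zero    = refl
    gaussian-0 (suc b) = refl

    factorial : ℕ → Carrier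
    factorial n = ∏< n (λ j → 1# - p ^ suc j)

    -- The quotient formula with denominators cleared. The recursion matches 1 - QP = (1 - P) + P(1
    -- - Q).
    gaussian-factorial : ∀ a b → gaussian a b * (factorial a * factorial b) ≈ factorial (a ℕ.+ b)
    gaussian-factorial a       zero    = trans (trans (*-identityˡ _) (*-identityʳ _))
      (reflexive (≡.cong factorial (≡.sym (ℕ.+-identityʳ a))))
    gaussian-factorial zero    (suc b) = trans (*-identityˡ _) (*-identityˡ _)
    gaussian-factorial (suc a) (suc b) = begin
      (g₁ + P * g₂) * (Fa * (1# - Q) * (Fb * (1# - P)))
        ≈⟨ solve 6 (λ g₁ P g₂ Fa Q Fb → (g₁ :+ P :* g₂) :* (Fa :* (𝟙 :- Q) :* (Fb :* (𝟙 :- P)))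
             := g₁ :* (Fa :* (𝟙 :- Q) :* Fb) :* (𝟙 :- P) :+ P :* (g₂ :* (Fa :* (Fb :* (𝟙 :- P)))) :* (𝟙 :- Q))
             refl g₁ P g₂ Fa Q Fb ⟩
      g₁ * (Fa * (1# - Q) * Fb) * (1# - P) + P * (g₂ * (Fa * (Fb * (1# - P)))) * (1# - Q)
        ≈⟨ +-cong (*-congʳ (gaussian-factorial (suc a) b)) (*-congʳ (*-congˡ (gaussian-factorial a (suc b)))) ⟩
      factorial (suc a ℕ.+ b) * (1# - P) + P * factorial (a ℕ.+ suc b) * (1# - Q)
        ≡⟨ ≡.cong (λ n → factorial n * (1# - P) + P * factorial (a ℕ.+ suc b) * (1# - Q)) (≡.sym (ℕ.+-suc a b)) ⟩
      F * (1# - P) + P * F * (1# - Q)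
        ≈⟨ solve 3 (λ F P Q → F :* (𝟙 :- P) :+ P :* F :* (𝟙 :- Q) := F :* (𝟙 :- Q :* P)) refl F P Q ⟩
      F * (1# - Q * P)
        ≈⟨ *-congˡ (+-congˡ (-‿cong (sym (^-homo-* p (suc a) (suc b))))) ⟩
      F * (1# - p ^ (suc a ℕ.+ suc b)) ∎
      where
      g₁ = gaussian (suc a) b
      g₂ = gaussian a (suc b)
      P  = p ^ suc b
      Q  = p ^ suc a
      Fa = factorial a
      Fb = factorial b
      F  = factorial (a ℕ.+ suc b)

    module _ (x y : Carrier) where

      term : ℕ → ℕ → Carrier
      term a b = gaussian a b * (p ^ triangle a * (x ^ b * y ^ a))

      private
        -- The contributions of x and of y p^(a+b), chosen from the last factor of the product.
        left right : ℕ → ℕ → Carrier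
        left  a       zero    = 0#
        left  a       (suc b) = x * term a b
        right zero    b       = 0#
        right (suc a) b       = y * p ^ (a ℕ.+ b) * term a b

        -- The entry at (0, 0) is the empty product and has no last factor, hence the hypothesis.
        pascal : ∀ a b → 0 < a ℕ.+ b → term a b ≈ left a b + right a b
        pascal zero    (suc b) _ = sym (trans (+-identityʳ _) (trans (*-congˡ (*-congʳ (gaussian-0 b)))
          (solve 2 (λ x X → x :* (𝟙 :* (𝟙 :* (X :* 𝟙))) := 𝟙 :* (𝟙 :* (x :* X :* 𝟙))) refl x (x ^ b))))
        pascal (suc a) zero    _ = sym (trans (+-identityˡ _) (begin
          y * p ^ (a ℕ.+ 0) * (1# * (p ^ triangle a * (1# * y ^ a)))
            ≡⟨ ≡.cong (λ n → y * p ^ n * (1# * (p ^ triangle a * (1# * y ^ a)))) (ℕ.+-identityʳ a) ⟩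
          y * p ^ a * (1# * (p ^ triangle a * (1# * y ^ a)))
            ≈⟨ solve 4 (λ y P T Y → y :* P :* (𝟙 :* (T :* (𝟙 :* Y))) := 𝟙 :* ((T :* P) :* (𝟙 :* (y :* Y))))
                 refl y (p ^ a) (p ^ triangle a) (y ^ a) ⟩
          1# * (p ^ triangle a * p ^ a * (1# * (y * y ^ a)))
            ≈⟨ *-congˡ (*-congʳ (sym (^-homo-* p (triangle a) a))) ⟩
          term (suc a) zero ∎))
        pascal (suc a) (suc b) _ = sym (begin
          x * (g₁ * (p ^ triangle (suc a) * (X * (y * Y)))) + y * p ^ (a ℕ.+ suc b) * (g₂ * (T * (x * X * Y)))
            ≈⟨ +-cong (*-congˡ (*-congˡ (*-congʳ T+))) (*-congʳ (*-congˡ (^-homo-* p a (suc b)))) ⟩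
          x * (g₁ * (T * p ^ a * (X * (y * Y)))) + y * (p ^ a * p ^ suc b) * (g₂ * (T * (x * X * Y)))
            ≈⟨ solve 9 (λ x y g₁ g₂ T X Y Pa Pb →
                 x :* (g₁ :* (T :* Pa :* (X :* (y :* Y)))) :+ y :* (Pa :* Pb) :* (g₂ :* (T :* (x :* X :* Y)))
                 := (g₁ :+ Pb :* g₂) :* (T :* Pa :* (x :* X :* (y :* Y)))) refl x y g₁ g₂ T X Y (p ^ a) (p ^ suc b) ⟩
          (g₁ + p ^ suc b * g₂) * (T * p ^ a * (x * X * (y * Y)))
            ≈⟨ *-congˡ (*-congʳ (sym T+)) ⟩
          term (suc a) (suc b) ∎)
          where
          g₁ = gaussian (suc a) b
          g₂ = gaussian a (suc b)
          T  = p ^ triangle a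
          X  = x ^ b
          Y  = y ^ a
          T+ = ^-homo-* p (triangle a) a

      -- Cauchy's q-binomial theorem. The form homogeneous in x and y permits the specialisation of
      -- x to a power of p without inverting it.
      q-binomial : ∀ N → ∏< N (λ j → x + y * p ^ j) ≈ antidiagonal N term
      q-binomial zero    = solve 0 (𝟙 := 𝟙 :* (𝟙 :* (𝟙 :* 𝟙))) refl
      q-binomial (suc N) = sym (begin
        antidiagonal (suc N) term
          ≈⟨ antidiagonal-cong (suc N) (λ a b a+b≡ → pascal a b (≡.subst (0 <_) (≡.sym a+b≡) (s≤s z≤n))) ⟩
        antidiagonal (suc N) (λ a b → left a b + right a b)
          ≈⟨ antidiagonal-+ (suc N) left right ⟩
        antidiagonal (suc N) left + antidiagonal (suc N) right
          -- On the antidiagonal `left` vanishes at the last entry (b = 0) and `right` at the first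
          -- (a = 0).
          ≈⟨ +-cong (trans (antidiagonal-snoc N left) (+-identityʳ _)) (+-identityˡ _) ⟩
        antidiagonal N (λ a b → x * term a b) + antidiagonal N (λ a b → y * p ^ (a ℕ.+ b) * term a b)
          ≈⟨ +-cong (antidiagonal-scale N x term) (trans
               (antidiagonal-cong N (λ a b a+b≡N → *-congʳ (*-congˡ (reflexive (≡.cong (p ^_) a+b≡N)))))
               (antidiagonal-scale N (y * p ^ N) term)) ⟩
        x * antidiagonal N term + y * p ^ N * antidiagonal N term
          ≈⟨ sym (distribʳ _ _ _) ⟩
        (x + y * p ^ N) * antidiagonal N term
          ≈⟨ trans (*-comm _ _) (*-congʳ (sym (q-binomial N))) ⟩
        ∏< (suc N) (λ j → x + y * p ^ j) ∎)

  -- This is (-z)^m p^(m(m-1)/2) for every integer m. Negative powers of z are expressed through w =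
  -- p/z, since z need not be invertible.
  jacobiTerm : Carrier → Carrier → Carrier → ℤ → Carrier
  jacobiTerm p z w (+ m)    = (- z) ^ m * p ^ triangle m
  jacobiTerm p z w -[1+ m ] = (- w) ^ suc m * p ^ triangle (suc m)

  module FiniteTripleProduct {p z w : Carrier} (zw≈p : z * w ≈ p) (regular-p : Regular p) where
    open Gaussian p

    private
      regular-−z : Regular (- z)
      regular-−z {x} {y} e = regular-p (begin
        p * x           ≈⟨ *-congʳ (sym zw≈p) ⟩
        z * w * x       ≈⟨ solve 3 (λ z w x → z :* w :* x := :- w :* (:- z :* x)) refl z w x ⟩
        - w * (- z * x) ≈⟨ *-congˡ e ⟩
        - w * (- z * y) ≈⟨ solve 3 (λ z w x → :- w :* (:- z :* x) := z :* w :* x) refl z w y ⟩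
        z * w * y       ≈⟨ *-congʳ zw≈p ⟩
        p * y           ∎)

    -- As p = zw, the factor at j is -z p^j (1 - w p^(n-1-j)). The factors in w thus appear in
    -- reverse order, and the induction peels off the first factor on the left and the last on the
    -- right.
    lower : ∀ n → ∏< n (λ j → p ^ n + - z * p ^ j) ≈ (- z) ^ n * p ^ triangle n * ∏< n (λ j → 1# - w * p ^ j)
    lower zero    = solve 0 (𝟙 := 𝟙 :* 𝟙 :* 𝟙) refl
    lower (suc n) = begin
      ∏< (suc n) (λ j → p ^ suc n + - z * p ^ j)
        ≈⟨ ∏-cons n _ ⟩
      (p * p ^ n + - z * 1#) * ∏< n (λ j → p * p ^ n + - z * (p * p ^ j))
        ≈⟨ *-cong (+-congʳ (*-congʳ (sym zw≈p))) (∏-cong n λ j →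
             solve 4 (λ p P z X → p :* P :+ :- z :* (p :* X) := p :* (P :+ :- z :* X)) refl p (p ^ n) z (p ^ j)) ⟩
      (z * w * p ^ n + - z * 1#) * ∏< n (λ j → p * (p ^ n + - z * p ^ j))
        ≈⟨ *-cong (solve 3 (λ z w P → z :* w :* P :+ :- z :* 𝟙 := :- z :* (𝟙 :- w :* P)) refl z w (p ^ n))
             (trans (∏-* n _ _) (*-cong (∏-const n p) (lower n))) ⟩
      (- z * (1# - w * p ^ n)) * (p ^ n * ((- z) ^ n * p ^ triangle n * W))
        ≈⟨ solve 6 (λ z′ w P Z T W → z′ :* (𝟙 :- w :* P) :* (P :* (Z :* T :* W)) := z′ :* Z :* (T :* P) :* (W :* (𝟙 :- w :* P)))
             refl (- z) w (p ^ n) ((- z) ^ n) (p ^ triangle n) W ⟩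
      - z * (- z) ^ n * (p ^ triangle n * p ^ n) * (W * (1# - w * p ^ n))
        ≈⟨ *-congʳ (*-congˡ (sym (^-homo-* p (triangle n) n))) ⟩
      (- z) ^ suc n * p ^ triangle (suc n) * ∏< (suc n) (λ j → 1# - w * p ^ j) ∎
      where W = ∏< n (λ j → 1# - w * p ^ j)

    upper : ∀ n → ∏< n (λ j → p ^ n + - z * p ^ (n ℕ.+ j)) ≈ (p ^ n) ^ n * ∏< n (λ j → 1# - z * p ^ j)
    upper n = begin
      ∏< n (λ j → p ^ n + - z * p ^ (n ℕ.+ j))
        ≈⟨ ∏-cong n (λ j → trans (+-congˡ (*-congˡ (^-homo-* p n j)))
             (solve 3 (λ P z X → P :+ :- z :* (P :* X) := P :* (𝟙 :- z :* X)) refl (p ^ n) z (p ^ j))) ⟩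
      ∏< n (λ j → p ^ n * (1# - z * p ^ j))
        ≈⟨ trans (∏-* n _ _) (*-congʳ (∏-const n (p ^ n))) ⟩
      (p ^ n) ^ n * ∏< n (λ j → 1# - z * p ^ j) ∎

    -- What the two halves of the product of 2n factors p^n - z p^j have in excess of the two finite
    -- products in w and z.
    shiftFactor : ℕ → Carrier
    shiftFactor n = (- z) ^ n * p ^ triangle n * (p ^ n) ^ n

    regular-shift : ∀ n → Regular (shiftFactor n)
    regular-shift n = regular-* (regular-* (regular-^ regular-−z n) (regular-^ regular-p (triangle n)))
      (regular-^ (regular-^ regular-p n) n)

    private
      P^ : ∀ m n → p ^ m * p ^ n ≈ p ^ (m ℕ.+ n)
      P^ m n = sym (^-homo-* p m n)

      above : ∀ m b → let n = m ℕ.+ b in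
        p ^ triangle (n ℕ.+ m) * ((p ^ n) ^ b * (- z) ^ (n ℕ.+ m)) ≈ shiftFactor n * jacobiTerm p z w (+ m)
      above m b = begin
        p ^ triangle (n ℕ.+ m) * ((p ^ n) ^ b * (- z) ^ (n ℕ.+ m))
          ≈⟨ *-cong refl (*-cong (^-assocʳ p n b) (^-homo-* (- z) n m)) ⟩
        p ^ triangle (n ℕ.+ m) * (p ^ (n ℕ.* b) * (Zn * Zm))
          ≈⟨ solve 4 (λ T S Zn Zm → T :* (S :* (Zn :* Zm)) := T :* S :* (Zn :* Zm)) refl _ _ Zn Zm ⟩
        p ^ triangle (n ℕ.+ m) * p ^ (n ℕ.* b) * (Zn * Zm)
          ≈⟨ *-congʳ (P^ (triangle (n ℕ.+ m)) (n ℕ.* b)) ⟩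
        p ^ (triangle (n ℕ.+ m) ℕ.+ n ℕ.* b) * (Zn * Zm)
          ≡⟨ ≡.cong (λ e → p ^ e * (Zn * Zm)) exponent ⟩
        p ^ (triangle n ℕ.+ n ℕ.* n ℕ.+ triangle m) * (Zn * Zm)
          ≈⟨ *-congʳ (trans (^-homo-* p (triangle n ℕ.+ n ℕ.* n) (triangle m))
               (*-congʳ (trans (^-homo-* p (triangle n) (n ℕ.* n)) (*-congˡ (sym (^-assocʳ p n n)))))) ⟩
        p ^ triangle n * (p ^ n) ^ n * p ^ triangle m * (Zn * Zm)
          ≈⟨ solve 5 (λ T S U Zn Zm → T :* S :* U :* (Zn :* Zm) := Zn :* T :* S :* (Zm :* U)) refl _ _ _ Zn Zm ⟩
        shiftFactor n * ((- z) ^ m * p ^ triangle m) ∎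
        where
        n  = m ℕ.+ b
        Zn = (- z) ^ n
        Zm = (- z) ^ m
        exponent : triangle (n ℕ.+ m) ℕ.+ n ℕ.* b ≡ triangle n ℕ.+ n ℕ.* n ℕ.+ triangle m
        exponent = ≡.trans (≡.cong (ℕ._+ n ℕ.* b) (triangle-+ n m))
          (ℕS.solve 4 (λ m b s t → let n = m ℕS.:+ b in s ℕS.:+ t ℕS.:+ n ℕS.:* m ℕS.:+ n ℕS.:* b ℕS.:= s ℕS.:+ n ℕS.:* n ℕS.:+ t)
            ≡.refl m b (triangle n) (triangle m))

      below : ∀ a m → let n = a ℕ.+ m in
        p ^ triangle a * ((p ^ n) ^ (n ℕ.+ m) * (- z) ^ a) ≈ shiftFactor n * ((- w) ^ m * p ^ triangle m)
      below a m = begin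
        p ^ triangle a * ((p ^ n) ^ (n ℕ.+ m) * Za)
          ≈⟨ *-congˡ (*-congʳ (^-assocʳ p n (n ℕ.+ m))) ⟩
        p ^ triangle a * (p ^ (n ℕ.* (n ℕ.+ m)) * Za)
          ≈⟨ trans (sym (*-assoc _ _ _)) (*-congʳ (P^ (triangle a) (n ℕ.* (n ℕ.+ m)))) ⟩
        p ^ (triangle a ℕ.+ n ℕ.* (n ℕ.+ m)) * Za
          ≡⟨ ≡.cong (λ e → p ^ e * Za) exponent ⟩
        p ^ (triangle n ℕ.+ n ℕ.* n ℕ.+ (m ℕ.+ triangle m)) * Za
          ≈⟨ *-congʳ (trans (^-homo-* p (triangle n ℕ.+ n ℕ.* n) (m ℕ.+ triangle m))
               (*-cong (trans (^-homo-* p (triangle n) (n ℕ.* n)) (*-congˡ (sym (^-assocʳ p n n)))) (^-homo-* p m (triangle m)))) ⟩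
        p ^ triangle n * (p ^ n) ^ n * (p ^ m * p ^ triangle m) * Za
          ≈⟨ *-congʳ (*-congˡ (*-congʳ zw^)) ⟩
        p ^ triangle n * (p ^ n) ^ n * ((- z) ^ m * (- w) ^ m * p ^ triangle m) * Za
          ≈⟨ solve 6 (λ T S Zm Wm U Za → T :* S :* (Zm :* Wm :* U) :* Za := Za :* Zm :* T :* S :* (Wm :* U)) refl _ _ _ _ _ Za ⟩
        Za * (- z) ^ m * p ^ triangle n * (p ^ n) ^ n * ((- w) ^ m * p ^ triangle m)
          ≈⟨ *-congʳ (*-congʳ (*-congʳ (sym (^-homo-* (- z) a m)))) ⟩
        shiftFactor n * ((- w) ^ m * p ^ triangle m) ∎
        where
        n  = a ℕ.+ m
        Za = (- z) ^ a
        -- Supplies the m powers of -z that are missing to the left of the middle term, at the price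
        -- of powers of -w.
        zw^ : p ^ m ≈ (- z) ^ m * (- w) ^ m
        zw^ = trans (^-congˡ m (trans (sym zw≈p) (solve 2 (λ z w → z :* w := :- z :* :- w) refl z w))) (^-distrib-* (- z) (- w) m)
        exponent : triangle a ℕ.+ n ℕ.* (n ℕ.+ m) ≡ triangle n ℕ.+ n ℕ.* n ℕ.+ (m ℕ.+ triangle m)
        exponent = ≡.trans
          (ℕS.solve 3 (λ a m s → let n = a ℕS.:+ m in
             s ℕS.:+ n ℕS.:* (n ℕS.:+ m) ℕS.:= s ℕS.:+ n ℕS.:* n ℕS.:+ a ℕS.:* m ℕS.:+ m ℕS.:* m) ≡.refl a m (triangle a))
          (≡.trans (≡.cong (triangle a ℕ.+ n ℕ.* n ℕ.+ a ℕ.* m ℕ.+_) (≡.sym (2*triangle m)))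
          (≡.trans
          (ℕS.solve 4 (λ a m s t → let n = a ℕS.:+ m in
             s ℕS.:+ n ℕS.:* n ℕS.:+ a ℕS.:* m ℕS.:+ (t ℕS.:+ t ℕS.:+ m) ℕS.:= (s ℕS.:+ t ℕS.:+ a ℕS.:* m) ℕS.:+ n ℕS.:* n ℕS.:+ (m ℕS.:+ t))
             ≡.refl a m (triangle a) (triangle m))
          (≡.cong (λ s → s ℕ.+ n ℕ.* n ℕ.+ (m ℕ.+ triangle m)) (≡.sym (triangle-+ a m)))))

    -- Completes the square around the middle index n: what is left of the exponent of p depends
    -- only on the distance of a from n.
    term-shift : ∀ n a b → a ℕ.+ b ≡ n ℕ.+ n →
      p ^ triangle a * ((p ^ n) ^ b * (- z) ^ a) ≈ shiftFactor n * jacobiTerm p z w (a ⊖ n)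
    term-shift n a b a+b≡2n with ℕ.≤-total n a
    ... | inj₁ n≤a with m , ≡.refl ← ℕ.m≤n⇒∃[o]m+o≡n n≤a
          with ≡.refl ← ℕ.+-cancelˡ-≡ n (m ℕ.+ b) n (≡.trans (≡.sym (ℕ.+-assoc n m b)) a+b≡2n)
          = trans (above m b) (*-congˡ (reflexive (≡.cong (jacobiTerm p z w) (≡.sym
              (≡.trans (≡.cong ((n ℕ.+ m) ⊖_) (≡.sym (ℕ.+-identityʳ n))) (ℤ.+-cancelˡ-⊖ n m 0))))))
    ... | inj₂ a≤n with m , ≡.refl ← ℕ.m≤n⇒∃[o]m+o≡n a≤n
          with ≡.refl ← ℕ.+-cancelˡ-≡ a b (a ℕ.+ m ℕ.+ m) (≡.trans a+b≡2n
                 (ℕS.solve 2 (λ a m → a ℕS.:+ m ℕS.:+ (a ℕS.:+ m) ℕS.:= a ℕS.:+ (a ℕS.:+ m ℕS.:+ m)) ≡.refl a m))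
          = trans (below a m) (*-congˡ (trans (reindexed m)
              (reflexive (≡.cong (jacobiTerm p z w) (≡.sym
                (≡.trans (≡.cong (_⊖ (a ℕ.+ m)) (≡.sym (ℕ.+-identityʳ a))) (ℤ.+-cancelˡ-⊖ a 0 m)))))))
      where
      reindexed : ∀ m → (- w) ^ m * p ^ triangle m ≈ jacobiTerm p z w (0 ⊖ m)
      reindexed zero    = refl
      reindexed (suc m) = refl

    -- Cauchy's derivation: in the q-binomial theorem with 2n factors take x = p^n and y = -z. The
    -- factors below n produce the product in w, those from n on the product in z.
    finite-triple-product : ∀ n →
      ∏< n (λ j → 1# - z * p ^ j) * ∏< n (λ j → 1# - w * p ^ j)
        ≈ antidiagonal (n ℕ.+ n) (λ a b → gaussian a b * jacobiTerm p z w (a ⊖ n))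
    finite-triple-product n = regular-shift n (begin
      shiftFactor n * (Z * W)
        ≈⟨ solve 5 (λ A B C Z W → A :* B :* C :* (Z :* W) := A :* B :* W :* (C :* Z)) refl _ _ _ Z W ⟩
      (- z) ^ n * p ^ triangle n * W * ((p ^ n) ^ n * Z)
        ≈⟨ sym (*-cong (lower n) (upper n)) ⟩
      ∏< n (λ j → p ^ n + - z * p ^ j) * ∏< n (λ j → p ^ n + - z * p ^ (n ℕ.+ j))
        ≈⟨ sym (∏-+ n n _) ⟩
      ∏< (n ℕ.+ n) (λ j → p ^ n + - z * p ^ j)
        ≈⟨ q-binomial (p ^ n) (- z) (n ℕ.+ n) ⟩
      antidiagonal (n ℕ.+ n) (λ a b → gaussian a b * (p ^ triangle a * ((p ^ n) ^ b * (- z) ^ a)))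
        ≈⟨ antidiagonal-cong (n ℕ.+ n) (λ a b e → trans (*-congˡ (term-shift n a b e))
             (solve 3 (λ g s t → g :* (s :* t) := s :* (g :* t)) refl _ _ _)) ⟩
      antidiagonal (n ℕ.+ n) (λ a b → shiftFactor n * (gaussian a b * jacobiTerm p z w (a ⊖ n)))
        ≈⟨ antidiagonal-scale (n ℕ.+ n) (shiftFactor n) _ ⟩
      shiftFactor n * antidiagonal (n ℕ.+ n) (λ a b → gaussian a b * jacobiTerm p z w (a ⊖ n)) ∎)
      where
      Z = ∏< n (λ j → 1# - z * p ^ j)
      W = ∏< n (λ j → 1# - w * p ^ j)

-- The Jacobi triple product as a q-adic limit

module JacobiTripleProduct (A : AdicRing) where
  open AdicRing A
  open Adic A
  open Sums A
  open TripleProduct A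

  module _ {k : ℕ} .{{_ : NonZero k}} {z w Z W P : Carrier} (zw≈p : z * w ≈ q ^ k)
           (hZ : HasProduct (λ j → 1# - z * (q ^ k) ^ j) Z)
           (hW : HasProduct (λ j → 1# - w * (q ^ k) ^ j) W)
           (hP : HasProduct (λ j → 1# - q ^ k * (q ^ k) ^ j) P) where

    private
      p = q ^ k
      jac = jacobiTerm p z w

    open Gaussian p
    open FiniteTripleProduct zw≈p (regular-^ regular-q k)

    private
      p^≈0 : ∀ {N n} → N ≤ n → p ^ n ≈ 0# mod N
      p^≈0 {N} {n} N≤n = mod-trans (≈⇒mod N (^-assocʳ q k n)) (q^≈0 (ℕ.≤-trans N≤n (ℕ.m≤n*m n k)))

      jac≈0 : ∀ {N} m → N < ∣ m ∣ → jac m ≈ 0# mod N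
      jac≈0 (+ suc m)  (s≤s N≤m) = *-≈0ʳ (p^≈0 (ℕ.≤-trans N≤m (n≤triangle m))) _
      jac≈0 -[1+ m ]   (s≤s N≤m) = *-≈0ʳ (p^≈0 (ℕ.≤-trans N≤m (n≤triangle m))) _

      principal-P : Principal P
      principal-P = product-principal hP (mod-trans
        (mod-+ (mod-refl {1#}) (mod-‿- (*-≈0ˡ (q^≈0 (ℕ.>-nonZero⁻¹ k)) 1#)))
        (≈⇒mod 1 (trans (sym (+-identityʳ _)) (solve 1 (λ z → 𝟙 :- z :+ z := 𝟙) refl 0#))))

      -- All three factorials in the quotient formula are P modulo `q ^ N`, so gaussian · P² = P. An
      -- extra factor P is introduced and cancelled.
      gaussian-limit : ∀ {N} a b → N ≤ a → N ≤ b → P * gaussian a b ≈ 1# mod N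
      gaussian-limit {N} a b N≤a N≤b = principal-cancel-mod principal-P (begin
        P * (P * gaussian a b)                        ≈⟨ ≈⇒mod N (solve 2 (λ P g → P :* (P :* g) := g :* (P :* P)) refl P _) ⟩
        gaussian a b * (P * P)                        ≈⟨ mod-* mod-refl (mod-* (F≈P a N≤a) (F≈P b N≤b)) ⟨
        gaussian a b * (factorial a * factorial b)    ≈⟨ ≈⇒mod N (gaussian-factorial a b) ⟩
        factorial (a ℕ.+ b)                           ≈⟨ F≈P (a ℕ.+ b) (ℕ.≤-trans N≤a (ℕ.m≤m+n a b)) ⟩
        P                                             ≈⟨ ≈⇒mod N (*-identityʳ P) ⟨
        P * 1#                                        ∎)
        where
        open SetoidReasoning (mod-setoid N)
        F≈P : ∀ n → N ≤ n → factorial n ≈ P mod N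
        F≈P n N≤n = mod-≤ N≤n (hP n)

      module Truncated (N : ℕ) where
        -- With n = 2N, an entry with a < N or b < N has |a - n| > N, where the Jacobi term is
        -- negligible; all other entries satisfy N ≤ a and N ≤ b, where the Gaussian coefficient has
        -- reached its limit.
        n = N ℕ.+ N

        N≤n : N ≤ n
        N≤n = ℕ.m≤m+n N N

        covered : ∀ m → ∣ m ∣ ≤ n → m ∈ applyUpTo (_⊖ n) (suc (n ℕ.+ n))
        covered (+ m) m≤n = ≡.subst (_∈ applyUpTo (_⊖ n) (suc (n ℕ.+ n)))
          (≡.trans (≡.cong ((n ℕ.+ m) ⊖_) (≡.sym (ℕ.+-identityʳ n))) (ℤ.+-cancelˡ-⊖ n m 0))
          (∈-applyUpTo⁺ (_⊖ n) (s≤s (ℕ.+-monoʳ-≤ n m≤n)))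
        covered -[1+ m ] m≤n = ≡.subst (_∈ applyUpTo (_⊖ n) (suc (n ℕ.+ n)))
          (≡.trans (ℤ.⊖-≤ (ℕ.m∸n≤m n (suc m))) (≡.cong (λ e → ℤ.- + e) (ℕ.m∸[m∸n]≡n m≤n)))
          (∈-applyUpTo⁺ (_⊖ n) (s≤s (ℕ.≤-trans (ℕ.m∸n≤m n (suc m)) (ℕ.m≤m+n n n))))

        n∸a : ∀ {a} → a < N → N < n ∸ a
        n∸a {a} a<N = ℕ.m+n≤o⇒m≤o∸n (suc N) (ℕ.≤-trans (ℕ.≤-reflexive (≡.sym (ℕ.+-suc N a))) (ℕ.+-monoʳ-≤ N a<N))

        far-below : ∀ {a} → a < N → N < ∣ a ⊖ n ∣
        far-below {a} a<N = ≡.subst (N <_) (≡.sym (ℤ.∣⊖∣-≤ (ℕ.≤-trans (ℕ.<⇒≤ a<N) N≤n))) (n∸a a<N)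

        far-above : ∀ {a b} → a ℕ.+ b ≡ n ℕ.+ n → b < N → N < ∣ a ⊖ n ∣
        far-above {a} {b} a+b≡ b<N = ≡.subst (N <_) (≡.sym (≡.trans (ℤ.∣m⊖n∣≡∣n⊖m∣ a n)
          (≡.trans (ℤ.∣⊖∣-≤ n≤a) a∸n≡))) (n∸a b<N)
          where
          b≤n : b ≤ n
          b≤n = ℕ.≤-trans (ℕ.<⇒≤ b<N) N≤n
          a≡ : a ≡ n ℕ.+ (n ∸ b)
          a≡ = ≡.trans (≡.sym (ℕ.m+n∸n≡m a b)) (≡.trans (≡.cong (_∸ b) a+b≡) (ℕ.+-∸-assoc n b≤n))
          n≤a : n ≤ a
          n≤a = ≡.subst (n ≤_) (≡.sym a≡) (ℕ.m≤m+n n (n ∸ b))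
          a∸n≡ : a ∸ n ≡ n ∸ b
          a∸n≡ = ≡.trans (≡.cong (_∸ n) a≡) (ℕ.m+n∸m≡n n (n ∸ b))

        negligible : ∀ a b → N < ∣ a ⊖ n ∣ → jac (a ⊖ n) ≈ P * (gaussian a b * jac (a ⊖ n)) mod N
        negligible a b far = mod-trans (jac≈0 (a ⊖ n) far) (mod-sym (*-≈0ʳ (*-≈0ʳ (jac≈0 (a ⊖ n) far) _) P))

        term≈ : ∀ a b → a ℕ.+ b ≡ n ℕ.+ n → jac (a ⊖ n) ≈ P * (gaussian a b * jac (a ⊖ n)) mod N
        term≈ a b a+b≡ with N ℕ.≤? a | N ℕ.≤? b
        ... | yes N≤a | yes N≤b = mod-sym (mod-trans (≈⇒mod N (sym (*-assoc P _ _)))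
              (mod-trans (mod-* (gaussian-limit a b N≤a N≤b) mod-refl) (≈⇒mod N (*-identityˡ _))))
        ... | no N≰a  | _       = negligible a b (far-below (ℕ.≰⇒> N≰a))
        ... | yes _   | no N≰b  = negligible a b (far-above a+b≡ (ℕ.≰⇒> N≰b))

        open SetoidReasoning (mod-setoid N)

        total≈ : ∑ jac (applyUpTo (_⊖ n) (suc (n ℕ.+ n))) ≈ Z * W * P mod N
        total≈ = begin
          ∑ jac (applyUpTo (_⊖ n) (suc (n ℕ.+ n)))
            ≈⟨ ≈⇒mod N (antidiagonal-∑ (n ℕ.+ n) jac (_⊖ n)) ⟨
          antidiagonal (n ℕ.+ n) (λ a _ → jac (a ⊖ n))
            ≈⟨ antidiagonal-cong-mod (n ℕ.+ n) term≈ ⟩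
          antidiagonal (n ℕ.+ n) (λ a b → P * (gaussian a b * jac (a ⊖ n)))
            ≈⟨ ≈⇒mod N (trans (antidiagonal-scale (n ℕ.+ n) P _) (*-comm P _)) ⟩
          antidiagonal (n ℕ.+ n) (λ a b → gaussian a b * jac (a ⊖ n)) * P
            ≈⟨ ≈⇒mod N (*-congʳ (finite-triple-product n)) ⟨
          ∏< n (λ j → 1# - z * p ^ j) * ∏< n (λ j → 1# - w * p ^ j) * P
            ≈⟨ mod-* (mod-* (mod-≤ N≤n (hZ n)) (mod-≤ N≤n (hW n))) mod-refl ⟩
          Z * W * P ∎

    -- The limit of the finite identity: the Gaussian coefficients tend to 1/P, which is why P joins
    -- the product side.
    triple-product : HasSum jac (Z * W * P)
    triple-product N = record
      { support   = applyUpTo (_⊖ n) (suc (n ℕ.+ n))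
      ; unique    = Unique.applyUpTo⁺₁ (_⊖ n) _ (λ i<j _ e → ℤ.<-irrefl e (ℤ.⊖-monoˡ-< n i<j))
      ; vanishing = λ m m∉ → jac≈0 m (ℕ.≰⇒> λ m≤N → m∉ (covered m (ℕ.≤-trans m≤N N≤n)))
      ; total     = total≈
      }
      where open Truncated N

-- Bijections of index sets and the exponents of theta series

module ℤ+ = AbelianGroupProperties ℤ.+-0-abelianGroup

module ℤS = ℤSolver.+-*-Solver

residueClass : ∀ d → Fin d × ℤ → ℤ
residueClass d (r , m) = + toℕ r ℤ.+ m ℤ.* + d

-- The multiple (m′ - m) d equals a difference of two residues, which is less than d in absolute
-- value.
residueClass-injective : ∀ d {x y} → residueClass d x ≡ residueClass d y → x ≡ y
residueClass-injective d {r , m} {r′ , m′} e = ≡.cong₂ _,_ r≡r′ m≡m′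
  where
  difference : (m′ ℤ.- m) ℤ.* + d ≡ toℕ r ⊖ toℕ r′
  difference = begin
    (m′ ℤ.- m) ℤ.* + d
      ≡⟨ solve 4 (λ r m m′ d → (m′ :- m) :* d := r :+ m′ :* d :- (r :+ m :* d)) ≡.refl (+ toℕ r′) m m′ (+ d) ⟩
    + toℕ r′ ℤ.+ m′ ℤ.* + d ℤ.- (+ toℕ r′ ℤ.+ m ℤ.* + d)
      ≡⟨ ≡.cong (ℤ._- (+ toℕ r′ ℤ.+ m ℤ.* + d)) (≡.sym e) ⟩
    + toℕ r ℤ.+ m ℤ.* + d ℤ.- (+ toℕ r′ ℤ.+ m ℤ.* + d)
      ≡⟨ solve 3 (λ r r′ md → r :+ md :- (r′ :+ md) := r :- r′) ≡.refl (+ toℕ r) (+ toℕ r′) (m ℤ.* + d) ⟩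
    + toℕ r ℤ.- + toℕ r′
      ≡⟨ ℤ.[+m]-[+n]≡m⊖n (toℕ r) (toℕ r′) ⟩
    toℕ r ⊖ toℕ r′ ∎
    where
    open ≡.≡-Reasoning
    open ℤS

  small : ∣ m′ ℤ.- m ∣ ℕ.* d < 1 ℕ.* d
  small = ℕ.≤-trans (ℕ.s≤s (ℕ.≤-reflexive (≡.trans (≡.sym (ℤ.abs-* (m′ ℤ.- m) (+ d))) (≡.cong ∣_∣ difference))))
    (ℕ.≤-trans (ℕ.s≤s (ℤ.∣m⊝n∣≤m⊔n (toℕ r) (toℕ r′)))
    (ℕ.≤-trans (ℕ.⊔-lub (Fin.toℕ<n r) (Fin.toℕ<n r′)) (ℕ.≤-reflexive (≡.sym (ℕ.*-identityˡ d)))))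

  m≡m′ : m ≡ m′
  m≡m′ = ≡.sym (ℤ.i-j≡0⇒i≡j m′ m (ℤ.∣i∣≡0⇒i≡0 (ℕ.n<1⇒n≡0 (ℕ.*-cancelʳ-< d ∣ m′ ℤ.- m ∣ 1 small))))

  r≡r′ : r ≡ r′
  r≡r′ = Fin.toℕ-injective (ℤ.+-injective (ℤ+.∙-cancelʳ (m ℤ.* + d) _ _
    (≡.trans e (≡.cong (λ m → + toℕ r′ ℤ.+ m ℤ.* + d) (≡.sym m≡m′)))))

residueClass-surjective : ∀ d .{{_ : NonZero d}} n → ∃ λ x → residueClass d x ≡ n
residueClass-surjective d n = (fromℕ< (ℤ.n%ℕd<d n d) , n ℤ./ℕ d) , ≡.trans
  (≡.cong (λ r → + r ℤ.+ (n ℤ./ℕ d) ℤ.* + d) (Fin.toℕ-fromℕ< (ℤ.n%ℕd<d n d)))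
  (≡.sym (ℤ.a≡a%ℕn+[a/ℕn]*n n d))

-- r is the parity of the sum of the two coordinates of the image.
rotate : Fin 2 × ℤ × ℤ → ℤ × ℤ
rotate (r , u , v) = u ℤ.+ v ℤ.+ + toℕ r , u ℤ.- v

rotate-sum : ∀ r u v → r ℤ.+ u ℤ.* + 2 ≡ (u ℤ.+ v ℤ.+ r) ℤ.+ (u ℤ.- v)
rotate-sum = solve 3 (λ r u v → r :+ u :* con (+ 2) := (u :+ v :+ r) :+ (u :- v)) ≡.refl
  where open ℤS

-- The coordinates of the image add up to r + 2u, which determines r and u; the second coordinate
-- then gives v.
rotate-injective : ∀ {x y} → rotate x ≡ rotate y → x ≡ y
rotate-injective {r , u , v} {r′ , u′ , v′} e
  with ≡.refl ← residueClass-injective 2 {r , u} {r′ , u′} (≡.trans (rotate-sum (+ toℕ r) u v)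
                  (≡.trans (≡.cong₂ ℤ._+_ (≡.cong proj₁ e) (≡.cong proj₂ e)) (≡.sym (rotate-sum (+ toℕ r′) u′ v′))))
  with ≡.refl ← ℤ.neg-injective (ℤ+.∙-cancelˡ u _ _ (≡.cong proj₂ e)) = ≡.refl

rotate-surjective : ∀ x → ∃ λ y → rotate y ≡ x
rotate-surjective (m , n) with (r , u) , e ← residueClass-surjective 2 (m ℤ.+ n) = (r , u , u ℤ.- n) , ≡.cong₂ _,_
  (≡.trans (solve 3 (λ r u n → u :+ (u :- n) :+ r := r :+ u :* con (+ 2) :- n) ≡.refl (+ toℕ r) u n)
    (≡.trans (≡.cong (ℤ._- n) e) (solve 2 (λ m n → m :+ n :- n := m) ≡.refl m n)))
  (solve 2 (λ u n → u :- (u :- n) := n) ≡.refl u n)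
  where open ℤS

-- It turns 5m + (5 - t) into -(5m + t), which pairs opposite residue classes modulo 5.
reflect : ℤ → ℤ
reflect m = -1ℤ ℤ.- m

reflect-involutive : ∀ m → reflect (reflect m) ≡ m
reflect-involutive = solve 1 (λ m → con -1ℤ :- (con -1ℤ :- m) := m) ≡.refl
  where open ℤS

-- The exponent of q in the m-th term of Ramanujan's f(q^i, q^j).
thetaExponent : ℕ → ℕ → ℤ → ℕ
thetaExponent i j (+ m)    = (i ℕ.+ j) ℕ.* triangle m ℕ.+ i ℕ.* m
thetaExponent i j -[1+ m ] = (i ℕ.+ j) ℕ.* triangle (suc m) ℕ.+ j ℕ.* suc m

double : ℤ → ℤ
double e = e ℤ.+ e

double-injective : ∀ {a b} → double (+ a) ≡ double (+ b) → a ≡ b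
double-injective {a} {b} e = ℕ.*-cancelˡ-≡ a b 2 (≡.trans (twice a) (≡.trans (ℤ.+-injective e) (≡.sym (twice b))))
  where
  twice : ∀ n → 2 ℕ.* n ≡ n ℕ.+ n
  twice n = ≡.cong (n ℕ.+_) (ℕ.+-identityʳ n)

-- Twice the exponent, as a single polynomial (i+j)m(m-1) + 2im valid for both signs of m.
-- Identities between exponents become polynomial identities over the integers.
thetaQuadratic : ℤ → ℤ → ℤ → ℤ
thetaQuadratic i j m = (i ℤ.+ j) ℤ.* (m ℤ.* m) ℤ.+ (i ℤ.- j) ℤ.* m

double-thetaExponent : ∀ i j m → double (+ thetaExponent i j m) ≡ thetaQuadratic (+ i) (+ j) m
double-thetaExponent i j (+ m) = begin
  + (s ℕ.* t ℕ.+ i ℕ.* m ℕ.+ (s ℕ.* t ℕ.+ i ℕ.* m))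
    ≡⟨ ≡.cong +_ (ℕS.solve 4 (λ i j m t → let s = i ℕS.:+ j in
         s ℕS.:* t ℕS.:+ i ℕS.:* m ℕS.:+ (s ℕS.:* t ℕS.:+ i ℕS.:* m) ℕS.:= s ℕS.:* (t ℕS.:+ t) ℕS.:+ (i ℕS.:* m ℕS.:+ i ℕS.:* m))
         ≡.refl i j m t) ⟩
  + (s ℕ.* (t ℕ.+ t) ℕ.+ (i ℕ.* m ℕ.+ i ℕ.* m))
    ≡⟨ ≡.cong₂ ℤ._+_ (ℤ.pos-* s (t ℕ.+ t)) (≡.cong₂ ℤ._+_ (ℤ.pos-* i m) (ℤ.pos-* i m)) ⟩
  (+ i ℤ.+ + j) ℤ.* + (t ℕ.+ t) ℤ.+ (+ i ℤ.* + m ℤ.+ + i ℤ.* + m)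
    ≡⟨ solve 4 (λ i j m T → (i :+ j) :* T :+ (i :* m :+ i :* m) := (i :+ j) :* (T :+ m) :+ (i :- j) :* m)
         ≡.refl (+ i) (+ j) (+ m) (+ (t ℕ.+ t)) ⟩
  (+ i ℤ.+ + j) ℤ.* + (t ℕ.+ t ℕ.+ m) ℤ.+ (+ i ℤ.- + j) ℤ.* + m
    ≡⟨ ≡.cong (λ T → (+ i ℤ.+ + j) ℤ.* T ℤ.+ (+ i ℤ.- + j) ℤ.* + m)
         (≡.trans (≡.cong +_ (2*triangle m)) (ℤ.pos-* m m)) ⟩
  thetaQuadratic (+ i) (+ j) (+ m) ∎
  where
  open ≡.≡-Reasoning
  open ℤS
  s = i ℕ.+ j
  t = triangle m
double-thetaExponent i j -[1+ m ] = begin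
  double (+ thetaExponent i j -[1+ m ])
    ≡⟨ ≡.cong (λ e → double (+ (e ℕ.* triangle (suc m) ℕ.+ j ℕ.* suc m))) (ℕ.+-comm i j) ⟩
  double (+ thetaExponent j i (+ suc m))
    ≡⟨ double-thetaExponent j i (+ suc m) ⟩
  thetaQuadratic (+ j) (+ i) (ℤ.- -[1+ m ])
    ≡⟨ solve 3 (λ i j m → (j :+ i) :* (:- m :* :- m) :+ (j :- i) :* :- m := (i :+ j) :* (m :* m) :+ (i :- j) :* m)
         ≡.refl (+ i) (+ j) -[1+ m ] ⟩
  thetaQuadratic (+ i) (+ j) -[1+ m ] ∎
  where
  open ≡.≡-Reasoning
  open ℤS

double-+ : ∀ a b → double (+ (a ℕ.+ b)) ≡ double (+ a) ℤ.+ double (+ b)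
double-+ a b = ℤS.solve 2 (λ a b → (a ℤS.:+ b) ℤS.:+ (a ℤS.:+ b) ℤS.:= (a ℤS.:+ a) ℤS.:+ (b ℤS.:+ b)) ≡.refl (+ a) (+ b)

thetaExponent-+ : ∀ i j m i′ j′ n a b u a′ b′ v c →
  thetaQuadratic (+ i) (+ j) m ℤ.+ thetaQuadratic (+ i′) (+ j′) n
    ≡ double (+ c) ℤ.+ (thetaQuadratic (+ a) (+ b) u ℤ.+ thetaQuadratic (+ a′) (+ b′) v) →
  thetaExponent i j m ℕ.+ thetaExponent i′ j′ n ≡ c ℕ.+ (thetaExponent a b u ℕ.+ thetaExponent a′ b′ v)
thetaExponent-+ i j m i′ j′ n a b u a′ b′ v c e = double-injective (begin
  double (+ (E₁ ℕ.+ E₂))                                    ≡⟨ double-+ E₁ E₂ ⟩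
  double (+ E₁) ℤ.+ double (+ E₂)                           ≡⟨ ≡.cong₂ ℤ._+_ (double-thetaExponent i j m) (double-thetaExponent i′ j′ n) ⟩
  thetaQuadratic (+ i) (+ j) m ℤ.+ thetaQuadratic (+ i′) (+ j′) n
    ≡⟨ e ⟩
  double (+ c) ℤ.+ (thetaQuadratic (+ a) (+ b) u ℤ.+ thetaQuadratic (+ a′) (+ b′) v)
    ≡⟨ ≡.cong (λ x → double (+ c) ℤ.+ x) (≡.cong₂ ℤ._+_ (double-thetaExponent a b u) (double-thetaExponent a′ b′ v)) ⟨
  double (+ c) ℤ.+ (double (+ E₃) ℤ.+ double (+ E₄))        ≡⟨ ≡.cong (λ x → double (+ c) ℤ.+ x) (double-+ E₃ E₄) ⟨
  double (+ c) ℤ.+ double (+ (E₃ ℕ.+ E₄))                   ≡⟨ double-+ c (E₃ ℕ.+ E₄) ⟨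
  double (+ (c ℕ.+ (E₃ ℕ.+ E₄)))                            ∎)
  where
  open ≡.≡-Reasoning
  E₁ = thetaExponent i j m
  E₂ = thetaExponent i′ j′ n
  E₃ = thetaExponent a b u
  E₄ = thetaExponent a′ b′ v

quadratic : ∀ {n} → ℤS.Polynomial n → ℤS.Polynomial n → ℤS.Polynomial n → ℤS.Polynomial n
quadratic i j m = (i ℤS.:+ j) ℤS.:* (m ℤS.:* m) ℤS.:+ (i ℤS.:- j) ℤS.:* m

-- Theta functions and their addition formula

record QSeriesRing : Set₁ where
  field
    adicRing : AdicRing

  open AdicRing adicRing public
  open Adic adicRing public
  open Sums adicRing public

  field
    ⟨_⨾_⟩       : Carrier → (k : ℕ) → .{{NonZero k}} → Carrier
    ⟨⨾⟩-product : ∀ z k .{{_ : NonZero k}} → HasProduct (λ j → 1# - z * (q ^ k) ^ j) ⟨ z ⨾ k ⟩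

module Theta (A : QSeriesRing) where
  open QSeriesRing A
  open TripleProduct adicRing
  open JacobiTripleProduct adicRing

  module _ {s : Carrier} (s²≈1 : s * s ≈ 1#) where

    sign-⊖ : ∀ m n → s ^ ∣ m ⊖ n ∣ ≈ s ^ m * s ^ n
    sign-⊖ zero    zero    = sym (*-identityˡ 1#)
    sign-⊖ zero    (suc n) = sym (*-identityˡ _)
    sign-⊖ (suc m) zero    = sym (*-identityʳ _)
    sign-⊖ (suc m) (suc n) = begin
      s ^ ∣ suc m ⊖ suc n ∣     ≡⟨ ≡.cong (λ d → s ^ ∣ d ∣) (ℤ.[1+m]⊖[1+n]≡m⊖n m n) ⟩
      s ^ ∣ m ⊖ n ∣             ≈⟨ sign-⊖ m n ⟩
      s ^ m * s ^ n             ≈⟨ trans (sym (*-identityˡ _)) (*-congʳ (sym s²≈1)) ⟩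
      s * s * (s ^ m * s ^ n)   ≈⟨ solve 3 (λ s x y → s :* s :* (x :* y) := s :* x :* (s :* y)) refl s _ _ ⟩
      s ^ suc m * s ^ suc n     ∎
      where open SetoidReasoning setoid

    -- Since s is its own inverse, s^|m| is a character of the integers. Taking s = -1 or s = 1
    -- serves the alternating and the positive theta series at once.
    sign-+ : ∀ m n → s ^ ∣ m ℤ.+ n ∣ ≈ s ^ ∣ m ∣ * s ^ ∣ n ∣
    sign-+ (+ m)    (+ n)    = ^-homo-* s m n
    sign-+ (+ m)    -[1+ n ] = sign-⊖ m (suc n)
    sign-+ -[1+ m ] (+ n)    = trans (sign-⊖ n (suc m)) (*-comm _ _)
    sign-+ -[1+ m ] -[1+ n ] = trans (reflexive (≡.cong (s ^_) (≡.cong suc (≡.sym (ℕ.+-suc m n))))) (^-homo-* s (suc m) (suc n))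

    sign-double : ∀ m → s ^ ∣ double m ∣ ≈ 1#
    sign-double m = trans (sign-+ m m) (trans (sym (^-distrib-* s s ∣ m ∣))
      (trans (^-congˡ ∣ m ∣ s²≈1) (1^n≈1 ∣ m ∣)))

    sign-parity : ∀ {n} m k r → n ≡ double k ℤ.+ (m ℤ.+ + r) → s ^ ∣ n ∣ ≈ s ^ r * s ^ ∣ m ∣
    sign-parity m k r ≡.refl = trans (sign-+ (double k) (m ℤ.+ + r)) (trans (*-cong (sign-double k) (sign-+ m (+ r)))
      (trans (*-identityˡ _) (*-comm _ _)))

  thetaTerm : Carrier → ℕ → ℕ → ℤ → Carrier
  thetaTerm s i j m = s ^ ∣ m ∣ * q ^ thetaExponent i j m

  theta-sum : ∀ {s z w} i j .{{_ : NonZero (i ℕ.+ j)}} → s * s ≈ 1# → - z ≈ s * q ^ i → - w ≈ s * q ^ j →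
    HasSum (thetaTerm s i j) (⟨ z ⨾ i ℕ.+ j ⟩ * ⟨ w ⨾ i ℕ.+ j ⟩ * ⟨ q ^ (i ℕ.+ j) ⨾ i ℕ.+ j ⟩)
  theta-sum {s} {z} {w} i j s²≈1 −z≈ −w≈ = sum-cong term≈ refl
    (triple-product zw≈p (⟨⨾⟩-product z k) (⟨⨾⟩-product w k) (⟨⨾⟩-product (q ^ k) k))
    where
    open SetoidReasoning setoid
    k = i ℕ.+ j

    zw≈p : z * w ≈ q ^ k
    zw≈p = begin
      z * w                          ≈⟨ solve 2 (λ z w → z :* w := :- z :* :- w) refl z w ⟩
      - z * - w                      ≈⟨ *-cong −z≈ −w≈ ⟩
      (s * q ^ i) * (s * q ^ j)      ≈⟨ solve 3 (λ s x y → s :* x :* (s :* y) := s :* s :* (x :* y)) refl s _ _ ⟩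
      s * s * (q ^ i * q ^ j)        ≈⟨ *-cong s²≈1 (sym (^-homo-* q i j)) ⟩
      1# * q ^ k                     ≈⟨ *-identityˡ _ ⟩
      q ^ k                          ∎

    power : ∀ {y} l m → y ≈ s * q ^ l → y ^ m * (q ^ k) ^ triangle m ≈ s ^ m * q ^ (k ℕ.* triangle m ℕ.+ l ℕ.* m)
    power {y} l m y≈ = begin
      y ^ m * (q ^ k) ^ triangle m
        ≈⟨ *-cong (trans (^-congˡ m y≈) (trans (^-distrib-* s (q ^ l) m) (*-congˡ (^-assocʳ q l m)))) (^-assocʳ q k (triangle m)) ⟩
      s ^ m * q ^ (l ℕ.* m) * q ^ (k ℕ.* triangle m)
        ≈⟨ solve 3 (λ a b c → a :* b :* c := a :* (c :* b)) refl _ _ _ ⟩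
      s ^ m * (q ^ (k ℕ.* triangle m) * q ^ (l ℕ.* m))
        ≈⟨ *-congˡ (sym (^-homo-* q (k ℕ.* triangle m) (l ℕ.* m))) ⟩
      s ^ m * q ^ (k ℕ.* triangle m ℕ.+ l ℕ.* m) ∎

    term≈ : ∀ m → jacobiTerm (q ^ k) z w m ≈ thetaTerm s i j m
    term≈ (+ m)    = power i m −z≈
    term≈ -[1+ m ] = power j (suc m) −w≈

  -- Ramanujan's f(-q^i, -q^j).
  J : (i j : ℕ) → .{{NonZero (i ℕ.+ j)}} → Carrier
  J i j = ⟨ q ^ i ⨾ i ℕ.+ j ⟩ * ⟨ q ^ j ⨾ i ℕ.+ j ⟩ * ⟨ q ^ (i ℕ.+ j) ⨾ i ℕ.+ j ⟩

  -- Ramanujan's f(q^i, q^j). For j = 0 the product contains (-1; q^i), whose first factor is 2;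
  -- accordingly `Θ i 0` is 2ψ(q^i).
  Θ : (i j : ℕ) → .{{NonZero (i ℕ.+ j)}} → Carrier
  Θ i j = ⟨ - q ^ i ⨾ i ℕ.+ j ⟩ * ⟨ - q ^ j ⨾ i ℕ.+ j ⟩ * ⟨ q ^ (i ℕ.+ j) ⨾ i ℕ.+ j ⟩

  −1²≈1 : - 1# * - 1# ≈ 1#
  −1²≈1 = solve 0 (:- 𝟙 :* :- 𝟙 := 𝟙) refl

  J-sum : ∀ i j .{{_ : NonZero (i ℕ.+ j)}} → HasSum (thetaTerm (- 1#) i j) (J i j)
  J-sum i j = theta-sum i j −1²≈1 (minus (q ^ i)) (minus (q ^ j))
    where
    minus : ∀ x → - x ≈ - 1# * x
    minus = solve 1 (λ x → :- x := :- 𝟙 :* x) refl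

  Θ-sum : ∀ i j .{{_ : NonZero (i ℕ.+ j)}} → HasSum (thetaTerm 1# i j) (Θ i j)
  Θ-sum i j = theta-sum i j (*-identityˡ 1#) (double-minus (q ^ i)) (double-minus (q ^ j))
    where
    double-minus : ∀ x → - - x ≈ 1# * x
    double-minus = solve 1 (λ x → :- (:- x) := 𝟙 :* x) refl

  thetaTerm-1 : ∀ i j m → thetaTerm 1# i j m ≈ q ^ thetaExponent i j m
  thetaTerm-1 i j m = trans (*-congʳ (1^n≈1 ∣ m ∣)) (*-identityˡ _)

  -- m² + n² is, up to a factor 2, preserved by the rotation (m, n) = (u + v + r, u - v), which
  -- turns the product of two theta series into two products of theta series of twice the period.
  theta-addition : ∀ i d e
    .{{_ : NonZero (i ℕ.+ (i ℕ.+ d ℕ.+ e))}} .{{_ : NonZero (i ℕ.+ d ℕ.+ (i ℕ.+ e))}}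
    .{{_ : NonZero ((i ℕ.+ (i ℕ.+ d)) ℕ.+ ((i ℕ.+ d ℕ.+ e) ℕ.+ (i ℕ.+ e)))}}
    .{{_ : NonZero ((i ℕ.+ (i ℕ.+ e)) ℕ.+ ((i ℕ.+ d ℕ.+ e) ℕ.+ (i ℕ.+ d)))}}
    .{{_ : NonZero ((i ℕ.+ (i ℕ.+ d ℕ.+ e)) ℕ.+ (i ℕ.+ (i ℕ.+ d)) ℕ.+ e)}}
    .{{_ : NonZero ((i ℕ.+ (i ℕ.+ d ℕ.+ e)) ℕ.+ (i ℕ.+ (i ℕ.+ e)) ℕ.+ d)}} →
    J i (i ℕ.+ d ℕ.+ e) * J (i ℕ.+ d) (i ℕ.+ e)
      ≈ Θ (i ℕ.+ (i ℕ.+ d)) ((i ℕ.+ d ℕ.+ e) ℕ.+ (i ℕ.+ e)) * Θ (i ℕ.+ (i ℕ.+ e)) ((i ℕ.+ d ℕ.+ e) ℕ.+ (i ℕ.+ d))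
        - q ^ i * (Θ ((i ℕ.+ (i ℕ.+ d ℕ.+ e)) ℕ.+ (i ℕ.+ (i ℕ.+ d))) e * Θ ((i ℕ.+ (i ℕ.+ d ℕ.+ e)) ℕ.+ (i ℕ.+ (i ℕ.+ e))) d)
  theta-addition i d e = trans
    (sum-unique (≡-dec ℤ._≟_ ℤ._≟_) (sum-* ℤ._≟_ (J-sum i i′) (J-sum j j′))
      (sum-reindex rotate rotate-injective rotate-surjective (sum-Fin 2 pieces)))
    (trans (+-congˡ (+-identityʳ _)) (solve 3 (λ a Q b → a :+ (:- Q :* b) := a :- Q :* b) refl _ _ _))
    where
    open SetoidReasoning setoid
    -- The parametrisation by i, d, e forces i + i′ = j + j′. Both series then have the same period
    -- and the cross terms uv cancel; the differences d = j - i and e = j′ - i stay natural numbers.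
    j = i ℕ.+ d
    i′ = i ℕ.+ d ℕ.+ e
    j′ = i ℕ.+ e
    L = i ℕ.+ i′

    even-exponent : ∀ u v → thetaExponent i i′ (u ℤ.+ v ℤ.+ 0ℤ) ℕ.+ thetaExponent j j′ (u ℤ.- v)
      ≡ thetaExponent (i ℕ.+ j) (i′ ℕ.+ j′) u ℕ.+ thetaExponent (i ℕ.+ j′) (i′ ℕ.+ j) v
    even-exponent u v = thetaExponent-+ i i′ _ j j′ _ _ _ u _ _ v 0
      (ℤS.solve 5 (λ i d e u v → let j = i ℤS.:+ d ; i′ = i ℤS.:+ d ℤS.:+ e ; j′ = i ℤS.:+ e in
         quadratic i i′ (u ℤS.:+ v ℤS.:+ ℤS.con 0ℤ) ℤS.:+ quadratic j j′ (u ℤS.:- v)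
         ℤS.:= ℤS.con 0ℤ ℤS.:+ (quadratic (i ℤS.:+ j) (i′ ℤS.:+ j′) u ℤS.:+ quadratic (i ℤS.:+ j′) (i′ ℤS.:+ j) v))
         ≡.refl (+ i) (+ d) (+ e) u v)

    odd-exponent : ∀ u v → thetaExponent i i′ (u ℤ.+ v ℤ.+ 1ℤ) ℕ.+ thetaExponent j j′ (u ℤ.- v)
      ≡ i ℕ.+ (thetaExponent (L ℕ.+ (i ℕ.+ j)) e u ℕ.+ thetaExponent (L ℕ.+ (i ℕ.+ j′)) d v)
    odd-exponent u v = thetaExponent-+ i i′ _ j j′ _ _ _ u _ _ v i
      (ℤS.solve 5 (λ i d e u v → let j = i ℤS.:+ d ; i′ = i ℤS.:+ d ℤS.:+ e ; j′ = i ℤS.:+ e ; L = i ℤS.:+ i′ in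
         quadratic i i′ (u ℤS.:+ v ℤS.:+ ℤS.con 1ℤ) ℤS.:+ quadratic j j′ (u ℤS.:- v)
         ℤS.:= (i ℤS.:+ i) ℤS.:+ (quadratic (L ℤS.:+ (i ℤS.:+ j)) e u ℤS.:+ quadratic (L ℤS.:+ (i ℤS.:+ j′)) d v))
         ≡.refl (+ i) (+ d) (+ e) u v)

    signs : ∀ r u v → (- 1#) ^ ∣ u ℤ.+ v ℤ.+ + r ∣ * (- 1#) ^ ∣ u ℤ.- v ∣ ≈ (- 1#) ^ r
    signs r u v = begin
      (- 1#) ^ ∣ u ℤ.+ v ℤ.+ + r ∣ * (- 1#) ^ ∣ u ℤ.- v ∣
        ≈⟨ sign-+ −1²≈1 (u ℤ.+ v ℤ.+ + r) (u ℤ.- v) ⟨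
      (- 1#) ^ ∣ (u ℤ.+ v ℤ.+ + r) ℤ.+ (u ℤ.- v) ∣
        ≈⟨ sign-parity −1²≈1 0ℤ u r (ℤS.solve 3 (λ u v r → (u ℤS.:+ v ℤS.:+ r) ℤS.:+ (u ℤS.:- v)
             ℤS.:= (u ℤS.:+ u) ℤS.:+ (ℤS.con 0ℤ ℤS.:+ r)) ≡.refl u v (+ r)) ⟩
      (- 1#) ^ r * 1#
        ≈⟨ *-identityʳ _ ⟩
      (- 1#) ^ r ∎

    module _ (r c a b a′ b′ : ℕ) (u v : ℤ)
             (exponent : thetaExponent i i′ (u ℤ.+ v ℤ.+ + r) ℕ.+ thetaExponent j j′ (u ℤ.- v)
                         ≡ c ℕ.+ (thetaExponent a b u ℕ.+ thetaExponent a′ b′ v)) where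
      piece : ((- 1#) ^ r * q ^ c) * (thetaTerm 1# a b u * thetaTerm 1# a′ b′ v)
        ≈ thetaTerm (- 1#) i i′ (u ℤ.+ v ℤ.+ + r) * thetaTerm (- 1#) j j′ (u ℤ.- v)
      piece = sym (begin
        (- 1#) ^ ∣ m ∣ * q ^ thetaExponent i i′ m * ((- 1#) ^ ∣ n ∣ * q ^ thetaExponent j j′ n)
          ≈⟨ solve 4 (λ a b c d → a :* b :* (c :* d) := a :* c :* (b :* d)) refl _ _ _ _ ⟩
        (- 1#) ^ ∣ m ∣ * (- 1#) ^ ∣ n ∣ * (q ^ thetaExponent i i′ m * q ^ thetaExponent j j′ n)
          ≈⟨ *-cong (signs r u v) (sym (^-homo-* q (thetaExponent i i′ m) (thetaExponent j j′ n))) ⟩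
        (- 1#) ^ r * q ^ (thetaExponent i i′ m ℕ.+ thetaExponent j j′ n)
          ≡⟨ ≡.cong (λ x → (- 1#) ^ r * q ^ x) exponent ⟩
        (- 1#) ^ r * q ^ (c ℕ.+ (thetaExponent a b u ℕ.+ thetaExponent a′ b′ v))
          ≈⟨ *-congˡ (trans (^-homo-* q c _) (*-congˡ (^-homo-* q (thetaExponent a b u) (thetaExponent a′ b′ v)))) ⟩
        (- 1#) ^ r * (q ^ c * (q ^ thetaExponent a b u * q ^ thetaExponent a′ b′ v))
          ≈⟨ sym (*-assoc _ _ _) ⟩
        (- 1#) ^ r * q ^ c * (q ^ thetaExponent a b u * q ^ thetaExponent a′ b′ v)
          ≈⟨ *-congˡ (*-cong (thetaTerm-1 a b u) (thetaTerm-1 a′ b′ v)) ⟨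
        (- 1#) ^ r * q ^ c * (thetaTerm 1# a b u * thetaTerm 1# a′ b′ v) ∎)
        where
        m = u ℤ.+ v ℤ.+ + r
        n = u ℤ.- v

    total : Fin 2 → Carrier
    total zero       = Θ (i ℕ.+ j) (i′ ℕ.+ j′) * Θ (i ℕ.+ j′) (i′ ℕ.+ j)
    total (suc zero) = - q ^ i * (Θ (L ℕ.+ (i ℕ.+ j)) e * Θ (L ℕ.+ (i ℕ.+ j′)) d)

    pieces : ∀ r → HasSum (λ (u , v) → thetaTerm (- 1#) i i′ (u ℤ.+ v ℤ.+ + toℕ r) * thetaTerm (- 1#) j j′ (u ℤ.- v)) (total r)
    pieces zero       = sum-cong (λ (u , v) → piece 0 0 _ _ _ _ u v (even-exponent u v))
      (solve 1 (λ x → 𝟙 :* 𝟙 :* x := x) refl _)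
      (sum-scale _ (sum-* ℤ._≟_ (Θ-sum (i ℕ.+ j) (i′ ℕ.+ j′)) (Θ-sum (i ℕ.+ j′) (i′ ℕ.+ j))))
    pieces (suc zero) = sum-cong (λ (u , v) → piece 1 i _ _ _ _ u v (odd-exponent u v))
      (solve 2 (λ Q x → :- 𝟙 :* 𝟙 :* Q :* x := :- Q :* x) refl _ _)
      (sum-scale _ (sum-* ℤ._≟_ (Θ-sum (L ℕ.+ (i ℕ.+ j)) e) (Θ-sum (L ℕ.+ (i ℕ.+ j′)) d)))

-- Signs and exponents on the residue classes modulo 5

module Residues₅ where
  open ℤS

  -- As 5 is odd, the sign on the class r + 5m is the alternating sign in m, up to the constant
  -- (-1)^r.
  direct-parity : ∀ r m → ∃ λ k → r ℤ.+ m ℤ.* + 5 ≡ double k ℤ.+ (m ℤ.+ r)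
  direct-parity r m = m ℤ.+ m , solve 2 (λ r m → r :+ m :* con (+ 5) := m :+ m :+ (m :+ m) :+ (m :+ r)) ≡.refl r m

  reflected-parity : ∀ t m → ∃ λ k → + 5 ℤ.- t ℤ.+ reflect m ℤ.* + 5 ≡ double k ℤ.+ (m ℤ.+ t)
  reflected-parity t m = ℤ.- (m ℤ.+ m ℤ.+ m) ℤ.- t , solve 2 (λ t m → con (+ 5) :- t :+ (con -1ℤ :- m) :* con (+ 5)
    := :- (m :+ m :+ m) :- t :+ (:- (m :+ m :+ m) :- t) :+ (m :+ t)) ≡.refl t m

  φ-direct : ∀ r m → thetaQuadratic 1ℤ 1ℤ (r ℤ.+ m ℤ.* + 5)
    ≡ double (r ℤ.* r) ℤ.+ thetaQuadratic (+ 25 ℤ.+ + 10 ℤ.* r) (+ 25 ℤ.- + 10 ℤ.* r) m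
  φ-direct = solve 2 (λ r m → quadratic (con 1ℤ) (con 1ℤ) (r :+ m :* con (+ 5))
    := r :* r :+ r :* r :+ quadratic (con (+ 25) :+ con (+ 10) :* r) (con (+ 25) :- con (+ 10) :* r) m) ≡.refl

  -- The argument is -(5m + t) and the exponent is its square, so the class 5 - t repeats the class
  -- t.
  φ-reflected : ∀ t m → thetaQuadratic 1ℤ 1ℤ (+ 5 ℤ.- t ℤ.+ reflect m ℤ.* + 5)
    ≡ double (t ℤ.* t) ℤ.+ thetaQuadratic (+ 25 ℤ.+ + 10 ℤ.* t) (+ 25 ℤ.- + 10 ℤ.* t) m
  φ-reflected = solve 2 (λ t m → quadratic (con 1ℤ) (con 1ℤ) (con (+ 5) :- t :+ (con -1ℤ :- m) :* con (+ 5))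
    := t :* t :+ t :* t :+ quadratic (con (+ 25) :+ con (+ 10) :* t) (con (+ 25) :- con (+ 10) :* t) m) ≡.refl

  ψ-direct : ∀ r m → thetaQuadratic 1ℤ 0ℤ (r ℤ.+ m ℤ.* + 5)
    ≡ (r ℤ.* r ℤ.+ r) ℤ.+ thetaQuadratic (+ 15 ℤ.+ + 5 ℤ.* r) (+ 10 ℤ.- + 5 ℤ.* r) m
  ψ-direct = solve 2 (λ r m → quadratic (con 1ℤ) (con 0ℤ) (r :+ m :* con (+ 5))
    := (r :* r :+ r) :+ quadratic (con (+ 15) :+ con (+ 5) :* r) (con (+ 10) :- con (+ 5) :* r) m) ≡.refl

  -- At n = -(5m + t) one has n(n+1) = (5m + t)(5m + t - 1), so here the class 5 - t repeats the
  -- class t - 1.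
  ψ-reflected : ∀ t m → thetaQuadratic 1ℤ 0ℤ (+ 5 ℤ.- t ℤ.+ reflect m ℤ.* + 5)
    ≡ (t ℤ.* t ℤ.- t) ℤ.+ thetaQuadratic (+ 10 ℤ.+ + 5 ℤ.* t) (+ 15 ℤ.- + 5 ℤ.* t) m
  ψ-reflected = solve 2 (λ t m → quadratic (con 1ℤ) (con 0ℤ) (con (+ 5) :- t :+ (con -1ℤ :- m) :* con (+ 5))
    := (t :* t :- t) :+ quadratic (con (+ 10) :+ con (+ 5) :* t) (con (+ 15) :- con (+ 5) :* t) m) ≡.refl

-- Product identities modulo 10 and dissections modulo 5

module Products (A : QSeriesRing) where
  open QSeriesRing A
  open Theta A
  open Residues₅
  open SetoidReasoning setoid

  ⟨⨾⟩-cong : ∀ {z w} k .{{_ : NonZero k}} → z ≈ w → ⟨ z ⨾ k ⟩ ≈ ⟨ w ⨾ k ⟩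
  ⟨⨾⟩-cong k z≈w = product-unique (λ j → +-congˡ (-‿cong (*-congʳ z≈w))) (⟨⨾⟩-product _ k) (⟨⨾⟩-product _ k)

  ⟨⨾⟩-principal : ∀ {z} k .{{_ : NonZero k}} → z ≈ 0# mod 1 → Principal ⟨ z ⨾ k ⟩
  ⟨⨾⟩-principal {z} k z≈0 = product-principal (⟨⨾⟩-product z k) (mod-trans
    (mod-+ (mod-refl {1#}) (mod-‿- (*-≈0ˡ z≈0 1#)))
    (≈⇒mod 1 (trans (sym (+-identityʳ _)) (solve 1 (λ z → 𝟙 :- z :+ z := 𝟙) refl 0#))))

  q^-principal : ∀ i k .{{_ : NonZero i}} .{{_ : NonZero k}} → Principal ⟨ q ^ i ⨾ k ⟩
  q^-principal i k = ⟨⨾⟩-principal k (q^≈0 (ℕ.>-nonZero⁻¹ i))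

  ⟨⨾⟩-step : ∀ z k .{{_ : NonZero k}} → ⟨ z ⨾ k ⟩ ≈ (1# - z) * ⟨ z * q ^ k ⨾ k ⟩
  ⟨⨾⟩-step z k = mod-separated λ N → mod-trans (mod-sym (mod-≤ (ℕ.n≤1+n N) (⟨⨾⟩-product z k (suc N))))
    (mod-trans (≈⇒mod N (trans (∏-cons N _) (*-cong (+-congˡ (-‿cong (*-identityʳ z)))
      (∏-cong N (λ j → +-congˡ (-‿cong (sym (*-assoc z (q ^ k) _))))))))
    (mod-* mod-refl (⟨⨾⟩-product (z * q ^ k) k N)))

  ⟨⨾⟩-difference-of-squares : ∀ i k .{{_ : NonZero k}} .{{_ : NonZero (k ℕ.+ k)}} →
    ⟨ q ^ i ⨾ k ⟩ * ⟨ - q ^ i ⨾ k ⟩ ≈ ⟨ q ^ (i ℕ.+ i) ⨾ k ℕ.+ k ⟩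
  ⟨⨾⟩-difference-of-squares i k = product-unique factor
    (λ n → mod-trans (≈⇒mod n (∏-* n _ _)) (mod-* (⟨⨾⟩-product (q ^ i) k n) (⟨⨾⟩-product (- q ^ i) k n)))
    (⟨⨾⟩-product _ (k ℕ.+ k))
    where
    factor : ∀ j → (1# - q ^ i * (q ^ k) ^ j) * (1# - (- q ^ i) * (q ^ k) ^ j) ≈ 1# - q ^ (i ℕ.+ i) * (q ^ (k ℕ.+ k)) ^ j
    factor j = trans
      (solve 2 (λ z x → (𝟙 :- z :* x) :* (𝟙 :- (:- z) :* x) := 𝟙 :- (z :* z) :* (x :* x)) refl (q ^ i) ((q ^ k) ^ j))
      (+-congˡ (-‿cong (sym (*-cong (^-homo-* q i i)
        (trans (^-congˡ j (^-homo-* q k k)) (^-distrib-* (q ^ k) (q ^ k) j))))))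

  ∏-blocks : ∀ N d t → ∏< (N ℕ.* d) t ≈ ∏< d (λ r → ∏< N (λ j → t (j ℕ.* d ℕ.+ r)))
  ∏-blocks zero    d t = sym (trans (∏-const d 1#) (1^n≈1 d))
  ∏-blocks (suc N) d t = begin
    ∏< (d ℕ.+ N ℕ.* d) t
      ≡⟨ ≡.cong (λ n → ∏< n t) (ℕ.+-comm d (N ℕ.* d)) ⟩
    ∏< (N ℕ.* d ℕ.+ d) t
      ≈⟨ ∏-+ (N ℕ.* d) d t ⟩
    ∏< (N ℕ.* d) t * ∏< d (λ r → t (N ℕ.* d ℕ.+ r))
      ≈⟨ *-congʳ (∏-blocks N d t) ⟩
    ∏< d (λ r → ∏< N (λ j → t (j ℕ.* d ℕ.+ r))) * ∏< d (λ r → t (N ℕ.* d ℕ.+ r))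
      ≈⟨ sym (∏-* d _ _) ⟩
    ∏< d (λ r → ∏< (suc N) (λ j → t (j ℕ.* d ℕ.+ r))) ∎

  ∏-cong-mod : ∀ {N} n {s t} → (∀ j → s j ≈ t j mod N) → ∏< n s ≈ ∏< n t mod N
  ∏-cong-mod zero    e = mod-refl
  ∏-cong-mod (suc n) e = mod-* (∏-cong-mod n e) (e n)

  -- The factors are sorted by their index modulo d.
  ⟨⨾⟩-split : ∀ d i k .{{_ : NonZero d}} .{{_ : NonZero k}} .{{_ : NonZero (k ℕ.* d)}} →
    ⟨ q ^ i ⨾ k ⟩ ≈ ∏< d (λ r → ⟨ q ^ (i ℕ.+ k ℕ.* r) ⨾ k ℕ.* d ⟩)
  ⟨⨾⟩-split d i k = mod-separated λ N → mod-trans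
    (mod-sym (mod-≤ (ℕ.m≤m*n N d) (⟨⨾⟩-product (q ^ i) k (N ℕ.* d))))
    (mod-trans (≈⇒mod N (trans (∏-blocks N d _) (∏-cong d λ r → ∏-cong N λ j → +-congˡ (-‿cong (power r j)))))
    (∏-cong-mod d (λ r → ⟨⨾⟩-product _ (k ℕ.* d) N)))
    where
    power : ∀ r j → q ^ i * (q ^ k) ^ (j ℕ.* d ℕ.+ r) ≈ q ^ (i ℕ.+ k ℕ.* r) * (q ^ (k ℕ.* d)) ^ j
    power r j = begin
      q ^ i * (q ^ k) ^ (j ℕ.* d ℕ.+ r)          ≈⟨ *-congˡ (^-homo-* (q ^ k) (j ℕ.* d) r) ⟩
      q ^ i * ((q ^ k) ^ (j ℕ.* d) * (q ^ k) ^ r) ≈⟨ solve 3 (λ a b c → a :* (b :* c) := a :* c :* b) refl _ _ _ ⟩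
      q ^ i * (q ^ k) ^ r * (q ^ k) ^ (j ℕ.* d)
        ≈⟨ *-cong (trans (*-congˡ (^-assocʳ q k r)) (sym (^-homo-* q i (k ℕ.* r))))
             (trans (reflexive (≡.cong ((q ^ k) ^_) (ℕ.*-comm j d)))
               (trans (sym (^-assocʳ (q ^ k) d j)) (^-congˡ j (^-assocʳ q k d)))) ⟩
      q ^ (i ℕ.+ k ℕ.* r) * (q ^ (k ℕ.* d)) ^ j ∎

  split₂ : ∀ i k .{{_ : NonZero k}} .{{_ : NonZero (k ℕ.* 2)}} →
    ⟨ q ^ i ⨾ k ⟩ ≈ ⟨ q ^ (i ℕ.+ k ℕ.* 0) ⨾ k ℕ.* 2 ⟩ * ⟨ q ^ (i ℕ.+ k ℕ.* 1) ⨾ k ℕ.* 2 ⟩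
  split₂ i k = trans (⟨⨾⟩-split 2 i k) (*-congʳ (*-identityˡ _))

  private
    variable
      a b c : Carrier

  swap : a * b * c ≈ b * a * c
  swap = *-congʳ (*-comm _ _)

  -- The T with index s is f(q^(10-s), q^(10+s)). With d = j - i and e = 10 - i - j, the addition
  -- formula writes the product of J with indices i and j as T_d T_e - q^i T_(10-d) T_(10-e). For i
  -- and j of equal parity only even indices occur.
  J₁ J₂ J₃ J₄ J₅ T₀ T₂ T₄ T₆ T₈ T₁₀ : Carrier
  J₁  = J 1 9
  J₂  = J 2 8
  J₃  = J 3 7
  J₄  = J 4 6
  J₅  = J 5 5
  T₀  = Θ 10 10
  T₂  = Θ 8 12
  T₄  = Θ 6 14
  T₆  = Θ 4 16
  T₈  = Θ 2 18
  T₁₀ = Θ 0 20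

  private
    reorient : ∀ {x y c z d d′ e e′} → x ≈ y → y ≈ c - z * (d * e) → d ≈ d′ → e ≈ e′ → x ≈ c - z * (d′ * e′)
    reorient x≈y y≈ d≈ e≈ = trans x≈y (trans y≈ (+-congˡ (-‿cong (*-congˡ (*-cong d≈ e≈)))))

  -- As Jᵢ = J₁₀₋ᵢ, some products have two expansions; the names record the pair (i, j) used.

  J₁J₇ : J₁ * J₃ ≈ T₂ * T₆ - q ^ 1 * (T₈ * T₄)
  J₁J₇ = reorient (*-congˡ swap) (theta-addition 1 6 2) swap swap

  J₁J₅ : J₁ * J₅ ≈ T₄ * T₄ - q ^ 1 * (T₆ * T₆)
  J₁J₅ = reorient refl (theta-addition 1 4 4) swap swap

  J₁J₃ : J₁ * J₃ ≈ T₆ * T₂ - q ^ 1 * (T₄ * T₈)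
  J₁J₃ = reorient refl (theta-addition 1 2 6) swap swap

  J₁J₁ : J₁ * J₁ ≈ T₈ * T₀ - q ^ 1 * (T₂ * T₁₀)
  J₁J₁ = reorient refl (theta-addition 1 0 8) swap swap

  J₂J₂ : J₂ * J₂ ≈ T₆ * T₀ - q ^ 2 * (T₄ * T₁₀)
  J₂J₂ = reorient refl (theta-addition 2 0 6) swap swap

  J₂J₄ : J₂ * J₄ ≈ T₄ * T₂ - q ^ 2 * (T₆ * T₈)
  J₂J₄ = reorient refl (theta-addition 2 2 4) swap swap

  J₂J₆ : J₂ * J₄ ≈ T₂ * T₄ - q ^ 2 * (T₈ * T₆)
  J₂J₆ = reorient (*-congˡ swap) (theta-addition 2 4 2) swap swap

  J₃J₃ : J₃ * J₃ ≈ T₄ * T₀ - q ^ 3 * (T₆ * T₁₀)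
  J₃J₃ = reorient refl (theta-addition 3 0 4) swap swap

  J₃J₅ : J₃ * J₅ ≈ T₂ * T₂ - q ^ 3 * (T₈ * T₈)
  J₃J₅ = reorient refl (theta-addition 3 2 2) swap swap

  J₄J₄ : J₄ * J₄ ≈ T₂ * T₀ - q ^ 4 * (T₈ * T₁₀)
  J₄J₄ = reorient refl (theta-addition 4 0 2) swap swap

  -- Up to powers of q, the products Jᵢ Jⱼ are the 2 × 2 minors of the matrix with rows (T₁₀₋ₛ) and (Tₛ),
  -- and the three relations below are Plücker relations between them.

  weierstrass₁ : (J₂ * J₄) * (J₃ * J₃) - q * ((J₁ * J₃) * (J₂ * J₂)) ≈ (J₄ * J₄) * (J₁ * J₅)
  weierstrass₁ = begin
    (J₂ * J₄) * (J₃ * J₃) - q * ((J₁ * J₃) * (J₂ * J₂))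
      ≈⟨ +-cong (*-cong J₂J₆ J₃J₃) (-‿cong (*-congˡ (*-cong J₁J₇ J₂J₂))) ⟩
    (T₂ * T₄ - q ^ 2 * (T₈ * T₆)) * (T₄ * T₀ - q ^ 3 * (T₆ * T₁₀))
      - q * ((T₂ * T₆ - q ^ 1 * (T₈ * T₄)) * (T₆ * T₀ - q ^ 2 * (T₄ * T₁₀)))
      ≈⟨ solve 7 (λ q T₀ T₂ T₄ T₆ T₈ T₁₀ →
           (T₂ :* T₄ :- q :^ 2 :* (T₈ :* T₆)) :* (T₄ :* T₀ :- q :^ 3 :* (T₆ :* T₁₀))
             :- q :* ((T₂ :* T₆ :- q :^ 1 :* (T₈ :* T₄)) :* (T₆ :* T₀ :- q :^ 2 :* (T₄ :* T₁₀)))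
           := (T₂ :* T₀ :- q :^ 4 :* (T₈ :* T₁₀)) :* (T₄ :* T₄ :- q :^ 1 :* (T₆ :* T₆))) refl q T₀ T₂ T₄ T₆ T₈ T₁₀ ⟩
    (T₂ * T₀ - q ^ 4 * (T₈ * T₁₀)) * (T₄ * T₄ - q ^ 1 * (T₆ * T₆))
      ≈⟨ *-cong J₄J₄ J₁J₅ ⟨
    (J₄ * J₄) * (J₁ * J₅) ∎

  weierstrass₂ : (J₄ * J₄) * (J₁ * J₃) + q * ((J₂ * J₄) * (J₁ * J₁)) ≈ (J₃ * J₅) * (J₂ * J₂)
  weierstrass₂ = begin
    (J₄ * J₄) * (J₁ * J₃) + q * ((J₂ * J₄) * (J₁ * J₁))
      ≈⟨ +-cong (*-cong J₄J₄ J₁J₃) (*-congˡ (*-cong J₂J₆ J₁J₁)) ⟩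
    (T₂ * T₀ - q ^ 4 * (T₈ * T₁₀)) * (T₆ * T₂ - q ^ 1 * (T₄ * T₈))
      + q * ((T₂ * T₄ - q ^ 2 * (T₈ * T₆)) * (T₈ * T₀ - q ^ 1 * (T₂ * T₁₀)))
      ≈⟨ solve 7 (λ q T₀ T₂ T₄ T₆ T₈ T₁₀ →
           (T₂ :* T₀ :- q :^ 4 :* (T₈ :* T₁₀)) :* (T₆ :* T₂ :- q :^ 1 :* (T₄ :* T₈))
             :+ q :* ((T₂ :* T₄ :- q :^ 2 :* (T₈ :* T₆)) :* (T₈ :* T₀ :- q :^ 1 :* (T₂ :* T₁₀)))
           := (T₂ :* T₂ :- q :^ 3 :* (T₈ :* T₈)) :* (T₆ :* T₀ :- q :^ 2 :* (T₄ :* T₁₀))) refl q T₀ T₂ T₄ T₆ T₈ T₁₀ ⟩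
    (T₂ * T₂ - q ^ 3 * (T₈ * T₈)) * (T₆ * T₀ - q ^ 2 * (T₄ * T₁₀))
      ≈⟨ *-cong J₃J₅ J₂J₂ ⟨
    (J₃ * J₅) * (J₂ * J₂) ∎

  weierstrass₃ : (J₃ * J₅) * (J₃ * J₃) - q ^ 2 * ((J₁ * J₃) * (J₁ * J₁)) ≈ (J₄ * J₄) * (J₂ * J₄)
  weierstrass₃ = begin
    (J₃ * J₅) * (J₃ * J₃) - q ^ 2 * ((J₁ * J₃) * (J₁ * J₁))
      ≈⟨ +-cong (*-cong J₃J₅ J₃J₃) (-‿cong (*-congˡ (*-cong J₁J₇ J₁J₁))) ⟩
    (T₂ * T₂ - q ^ 3 * (T₈ * T₈)) * (T₄ * T₀ - q ^ 3 * (T₆ * T₁₀))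
      - q ^ 2 * ((T₂ * T₆ - q ^ 1 * (T₈ * T₄)) * (T₈ * T₀ - q ^ 1 * (T₂ * T₁₀)))
      ≈⟨ solve 7 (λ q T₀ T₂ T₄ T₆ T₈ T₁₀ →
           (T₂ :* T₂ :- q :^ 3 :* (T₈ :* T₈)) :* (T₄ :* T₀ :- q :^ 3 :* (T₆ :* T₁₀))
             :- q :^ 2 :* ((T₂ :* T₆ :- q :^ 1 :* (T₈ :* T₄)) :* (T₈ :* T₀ :- q :^ 1 :* (T₂ :* T₁₀)))
           := (T₂ :* T₀ :- q :^ 4 :* (T₈ :* T₁₀)) :* (T₄ :* T₂ :- q :^ 2 :* (T₆ :* T₈))) refl q T₀ T₂ T₄ T₆ T₈ T₁₀ ⟩
    (T₂ * T₀ - q ^ 4 * (T₈ * T₁₀)) * (T₄ * T₂ - q ^ 2 * (T₆ * T₈))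
      ≈⟨ *-cong J₄J₄ J₂J₄ ⟨
    (J₄ * J₄) * (J₂ * J₄) ∎

  -- In these terms φ(-q^k) = g_k² f_2k, which is `J k k`, and ψ(q^k) = m_k f_2k.
  f₁ f₂ f₅ f₁₀ g₁ g₅ m₁ m₅ ψ₁ ψ₅ : Carrier
  f₁  = ⟨ q ^ 1 ⨾ 1 ⟩
  f₂  = ⟨ q ^ 2 ⨾ 2 ⟩
  f₅  = ⟨ q ^ 5 ⨾ 5 ⟩
  f₁₀ = ⟨ q ^ 10 ⨾ 10 ⟩
  g₁  = ⟨ q ^ 1 ⨾ 2 ⟩
  g₅  = ⟨ q ^ 5 ⨾ 10 ⟩
  m₁  = ⟨ - q ^ 1 ⨾ 1 ⟩
  m₅  = ⟨ - q ^ 5 ⨾ 5 ⟩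
  ψ₁  = m₁ * f₂
  ψ₅  = m₅ * f₁₀

  f₁≈g₁f₂ : f₁ ≈ g₁ * f₂
  f₁≈g₁f₂ = split₂ 1 1

  f₅≈g₅f₁₀ : f₅ ≈ g₅ * f₁₀
  f₅≈g₅f₁₀ = split₂ 5 5

  private
    -- Euler's identity (-q; q)(q; q²) = 1: both hypotheses express f₁ through f₂, and f₂ is
    -- cancelled.
    m*g≈1 : ∀ {f f′ g m} → Principal f′ → f ≈ g * f′ → f * m ≈ f′ → m * g ≈ 1#
    m*g≈1 {f} {f′} {g} {m} pf′ f≈ fm≈ = principal⇒regular pf′ (begin
      f′ * (m * g)   ≈⟨ solve 3 (λ f m g → f :* (m :* g) := g :* f :* m) refl f′ m g ⟩
      g * f′ * m     ≈⟨ *-congʳ f≈ ⟨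
      f * m          ≈⟨ fm≈ ⟩
      f′             ≈⟨ *-identityʳ f′ ⟨
      f′ * 1#        ∎)

    Θ≈2ψ : ∀ {f f′ g m n} → f ≈ g * f′ → m * g ≈ 1# → n ≈ (1# + 1#) * m → m * n * f ≈ (1# + 1#) * (m * f′)
    Θ≈2ψ {f} {f′} {g} {m} {n} f≈ mg≈1 n≈ = begin
      m * n * f                            ≈⟨ *-cong (*-congˡ n≈) f≈ ⟩
      m * ((1# + 1#) * m) * (g * f′)       ≈⟨ solve 3 (λ m g f → m :* ((𝟙 :+ 𝟙) :* m) :* (g :* f) := (𝟙 :+ 𝟙) :* (m :* f) :* (m :* g)) refl m g f′ ⟩
      (1# + 1#) * (m * f′) * (m * g)       ≈⟨ *-congˡ mg≈1 ⟩
      (1# + 1#) * (m * f′) * 1#            ≈⟨ *-identityʳ _ ⟩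
      (1# + 1#) * (m * f′)                 ∎

    ⟨−1⨾⟩ : ∀ k .{{_ : NonZero k}} → ⟨ - 1# ⨾ k ⟩ ≈ (1# + 1#) * ⟨ - q ^ k ⨾ k ⟩
    ⟨−1⨾⟩ k = trans (⟨⨾⟩-step (- 1#) k) (*-cong (solve 0 (𝟙 :- (:- 𝟙) := 𝟙 :+ 𝟙) refl)
      (⟨⨾⟩-cong k (solve 1 (λ x → :- 𝟙 :* x := :- x) refl (q ^ k))))

  m₁g₁≈1 : m₁ * g₁ ≈ 1#
  m₁g₁≈1 = m*g≈1 (q^-principal 2 2) f₁≈g₁f₂ (⟨⨾⟩-difference-of-squares 1 1)

  m₅g₅≈1 : m₅ * g₅ ≈ 1#
  m₅g₅≈1 = m*g≈1 (q^-principal 10 10) f₅≈g₅f₁₀ (⟨⨾⟩-difference-of-squares 5 5)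

  Θ₁≈2ψ₁ : Θ 1 0 ≈ (1# + 1#) * ψ₁
  Θ₁≈2ψ₁ = Θ≈2ψ f₁≈g₁f₂ m₁g₁≈1 (⟨−1⨾⟩ 1)

  Θ₅≈2ψ₅ : Θ 5 0 ≈ (1# + 1#) * ψ₅
  Θ₅≈2ψ₅ = Θ≈2ψ f₅≈g₅f₁₀ m₅g₅≈1 (⟨−1⨾⟩ 5)

  -- The residues 2 and 7 modulo 10 form (q²; q⁵), which together with (-q²; q⁵) gives (q⁴; q¹⁰);
  -- the residues 3 and 8 give (q⁶; q¹⁰) likewise.
  Θ₃₂-product : Θ 3 2 * (J₂ * J₃) ≈ J₄ * (f₅ * f₁₀)
  Θ₃₂-product = begin
    n₃ * n₂ * f₅ * (P₂ * P₈ * f₁₀ * (P₃ * P₇ * f₁₀))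
      ≈⟨ solve 8 (λ n₃ n₂ f₅ P₂ P₈ F P₃ P₇ → n₃ :* n₂ :* f₅ :* (P₂ :* P₈ :* F :* (P₃ :* P₇ :* F))
           := (P₂ :* P₇ :* n₂) :* (P₃ :* P₈ :* n₃) :* F :* (f₅ :* F)) refl n₃ n₂ f₅ P₂ P₈ f₁₀ P₃ P₇ ⟩
    (P₂ * P₇ * n₂) * (P₃ * P₈ * n₃) * f₁₀ * (f₅ * f₁₀)
      ≈⟨ *-congʳ (*-congʳ (*-cong
           (trans (*-congʳ (sym (split₂ 2 5))) (⟨⨾⟩-difference-of-squares 2 5))
           (trans (*-congʳ (sym (split₂ 3 5))) (⟨⨾⟩-difference-of-squares 3 5)))) ⟩
    J₄ * (f₅ * f₁₀) ∎
    where
    n₂ = ⟨ - q ^ 2 ⨾ 5 ⟩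
    n₃ = ⟨ - q ^ 3 ⨾ 5 ⟩
    P₂ = ⟨ q ^ 2 ⨾ 10 ⟩
    P₃ = ⟨ q ^ 3 ⨾ 10 ⟩
    P₇ = ⟨ q ^ 7 ⨾ 10 ⟩
    P₈ = ⟨ q ^ 8 ⨾ 10 ⟩

  Θ₄₁-product : Θ 4 1 * (J₁ * J₄) ≈ J₂ * (f₅ * f₁₀)
  Θ₄₁-product = begin
    n₄ * n₁ * f₅ * (P₁ * P₉ * f₁₀ * (P₄ * P₆ * f₁₀))
      ≈⟨ solve 8 (λ n₄ n₁ f₅ P₁ P₉ F P₄ P₆ → n₄ :* n₁ :* f₅ :* (P₁ :* P₉ :* F :* (P₄ :* P₆ :* F))
           := (P₁ :* P₆ :* n₁) :* (P₄ :* P₉ :* n₄) :* F :* (f₅ :* F)) refl n₄ n₁ f₅ P₁ P₉ f₁₀ P₄ P₆ ⟩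
    (P₁ * P₆ * n₁) * (P₄ * P₉ * n₄) * f₁₀ * (f₅ * f₁₀)
      ≈⟨ *-congʳ (*-congʳ (*-cong
           (trans (*-congʳ (sym (split₂ 1 5))) (⟨⨾⟩-difference-of-squares 1 5))
           (trans (*-congʳ (sym (split₂ 4 5))) (⟨⨾⟩-difference-of-squares 4 5)))) ⟩
    J₂ * (f₅ * f₁₀) ∎
    where
    n₁ = ⟨ - q ^ 1 ⨾ 5 ⟩
    n₄ = ⟨ - q ^ 4 ⨾ 5 ⟩
    P₁ = ⟨ q ^ 1 ⨾ 10 ⟩
    P₄ = ⟨ q ^ 4 ⨾ 10 ⟩
    P₆ = ⟨ q ^ 6 ⨾ 10 ⟩
    P₉ = ⟨ q ^ 9 ⨾ 10 ⟩

  -- The odd residues modulo 10 make up (q; q²), which cancels `m₁` by Euler's identity; the even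
  -- ones make up `f₂`.
  ψ₁-product : ψ₁ * (J₁ * J₃ * g₅) ≈ J₂ * J₄ * f₁₀
  ψ₁-product = begin
    m₁ * f₂ * (P₁ * P₉ * f₁₀ * (P₃ * P₇ * f₁₀) * g₅)
      ≈⟨ solve 8 (λ m f P₁ P₉ F P₃ P₇ P₅ → m :* f :* (P₁ :* P₉ :* F :* (P₃ :* P₇ :* F) :* P₅)
           := m :* (𝟙 :* P₁ :* P₃ :* P₅ :* P₇ :* P₉) :* f :* (F :* F)) refl m₁ f₂ P₁ P₉ f₁₀ P₃ P₇ g₅ ⟩
    m₁ * (1# * P₁ * P₃ * g₅ * P₇ * P₉) * f₂ * (f₁₀ * f₁₀)
      ≈⟨ *-congʳ (*-cong (trans (*-congˡ (sym (⟨⨾⟩-split 5 1 2))) m₁g₁≈1) (⟨⨾⟩-split 5 2 2)) ⟩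
    1# * (1# * P₂ * P₄ * P₆ * P₈ * f₁₀) * (f₁₀ * f₁₀)
      ≈⟨ solve 5 (λ P₂ P₄ P₆ P₈ F → 𝟙 :* (𝟙 :* P₂ :* P₄ :* P₆ :* P₈ :* F) :* (F :* F)
           := P₂ :* P₈ :* F :* (P₄ :* P₆ :* F) :* F) refl P₂ P₄ P₆ P₈ f₁₀ ⟩
    J₂ * J₄ * f₁₀ ∎
    where
    P₁ = ⟨ q ^ 1 ⨾ 10 ⟩
    P₂ = ⟨ q ^ 2 ⨾ 10 ⟩
    P₃ = ⟨ q ^ 3 ⨾ 10 ⟩
    P₄ = ⟨ q ^ 4 ⨾ 10 ⟩
    P₆ = ⟨ q ^ 6 ⨾ 10 ⟩
    P₇ = ⟨ q ^ 7 ⨾ 10 ⟩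
    P₈ = ⟨ q ^ 8 ⨾ 10 ⟩
    P₉ = ⟨ q ^ 9 ⨾ 10 ⟩

  sum-residues₅ : ∀ {f : ℤ → Carrier} {s₀ s₁ s₂ s₃ s₄} →
    HasSum (λ m → f (0ℤ ℤ.+ m ℤ.* + 5)) s₀ → HasSum (λ m → f (1ℤ ℤ.+ m ℤ.* + 5)) s₁ →
    HasSum (λ m → f (+ 2 ℤ.+ m ℤ.* + 5)) s₂ →
    HasSum (λ m → f (+ 3 ℤ.+ reflect m ℤ.* + 5)) s₃ → HasSum (λ m → f (+ 4 ℤ.+ reflect m ℤ.* + 5)) s₄ →
    HasSum f (s₀ + (s₁ + (s₂ + (s₃ + (s₄ + 0#)))))
  sum-residues₅ {f} {s₀} {s₁} {s₂} {s₃} {s₄} h₀ h₁ h₂ h₃ h₄ =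
    sum-reindex (residueClass 5) (residueClass-injective 5) (residueClass-surjective 5) (sum-Fin 5 parts)
    where
    total : Fin 5 → Carrier
    total zero                         = s₀
    total (suc zero)                   = s₁
    total (suc (suc zero))             = s₂
    total (suc (suc (suc zero)))       = s₃
    total (suc (suc (suc (suc zero)))) = s₄

    reflected : ∀ {g : ℤ → Carrier} {s} → HasSum (g ∘ reflect) s → HasSum g s
    reflected = sum-reindex reflect
      (λ {i} {j} e → ≡.trans (≡.sym (reflect-involutive i)) (≡.trans (≡.cong reflect e) (reflect-involutive j)))
      (λ i → reflect i , reflect-involutive i)

    parts : ∀ r → HasSum (λ m → f (residueClass 5 (r , m))) (total r)
    parts zero                         = h₀
    parts (suc zero)                   = h₁
    parts (suc (suc zero))             = h₂
    parts (suc (suc (suc zero)))       = reflected h₃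
    parts (suc (suc (suc (suc zero)))) = reflected h₄

  -- On a class parametrised by h the sign needs only the parity of h, and the exponent only its
  -- quadratic polynomial; up to s^r q^c another theta series results.
  theta-class : ∀ {s S} i j a b (h : ℤ → ℤ) r c → s * s ≈ 1# →
    (∀ m → ∃ λ k → h m ≡ double k ℤ.+ (m ℤ.+ + r)) →
    (∀ m → thetaQuadratic (+ i) (+ j) (h m) ≡ double (+ c) ℤ.+ thetaQuadratic (+ a) (+ b) m) →
    HasSum (thetaTerm s a b) S → HasSum (thetaTerm s i j ∘ h) (s ^ r * q ^ c * S)
  theta-class {s} i j a b h r c s²≈1 parity quad hS = sum-cong (λ m → sym (begin
    s ^ ∣ h m ∣ * q ^ thetaExponent i j (h m)
      ≈⟨ *-cong (sign-parity s²≈1 m (proj₁ (parity m)) r (proj₂ (parity m))) (trans (reflexive (≡.cong (q ^_) (exponent m))) (^-homo-* q c _)) ⟩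
    s ^ r * s ^ ∣ m ∣ * (q ^ c * q ^ thetaExponent a b m)
      ≈⟨ solve 4 (λ a b c d → a :* b :* (c :* d) := a :* c :* (b :* d)) refl _ _ _ _ ⟩
    s ^ r * q ^ c * thetaTerm s a b m ∎)) refl (sum-scale (s ^ r * q ^ c) hS)
    where
    exponent : ∀ m → thetaExponent i j (h m) ≡ c ℕ.+ thetaExponent a b m
    exponent m = double-injective (≡.trans (double-thetaExponent i j (h m)) (≡.trans (quad m)
      (≡.trans (≡.cong (λ e → double (+ c) ℤ.+ e) (≡.sym (double-thetaExponent a b m))) (≡.sym (double-+ c (thetaExponent a b m))))))

  -- The coefficients 2 arise because the residues r and -r contribute equally.
  φ-dissection : J 1 1 ≈ J 25 25 - (1# + 1#) * (q * J 35 15) + (1# + 1#) * (q ^ 4 * J 45 5)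
  φ-dissection = trans (sum-unique ℤ._≟_ (J-sum 1 1) (sum-residues₅
      (theta-class 1 1 25 25 _ 0 0 −1²≈1 (direct-parity 0ℤ) (φ-direct 0ℤ) (J-sum 25 25))
      (theta-class 1 1 35 15 _ 1 1 −1²≈1 (direct-parity 1ℤ) (φ-direct 1ℤ) (J-sum 35 15))
      (theta-class 1 1 45 5 _ 2 4 −1²≈1 (direct-parity (+ 2)) (φ-direct (+ 2)) (J-sum 45 5))
      (theta-class 1 1 45 5 _ 2 4 −1²≈1 (reflected-parity (+ 2)) (φ-reflected (+ 2)) (J-sum 45 5))
      (theta-class 1 1 35 15 _ 1 1 −1²≈1 (reflected-parity 1ℤ) (φ-reflected 1ℤ) (J-sum 35 15))))
    (trans (+-congˡ (+-congˡ (+-congˡ (+-congˡ (+-identityʳ _)))))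
      (solve 4 (λ q J₀ J₁ J₂ → let s = :- 𝟙 in
        s :^ 0 :* q :^ 0 :* J₀ :+ (s :^ 1 :* q :^ 1 :* J₁ :+ (s :^ 2 :* q :^ 4 :* J₂
          :+ (s :^ 2 :* q :^ 4 :* J₂ :+ s :^ 1 :* q :^ 1 :* J₁)))
        := J₀ :- (𝟙 :+ 𝟙) :* (q :* J₁) :+ (𝟙 :+ 𝟙) :* (q :^ 4 :* J₂)) refl q _ _ _))

  -- The symmetry m ↦ -1 - m of the exponent exchanges the residues 0 and 4, and 1 and 3. Residue 2
  -- is its own mirror image, and its factor 2 is hidden in `Θ 25 0`.
  ψ-dissection : Θ 1 0 ≈ (1# + 1#) * Θ 15 10 + (1# + 1#) * (q * Θ 20 5) + q ^ 3 * Θ 25 0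
  ψ-dissection = trans (sum-unique ℤ._≟_ (Θ-sum 1 0) (sum-residues₅
      (theta-class 1 0 15 10 _ 0 0 1² (direct-parity 0ℤ) (ψ-direct 0ℤ) (Θ-sum 15 10))
      (theta-class 1 0 20 5 _ 1 1 1² (direct-parity 1ℤ) (ψ-direct 1ℤ) (Θ-sum 20 5))
      (theta-class 1 0 25 0 _ 2 3 1² (direct-parity (+ 2)) (ψ-direct (+ 2)) (Θ-sum 25 0))
      (theta-class 1 0 20 5 _ 2 1 1² (reflected-parity (+ 2)) (ψ-reflected (+ 2)) (Θ-sum 20 5))
      (theta-class 1 0 15 10 _ 1 0 1² (reflected-parity 1ℤ) (ψ-reflected 1ℤ) (Θ-sum 15 10))))
    (trans (+-congˡ (+-congˡ (+-congˡ (+-congˡ (+-identityʳ _)))))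
      (solve 4 (λ q Θ₀ Θ₁ Θ₂ → let s = 𝟙 in
        s :^ 0 :* q :^ 0 :* Θ₀ :+ (s :^ 1 :* q :^ 1 :* Θ₁ :+ (s :^ 2 :* q :^ 3 :* Θ₂
          :+ (s :^ 2 :* q :^ 1 :* Θ₁ :+ s :^ 1 :* q :^ 0 :* Θ₀)))
        := (𝟙 :+ 𝟙) :* Θ₀ :+ (𝟙 :+ 𝟙) :* (q :* Θ₁) :+ q :^ 3 :* Θ₂) refl q _ _ _))
    where
    1² = *-identityˡ 1#

-- The parameters k and ρ

module Parametrisation (A : QSeriesRing) where
  open QSeriesRing A
  open Theta A
  open Products A
  open SetoidReasoning setoid

  principal-J : ∀ i j .{{_ : NonZero i}} .{{_ : NonZero j}} .{{_ : NonZero (i ℕ.+ j)}} → Principal (J i j)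
  principal-J i j = principal-* (principal-* (q^-principal i _) (q^-principal j _)) (q^-principal (i ℕ.+ j) _)

  regular-J : ∀ i j .{{_ : NonZero i}} .{{_ : NonZero j}} .{{_ : NonZero (i ℕ.+ j)}} → Regular (J i j)
  regular-J i j = principal⇒regular (principal-J i j)

  -- Reduces an identity that holds modulo known relations to one valid in every commutative ring.
  -- The coefficient c is the cofactor of the relation.
  combination₁ : ∀ {x y l r} c → l ≈ r → x ≈ y + c * (l - r) → x ≈ y
  combination₁ {y = y} {l} {r} c l≈r e = trans e (trans (+-congˡ (*-congˡ (+-congʳ l≈r)))
    (trans (+-congˡ (trans (*-congˡ (-‿inverseʳ r)) (zeroʳ c))) (+-identityʳ y)))

  combination₂ : ∀ {x y l r l′ r′} c c′ → l ≈ r → l′ ≈ r′ → x ≈ y + c * (l - r) + c′ * (l′ - r′) → x ≈ y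
  combination₂ c c′ l≈r l′≈r′ e = combination₁ c l≈r (combination₁ c′ l′≈r′ e)

  combination₃ : ∀ {x y l r l′ r′ l″ r″} c c′ c″ → l ≈ r → l′ ≈ r′ → l″ ≈ r″ →
    x ≈ y + c * (l - r) + c′ * (l′ - r′) + c″ * (l″ - r″) → x ≈ y
  combination₃ c c′ c″ l≈r l′≈r′ l″≈r″ e = combination₁ c l≈r (combination₂ c′ c″ l′≈r′ l″≈r″ e)

  module _ {κ ρ : Carrier} (κ-def : κ * (J₃ * J₄) ≈ J₁ * J₂) (ρ-def : ρ * (J₂ * J₃) ≈ J₁ * J₄) where

    private
      -- The quotient κ of the products J has constant term 1, hence can be cancelled as a principal
      -- series; the extra q makes it Ramanujan's k.
      k = q * κ
      A₀ = Θ 3 2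
      B₀ = Θ 4 1

    -- This is `weierstrass₁` divided by J₂J₃²J₄.
    1-k : (1# - k) * (J₂ * (J₃ * J₃)) ≈ J₁ * J₄ * J₅
    1-k = regular-J 4 6 (combination₂ 1# (- (q * J₂ * J₃)) weierstrass₁ κ-def
      (solve 7 (λ q κ J₁ J₂ J₃ J₄ J₅ → J₄ :* ((𝟙 :- q :* κ) :* (J₂ :* (J₃ :* J₃)))
        := J₄ :* (J₁ :* J₄ :* J₅)
          :+ 𝟙 :* ((J₂ :* J₄) :* (J₃ :* J₃) :- q :* ((J₁ :* J₃) :* (J₂ :* J₂)) :- (J₄ :* J₄) :* (J₁ :* J₅))
          :+ (:- (q :* J₂ :* J₃)) :* (κ :* (J₃ :* J₄) :- J₁ :* J₂)) refl q κ J₁ J₂ J₃ J₄ J₅))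

    -- This is `weierstrass₂` divided by J₁J₃J₄².
    1+k : (1# + k) * (J₁ * (J₄ * J₄)) ≈ J₂ * J₂ * J₅
    1+k = regular-J 3 7 (combination₂ 1# (q * J₁ * J₄) weierstrass₂ κ-def
      (solve 7 (λ q κ J₁ J₂ J₃ J₄ J₅ → J₃ :* ((𝟙 :+ q :* κ) :* (J₁ :* (J₄ :* J₄)))
        := J₃ :* (J₂ :* J₂ :* J₅)
          :+ 𝟙 :* ((J₄ :* J₄) :* (J₁ :* J₃) :+ q :* ((J₂ :* J₄) :* (J₁ :* J₁)) :- (J₃ :* J₅) :* (J₂ :* J₂))
          :+ (q :* J₁ :* J₄) :* (κ :* (J₃ :* J₄) :- J₁ :* J₂)) refl q κ J₁ J₂ J₃ J₄ J₅))

    -- Subtracting k² = q²J₁²J₂²/(J₃J₄)² from the quotient for 1 + k leaves J₂²/(J₁J₃³J₄²) times the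
    -- left side of `weierstrass₃`.
    1+k-k² : (1# + k - k * k) * (J₁ * (J₃ * J₃ * J₃)) ≈ J₂ * J₂ * J₂ * J₄
    1+k-k² = regular-* (regular-J 4 6) (regular-J 4 6)
      (combination₃ (J₃ * J₃ * J₃) (J₂ * J₂) (- (q * q * J₁ * J₃ * (κ * (J₃ * J₄) + J₁ * J₂))) 1+k weierstrass₃ κ-def
      (solve 7 (λ q κ J₁ J₂ J₃ J₄ J₅ → J₄ :* J₄ :* ((𝟙 :+ q :* κ :- q :* κ :* (q :* κ)) :* (J₁ :* (J₃ :* J₃ :* J₃)))
        := J₄ :* J₄ :* (J₂ :* J₂ :* J₂ :* J₄)
          :+ J₃ :* J₃ :* J₃ :* ((𝟙 :+ q :* κ) :* (J₁ :* (J₄ :* J₄)) :- J₂ :* J₂ :* J₅)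
          :+ J₂ :* J₂ :* ((J₃ :* J₅) :* (J₃ :* J₃) :- q :^ 2 :* ((J₁ :* J₃) :* (J₁ :* J₁)) :- (J₄ :* J₄) :* (J₂ :* J₄))
          :+ (:- (q :* q :* J₁ :* J₃ :* (κ :* (J₃ :* J₄) :+ J₁ :* J₂))) :* (κ :* (J₃ :* J₄) :- J₁ :* J₂))
        refl q κ J₁ J₂ J₃ J₄ J₅))

    private
      ratio : (1# - k) * (J₂ * J₂ * J₂ * (J₃ * J₃)) ≈ (1# + k) * (J₁ * J₁ * (J₄ * J₄ * J₄))
      ratio = regular-J 5 5 (combination₂ (J₂ * J₂ * J₅) (- (J₁ * J₄ * J₅)) 1-k 1+k
        (solve 6 (λ k J₁ J₂ J₃ J₄ J₅ → J₅ :* ((𝟙 :- k) :* (J₂ :* J₂ :* J₂ :* (J₃ :* J₃)))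
          := J₅ :* ((𝟙 :+ k) :* (J₁ :* J₁ :* (J₄ :* J₄ :* J₄)))
            :+ J₂ :* J₂ :* J₅ :* ((𝟙 :- k) :* (J₂ :* (J₃ :* J₃)) :- J₁ :* J₄ :* J₅)
            :+ (:- (J₁ :* J₄ :* J₅)) :* ((𝟙 :+ k) :* (J₁ :* (J₄ :* J₄)) :- J₂ :* J₂ :* J₅))
          refl k J₁ J₂ J₃ J₄ J₅))

    -- Eliminating J₅ gives (1 - k)/(1 + k) = J₁²J₄³/(J₂³J₃²), and the square of this is exactly
    -- ρ⁵/κ.
    modular-equation : κ * (1# - k) ^ 2 ≈ ρ ^ 5 * (1# + k) ^ 2
    modular-equation = regular-* (regular-* (regular-J 3 7) (regular-J 4 6)) (regular-^ (regular-* (regular-J 2 8) (regular-J 3 7)) 5) (begin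
      J₃ * J₄ * (J₂ * J₃) ^ 5 * (κ * (1# - k) ^ 2)
        ≈⟨ solve 5 (λ κ k J₂ J₃ J₄ → J₃ :* J₄ :* (J₂ :* J₃) :^ 5 :* (κ :* (𝟙 :- k) :^ 2)
             := κ :* (J₃ :* J₄) :* ((J₂ :* J₃) :^ 5 :* (𝟙 :- k) :^ 2)) refl κ k J₂ J₃ J₄ ⟩
      κ * (J₃ * J₄) * ((J₂ * J₃) ^ 5 * (1# - k) ^ 2)
        ≈⟨ *-congʳ κ-def ⟩
      J₁ * J₂ * ((J₂ * J₃) ^ 5 * (1# - k) ^ 2)
        ≈⟨ solve 4 (λ k J₁ J₂ J₃ → J₁ :* J₂ :* ((J₂ :* J₃) :^ 5 :* (𝟙 :- k) :^ 2)
             := J₁ :* J₃ :* ((𝟙 :- k) :* (J₂ :* J₂ :* J₂ :* (J₃ :* J₃))) :^ 2) refl k J₁ J₂ J₃ ⟩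
      J₁ * J₃ * ((1# - k) * (J₂ * J₂ * J₂ * (J₃ * J₃))) ^ 2
        ≈⟨ *-congˡ (^-congˡ 2 ratio) ⟩
      J₁ * J₃ * ((1# + k) * (J₁ * J₁ * (J₄ * J₄ * J₄))) ^ 2
        ≈⟨ solve 4 (λ k J₁ J₃ J₄ → J₁ :* J₃ :* ((𝟙 :+ k) :* (J₁ :* J₁ :* (J₄ :* J₄ :* J₄))) :^ 2
             := J₃ :* J₄ :* (𝟙 :+ k) :^ 2 :* (J₁ :* J₄) :^ 5) refl k J₁ J₃ J₄ ⟩
      J₃ * J₄ * (1# + k) ^ 2 * (J₁ * J₄) ^ 5
        ≈⟨ *-congˡ (^-congˡ 5 ρ-def) ⟨
      J₃ * J₄ * (1# + k) ^ 2 * (ρ * (J₂ * J₃)) ^ 5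
        ≈⟨ solve 5 (λ ρ k J₂ J₃ J₄ → J₃ :* J₄ :* (𝟙 :+ k) :^ 2 :* (ρ :* (J₂ :* J₃)) :^ 5
             := J₃ :* J₄ :* (J₂ :* J₃) :^ 5 :* (ρ :^ 5 :* (𝟙 :+ k) :^ 2)) refl ρ k J₂ J₃ J₄ ⟩
      J₃ * J₄ * (J₂ * J₃) ^ 5 * (ρ ^ 5 * (1# + k) ^ 2) ∎)

    -- The ratios J₃/J₅ and J₁/J₅, taken at q⁵, are the coefficients of the dissection of φ relative
    -- to its leading term.
    J₃-parameter : J₃ * (1# - k) ≈ J₅ * ρ
    J₃-parameter = regular-* (regular-J 2 8) (regular-J 3 7) (combination₂ 1# (- J₅) 1-k ρ-def
      (solve 7 (λ ρ k J₁ J₂ J₃ J₄ J₅ → J₂ :* J₃ :* (J₃ :* (𝟙 :- k)) := J₂ :* J₃ :* (J₅ :* ρ)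
        :+ 𝟙 :* ((𝟙 :- k) :* (J₂ :* (J₃ :* J₃)) :- J₁ :* J₄ :* J₅) :+ (:- J₅) :* (ρ :* (J₂ :* J₃) :- J₁ :* J₄))
        refl ρ k J₁ J₂ J₃ J₄ J₅))

    J₁-parameter : ρ * J₁ * (1# + k) ≈ κ * J₅
    J₁-parameter = regular-* (regular-* (regular-J 2 8) (regular-J 3 7)) (regular-J 4 6)
      (combination₃ (J₁ * J₄ * (1# + k)) J₁ (- (J₂ * J₅)) ρ-def 1+k κ-def
      (solve 8 (λ κ ρ k J₁ J₂ J₃ J₄ J₅ → J₂ :* J₃ :* J₄ :* (ρ :* J₁ :* (𝟙 :+ k)) := J₂ :* J₃ :* J₄ :* (κ :* J₅)
        :+ J₁ :* J₄ :* (𝟙 :+ k) :* (ρ :* (J₂ :* J₃) :- J₁ :* J₄)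
        :+ J₁ :* ((𝟙 :+ k) :* (J₁ :* (J₄ :* J₄)) :- J₂ :* J₂ :* J₅)
        :+ (:- (J₂ :* J₅)) :* (κ :* (J₃ :* J₄) :- J₁ :* J₂)) refl κ ρ k J₁ J₂ J₃ J₄ J₅))

    private
      ψ₅g₅ : ψ₅ * g₅ ≈ f₁₀
      ψ₅g₅ = trans (solve 3 (λ m f g → m :* f :* g := m :* g :* f) refl m₅ f₁₀ g₅) (trans (*-congʳ m₅g₅≈1) (*-identityˡ _))

      g₅f₅ : g₅ * f₅ ≈ J₅
      g₅f₅ = trans (*-congˡ f₅≈g₅f₁₀) (sym (*-assoc _ _ _))

      regular-g₅ : Regular g₅
      regular-g₅ = principal⇒regular (q^-principal 5 10)

    -- Together with `B-parameter` this makes the ratios in the dissection of ψ rational: f(q³,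
    -- q²)/ψ(q⁵) = ρ²(1 + k)/κ and f(q⁴, q)/ψ(q⁵) = (1 - k)/ρ².
    A-parameter : A₀ * κ ≈ ψ₅ * ρ ^ 2 * (1# + k)
    A-parameter = regular-* (regular-* regular-g₅ (regular-^ (regular-* (regular-J 2 8) (regular-J 3 7)) 2)) (regular-J 4 6) (begin
      g₅ * (J₂ * J₃) ^ 2 * J₄ * (A₀ * κ)
        ≈⟨ solve 6 (λ g J₂ J₃ J₄ A κ → g :* (J₂ :* J₃) :^ 2 :* J₄ :* (A :* κ)
             := g :* (A :* (J₂ :* J₃)) :* (κ :* (J₃ :* J₄)) :* J₂) refl g₅ J₂ J₃ J₄ A₀ κ ⟩
      g₅ * (A₀ * (J₂ * J₃)) * (κ * (J₃ * J₄)) * J₂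
        ≈⟨ *-congʳ (*-cong (*-congˡ Θ₃₂-product) κ-def) ⟩
      g₅ * (J₄ * (f₅ * f₁₀)) * (J₁ * J₂) * J₂
        ≈⟨ solve 6 (λ g f F J₁ J₂ J₄ → g :* (J₄ :* (f :* F)) :* (J₁ :* J₂) :* J₂ := F :* J₁ :* J₄ :* (J₂ :* J₂ :* (g :* f)))
             refl g₅ f₅ f₁₀ J₁ J₂ J₄ ⟩
      f₁₀ * J₁ * J₄ * (J₂ * J₂ * (g₅ * f₅))
        ≈⟨ *-congˡ (trans (*-congˡ g₅f₅) (sym 1+k)) ⟩
      f₁₀ * J₁ * J₄ * ((1# + k) * (J₁ * (J₄ * J₄)))
        ≈⟨ solve 4 (λ F J₁ J₄ k → F :* J₁ :* J₄ :* ((𝟙 :+ k) :* (J₁ :* (J₄ :* J₄))) := F :* (J₁ :* J₄) :^ 2 :* (J₄ :* (𝟙 :+ k)))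
             refl f₁₀ J₁ J₄ k ⟩
      f₁₀ * (J₁ * J₄) ^ 2 * (J₄ * (1# + k))
        ≈⟨ *-congʳ (*-cong ψ₅g₅ (^-congˡ 2 ρ-def)) ⟨
      ψ₅ * g₅ * (ρ * (J₂ * J₃)) ^ 2 * (J₄ * (1# + k))
        ≈⟨ solve 7 (λ ψ g ρ J₂ J₃ J₄ k → ψ :* g :* (ρ :* (J₂ :* J₃)) :^ 2 :* (J₄ :* (𝟙 :+ k))
             := g :* (J₂ :* J₃) :^ 2 :* J₄ :* (ψ :* ρ :^ 2 :* (𝟙 :+ k))) refl ψ₅ g₅ ρ J₂ J₃ J₄ k ⟩
      g₅ * (J₂ * J₃) ^ 2 * J₄ * (ψ₅ * ρ ^ 2 * (1# + k)) ∎)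

    B-parameter : B₀ * ρ ^ 2 ≈ ψ₅ * (1# - k)
    B-parameter = regular-* regular-g₅ (regular-^ (regular-* (regular-J 2 8) (regular-J 3 7)) 2) (begin
      g₅ * (J₂ * J₃) ^ 2 * (B₀ * ρ ^ 2)
        ≈⟨ solve 5 (λ g J₂ J₃ B ρ → g :* (J₂ :* J₃) :^ 2 :* (B :* ρ :^ 2) := g :* B :* (ρ :* (J₂ :* J₃)) :^ 2)
             refl g₅ J₂ J₃ B₀ ρ ⟩
      g₅ * B₀ * (ρ * (J₂ * J₃)) ^ 2
        ≈⟨ *-congˡ (^-congˡ 2 ρ-def) ⟩
      g₅ * B₀ * (J₁ * J₄) ^ 2
        ≈⟨ solve 4 (λ g B J₁ J₄ → g :* B :* (J₁ :* J₄) :^ 2 := g :* (B :* (J₁ :* J₄)) :* (J₁ :* J₄)) refl g₅ B₀ J₁ J₄ ⟩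
      g₅ * (B₀ * (J₁ * J₄)) * (J₁ * J₄)
        ≈⟨ *-congʳ (*-congˡ Θ₄₁-product) ⟩
      g₅ * (J₂ * (f₅ * f₁₀)) * (J₁ * J₄)
        ≈⟨ solve 6 (λ g f F J₁ J₂ J₄ → g :* (J₂ :* (f :* F)) :* (J₁ :* J₄) := F :* J₂ :* (J₁ :* J₄ :* (g :* f)))
             refl g₅ f₅ f₁₀ J₁ J₂ J₄ ⟩
      f₁₀ * J₂ * (J₁ * J₄ * (g₅ * f₅))
        ≈⟨ *-cong (*-congʳ ψ₅g₅) (trans 1-k (*-congˡ (sym g₅f₅))) ⟨
      ψ₅ * g₅ * J₂ * ((1# - k) * (J₂ * (J₃ * J₃)))
        ≈⟨ solve 5 (λ ψ g J₂ J₃ k → ψ :* g :* J₂ :* ((𝟙 :- k) :* (J₂ :* (J₃ :* J₃))) := g :* (J₂ :* J₃) :^ 2 :* (ψ :* (𝟙 :- k)))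
             refl ψ₅ g₅ J₂ J₃ k ⟩
      g₅ * (J₂ * J₃) ^ 2 * (ψ₅ * (1# - k)) ∎)

-- σ is the substitution q ↦ q⁵ and U extracts the coefficients of the powers of q⁵.
record DissectionRing : Set₁ where
  field
    qSeriesRing : QSeriesRing

  open QSeriesRing qSeriesRing public

  field
    nonzero-regular : ∀ {u} n → u ≈ ⟦ + suc n ⟧ mod 1 → Regular u

    σ       : Carrier → Carrier
    σ-cong  : ∀ {x y} → x ≈ y → σ x ≈ σ y
    σ-+     : ∀ x y → σ (x + y) ≈ σ x + σ y
    σ-*     : ∀ x y → σ (x * y) ≈ σ x * σ y
    σ-neg   : ∀ x → σ (- x) ≈ - σ x
    σ-const : ∀ n → σ ⟦ n ⟧ ≈ ⟦ n ⟧
    σ-q     : σ q ≈ q ^ 5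
    σ-⟨⨾⟩   : ∀ z k .{{_ : NonZero k}} .{{_ : NonZero (5 ℕ.* k)}} → σ ⟨ z ⨾ k ⟩ ≈ ⟨ σ z ⨾ 5 ℕ.* k ⟩

    U       : Carrier → Carrier
    U-cong  : ∀ {x y} → x ≈ y → U x ≈ U y
    U-+     : ∀ x y → U (x + y) ≈ U x + U y
    U-σ     : ∀ x y → U (σ x * y) ≈ x * U y
    U-1     : U 1# ≈ 1#
    U-q^    : ∀ i → 0 < i → i < 5 → U (q ^ i) ≈ 0#

-- Dissection of f₁ and of the crank series

module Dissection (A : DissectionRing) where
  open DissectionRing A
  open Theta qSeriesRing
  open Products qSeriesRing
  open Parametrisation qSeriesRing
  open SetoidReasoning setoid

  σ-1 : σ 1# ≈ 1#
  σ-1 = trans (σ-cong (sym 1-homo)) (trans (σ-const 1ℤ) 1-homo)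

  σ-^ : ∀ x n → σ (x ^ n) ≈ σ x ^ n
  σ-^ x zero    = σ-1
  σ-^ x (suc n) = trans (σ-* x (x ^ n)) (*-congˡ (σ-^ x n))

  σ-q^ : ∀ i → σ (q ^ i) ≈ q ^ (5 ℕ.* i)
  σ-q^ i = trans (σ-^ q i) (trans (^-congˡ i σ-q) (^-assocʳ q 5 i))

  σ-principal : ∀ {x} → Principal x → Principal (σ x)
  σ-principal {x} (z by x≈) = (q ^ 4 * σ z) by (begin
    σ x                            ≈⟨ σ-cong x≈ ⟩
    σ (1# + q ^ 1 * z)             ≈⟨ trans (σ-+ _ _) (+-cong σ-1 (trans (σ-* _ _) (*-congʳ (σ-q^ 1)))) ⟩
    1# + q ^ 5 * σ z               ≈⟨ +-congˡ (trans (*-congʳ (^-homo-* q 1 4)) (*-assoc _ _ _)) ⟩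
    1# + q ^ 1 * (q ^ 4 * σ z)     ∎)

  σ-⟨q^⟩ : ∀ i k .{{_ : NonZero k}} .{{_ : NonZero (5 ℕ.* k)}} → σ ⟨ q ^ i ⨾ k ⟩ ≈ ⟨ q ^ (5 ℕ.* i) ⨾ 5 ℕ.* k ⟩
  σ-⟨q^⟩ i k = trans (σ-⟨⨾⟩ (q ^ i) k) (⟨⨾⟩-cong (5 ℕ.* k) (σ-q^ i))

  σ-⟨−q^⟩ : ∀ i k .{{_ : NonZero k}} .{{_ : NonZero (5 ℕ.* k)}} → σ ⟨ - q ^ i ⨾ k ⟩ ≈ ⟨ - q ^ (5 ℕ.* i) ⨾ 5 ℕ.* k ⟩
  σ-⟨−q^⟩ i k = trans (σ-⟨⨾⟩ (- q ^ i) k) (⟨⨾⟩-cong (5 ℕ.* k) (trans (σ-neg _) (-‿cong (σ-q^ i))))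

  private
    σ-triple : ∀ {x y z x′ y′ z′} → σ x ≈ x′ → σ y ≈ y′ → σ z ≈ z′ → σ (x * y * z) ≈ x′ * y′ * z′
    σ-triple ex ey ez = trans (σ-* _ _) (*-cong (trans (σ-* _ _) (*-cong ex ey)) ez)

    σJ₅ : σ J₅ ≈ J 25 25
    σJ₅ = σ-triple (σ-⟨q^⟩ 5 10) (σ-⟨q^⟩ 5 10) (σ-⟨q^⟩ 10 10)

    σJ₃ : σ J₃ ≈ J 35 15
    σJ₃ = trans (σ-triple (σ-⟨q^⟩ 3 10) (σ-⟨q^⟩ 7 10) (σ-⟨q^⟩ 10 10)) swap

    σJ₁ : σ J₁ ≈ J 45 5
    σJ₁ = trans (σ-triple (σ-⟨q^⟩ 1 10) (σ-⟨q^⟩ 9 10) (σ-⟨q^⟩ 10 10)) swap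

    σΘ₃₂ : σ (Θ 3 2) ≈ Θ 15 10
    σΘ₃₂ = σ-triple (σ-⟨−q^⟩ 3 5) (σ-⟨−q^⟩ 2 5) (σ-⟨q^⟩ 5 5)

    σΘ₄₁ : σ (Θ 4 1) ≈ Θ 20 5
    σΘ₄₁ = σ-triple (σ-⟨−q^⟩ 4 5) (σ-⟨−q^⟩ 1 5) (σ-⟨q^⟩ 5 5)

    σΘ₅₀ : σ (Θ 5 0) ≈ Θ 25 0
    σΘ₅₀ = σ-triple (σ-⟨−q^⟩ 5 5) (σ-⟨−q^⟩ 0 5) (σ-⟨q^⟩ 5 5)

    2≈⟦2⟧ : 1# + 1# ≈ ⟦ + 2 ⟧
    2≈⟦2⟧ = solve 0 (𝟙 :+ 𝟙 := con (+ 2)) refl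

    σ-2 : σ (1# + 1#) ≈ 1# + 1#
    σ-2 = trans (σ-+ 1# 1#) (+-cong σ-1 σ-1)

  φ-dissected : J 1 1 ≈ σ J₅ - (1# + 1#) * (q * σ J₃) + (1# + 1#) * (q ^ 4 * σ J₁)
  φ-dissected = trans φ-dissection (sym (+-cong (+-cong σJ₅ (-‿cong (*-congˡ (*-congˡ σJ₃)))) (*-congˡ (*-congˡ σJ₁))))

  ψ-dissected : ψ₁ ≈ σ (Θ 3 2) + q * σ (Θ 4 1) + q ^ 3 * σ ψ₅
  ψ-dissected = nonzero-regular 1 (≈⇒mod 1 2≈⟦2⟧) (begin
    (1# + 1#) * ψ₁
      ≈⟨ Θ₁≈2ψ₁ ⟨
    Θ 1 0
      ≈⟨ ψ-dissection ⟩
    (1# + 1#) * Θ 15 10 + (1# + 1#) * (q * Θ 20 5) + q ^ 3 * Θ 25 0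
      ≈⟨ +-cong (+-cong (*-congˡ σΘ₃₂) (*-congˡ (*-congˡ σΘ₄₁)))
           (*-congˡ (trans (sym (trans (σ-cong Θ₅≈2ψ₅) (trans (σ-* _ _) (*-congʳ σ-2)))) σΘ₅₀)) ⟨
    (1# + 1#) * σ (Θ 3 2) + (1# + 1#) * (q * σ (Θ 4 1)) + q ^ 3 * ((1# + 1#) * σ ψ₅)
      ≈⟨ solve 5 (λ q Q A B C → (𝟙 :+ 𝟙) :* A :+ (𝟙 :+ 𝟙) :* (q :* B) :+ Q :* ((𝟙 :+ 𝟙) :* C)
           := (𝟙 :+ 𝟙) :* (A :+ q :* B :+ Q :* C)) refl q (q ^ 3) _ _ _ ⟩
    (1# + 1#) * (σ (Θ 3 2) + q * σ (Θ 4 1) + q ^ 3 * σ ψ₅) ∎)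

  -- In x³ - y³ = (x² + xy + y²)(x - y) the first factor has constant term 3, so it can be cancelled
  -- although it is not principal.
  cube-injective : ∀ {x y} → Principal x → Principal y → x ^ 3 ≈ y ^ 3 → x ≈ y
  cube-injective {x} {y} x≈1 y≈1 x³≈y³ = trans (sym (+-identityˡ x)) (trans (+-congʳ (sym (-‿inverseʳ y)))
    (trans (solve 2 (λ x y → y :- y :+ x := x :- y :+ y) refl x y) (trans (+-congʳ x-y≈0) (+-identityˡ y))))
    where
    x-y≈0 : x - y ≈ 0#
    x-y≈0 = nonzero-regular 2 (mod-trans
      (mod-+ (mod-+ (mod-* x≈1 x≈1) (mod-* x≈1 y≈1)) (mod-* y≈1 y≈1))
      (≈⇒mod 1 (solve 0 (𝟙 :* 𝟙 :+ 𝟙 :* 𝟙 :+ 𝟙 :* 𝟙 := con (+ 3)) refl)))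
      (begin
      (x * x + x * y + y * y) * (x - y)   ≈⟨ solve 2 (λ x y → (x :* x :+ x :* y :+ y :* y) :* (x :- y) := x :^ 3 :- y :^ 3) refl x y ⟩
      x ^ 3 - y ^ 3                       ≈⟨ trans (+-congʳ x³≈y³) (-‿inverseʳ _) ⟩
      0#                                  ≈⟨ zeroʳ _ ⟨
      (x * x + x * y + y * y) * 0#        ∎)

  private
    cube-product : ∀ {f f′ g m} → f ≈ g * f′ → m * g ≈ 1# → f ^ 3 ≈ (g * g * f′) ^ 2 * (m * f′)
    cube-product {f} {f′} {g} {m} f≈ mg≈1 = trans (^-congˡ 3 f≈) (combination₁ (- (g ^ 3 * f′ ^ 3)) mg≈1
      (solve 3 (λ f g m → (g :* f) :^ 3 := (g :* g :* f) :^ 2 :* (m :* f) :+ (:- (g :^ 3 :* f :^ 3)) :* (m :* g :- 𝟙)) refl f′ g m))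

  f₁-cubed : f₁ ^ 3 ≈ J 1 1 ^ 2 * ψ₁
  f₁-cubed = cube-product f₁≈g₁f₂ m₁g₁≈1

  f₅-cubed : f₅ ^ 3 ≈ J₅ ^ 2 * ψ₅
  f₅-cubed = cube-product f₅≈g₅f₁₀ m₅g₅≈1

  principal-m₁ : Principal m₁
  principal-m₁ = ⟨⨾⟩-principal 1 (mod-trans (mod-‿- (q^≈0 {1} {1} (s≤s z≤n)))
    (≈⇒mod 1 (trans (sym (+-identityˡ _)) (-‿inverseʳ 0#))))

  -- Here I is 1/m₁², which Euler's identity turns into g₁².
  φ²-quotient : ∀ {G I} → G ≈ f₁ * I → (m₁ * m₁) * I ≈ 1# → G * f₁ ≈ J 1 1 ^ 2
  φ²-quotient {G} {I} G≈ mmI≈1 = begin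
    G * f₁
      ≈⟨ *-cong (trans G≈ (*-congʳ f₁≈g₁f₂)) f₁≈g₁f₂ ⟩
    g₁ * f₂ * I * (g₁ * f₂)
      ≈⟨ combination₂ (- ((g₁ * f₂) ^ 2 * I * (m₁ * g₁ + 1#))) ((g₁ * g₁ * f₂) ^ 2) m₁g₁≈1 mmI≈1
           (solve 4 (λ g f m I → g :* f :* I :* (g :* f) := (g :* g :* f) :^ 2
             :+ (:- ((g :* f) :^ 2 :* I :* (m :* g :+ 𝟙))) :* (m :* g :- 𝟙)
             :+ (g :* g :* f) :^ 2 :* (m :* m :* I :- 𝟙)) refl g₁ f₂ m₁ I) ⟩
    J 1 1 ^ 2 ∎

  module _ {κ ρ : Carrier} (κ-def : κ * (J₃ * J₄) ≈ J₁ * J₂) (ρ-def : ρ * (J₂ * J₃) ≈ J₁ * J₄) where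

    private
      k = q * κ
      k̄ = q ^ 5 * σ κ
      x = q * σ ρ
      p = (1# - k̄) * (1# + k̄)
      F = σ J₅
      -- W is the polynomial x p φ/φ(-q²⁵), and V below is k̄ x² ψ/(q³ ψ(q²⁵)); u is to become the
      -- dissection of f₁.
      W = x * p - (1# + 1#) * (x ^ 2 * (1# + k̄)) + (1# + 1#) * (k̄ * (1# - k̄))
      u = 1# - x - x ^ 2
      V = k̄ * x ^ 2 + k̄ * (1# - k̄) + (1# + k̄) * x ^ 4

      principal-quotient : ∀ {z d n} → Principal d → Principal n → z * d ≈ n → Principal z
      principal-quotient {z} {d} {n} pd pn e = principal-cancel-mod pd
        (mod-trans (≈⇒mod 1 (trans (*-comm d z) e)) (mod-trans pn (mod-trans (mod-sym pd) (≈⇒mod 1 (sym (*-identityʳ d))))))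

      principal-κ : Principal κ
      principal-κ = principal-quotient (principal-* (principal-J 3 7) (principal-J 4 6)) (principal-* (principal-J 1 9) (principal-J 2 8)) κ-def

      principal-ρ : Principal ρ
      principal-ρ = principal-quotient (principal-* (principal-J 2 8) (principal-J 3 7)) (principal-* (principal-J 1 9) (principal-J 4 6)) ρ-def

      principal-1+q : ∀ y → Principal (1# + q * y)
      principal-1+q y = y by +-congˡ (*-congʳ (sym (*-identityʳ q)))

      principal-1-q : ∀ y → Principal (1# - q * y)
      principal-1-q y = (- y) by solve 2 (λ q y → 𝟙 :- q :* y := 𝟙 :+ q :^ 1 :* (:- y)) refl q y

      principal-1-k̄ : Principal (1# - k̄)
      principal-1-k̄ = (- (q ^ 4 * σ κ)) by solve 2 (λ q y → 𝟙 :- q :^ 5 :* y := 𝟙 :+ q :^ 1 :* (:- (q :^ 4 :* y))) refl q (σ κ)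

      principal-1+k̄ : Principal (1# + k̄)
      principal-1+k̄ = (q ^ 4 * σ κ) by solve 2 (λ q y → 𝟙 :+ q :^ 5 :* y := 𝟙 :+ q :^ 1 :* (q :^ 4 :* y)) refl q (σ κ)

      principal-u : Principal u
      principal-u = (- σ ρ - q * σ ρ * σ ρ) by
        solve 2 (λ q r → 𝟙 :- q :* r :- (q :* r) :^ 2 := 𝟙 :+ q :^ 1 :* (:- r :- q :* r :* r)) refl q (σ ρ)

      σ-k : σ k ≈ k̄
      σ-k = trans (σ-* q κ) (*-congʳ σ-q)

      σ-1-k : σ (1# - k) ≈ 1# - k̄
      σ-1-k = trans (σ-+ _ _) (+-cong σ-1 (trans (σ-neg _) (-‿cong σ-k)))

      σ-1+k : σ (1# + k) ≈ 1# + k̄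
      σ-1+k = trans (σ-+ _ _) (+-cong σ-1 σ-k)

      -- The factor q⁵ turns σ κ into k̄ on one side and (σ ρ)⁵ into x⁵ on the other.
      relation : k̄ * (1# - k̄) ^ 2 ≈ x ^ 5 * (1# + k̄) ^ 2
      relation = combination₁ (q ^ 5)
        (trans (sym (trans (σ-* _ _) (*-congˡ (trans (σ-^ _ 2) (^-congˡ 2 σ-1-k)))))
          (trans (σ-cong (modular-equation κ-def ρ-def)) (trans (σ-* _ _) (*-cong (σ-^ _ 5) (trans (σ-^ _ 2) (^-congˡ 2 σ-1+k))))))
        (solve 3 (λ q κ ρ → let k = q :^ 5 :* κ in k :* (𝟙 :- k) :^ 2
          := (q :* ρ) :^ 5 :* (𝟙 :+ k) :^ 2 :+ q :^ 5 :* (κ :* (𝟙 :- k) :^ 2 :- ρ :^ 5 :* (𝟙 :+ k) :^ 2)) refl q (σ κ) (σ ρ))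

      -- Dividing the dissection by F gives 1 - 2x/(1 - k̄) + 2k̄/(x(1 + k̄)); x p is the common
      -- denominator.
      φ-parameter : J 1 1 * (x * p) ≈ F * W
      φ-parameter = trans (*-congʳ φ-dissected) (combination₂
        (- ((1# + 1#) * q * x * (1# + k̄))) ((1# + 1#) * q ^ 5 * (1# - k̄))
        (trans (sym (trans (σ-* _ _) (*-congˡ σ-1-k))) (trans (σ-cong (J₃-parameter κ-def ρ-def)) (σ-* _ _)))
        (trans (sym (trans (σ-* _ _) (*-cong (σ-* _ _) σ-1+k))) (trans (σ-cong (J₁-parameter κ-def ρ-def)) (σ-* _ _)))
        (solve 6 (λ q κ ρ J₁ J₃ J₅ → let k = q :^ 5 :* κ ; x = q :* ρ ; p = (𝟙 :- k) :* (𝟙 :+ k) in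
          (J₅ :- (𝟙 :+ 𝟙) :* (q :* J₃) :+ (𝟙 :+ 𝟙) :* (q :^ 4 :* J₁)) :* (x :* p)
          := J₅ :* (x :* p :- (𝟙 :+ 𝟙) :* (x :^ 2 :* (𝟙 :+ k)) :+ (𝟙 :+ 𝟙) :* (k :* (𝟙 :- k)))
            :+ (:- ((𝟙 :+ 𝟙) :* q :* x :* (𝟙 :+ k))) :* (J₃ :* (𝟙 :- k) :- J₅ :* ρ)
            :+ (𝟙 :+ 𝟙) :* q :^ 5 :* (𝟙 :- k) :* (ρ :* J₁ :* (𝟙 :+ k) :- κ :* J₅))
          refl q (σ κ) (σ ρ) (σ J₁) (σ J₃) (σ J₅)))

      -- Dividing the dissection by q³ψ(q²⁵) gives (1 + k̄)x²/k̄ + (1 - k̄)/x² + 1.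
      ψ-parameter : ψ₁ * (k̄ * x ^ 2) ≈ q ^ 3 * σ ψ₅ * V
      ψ-parameter = trans (*-congʳ ψ-dissected) (combination₂
        (q ^ 5 * x ^ 2) (q ^ 3 * k̄)
        (trans (sym (σ-* _ _)) (trans (σ-cong (A-parameter κ-def ρ-def)) (trans (σ-* _ _) (*-cong (trans (σ-* _ _) (*-congˡ (σ-^ _ 2))) σ-1+k))))
        (trans (sym (trans (σ-* _ _) (*-congˡ (σ-^ _ 2)))) (trans (σ-cong (B-parameter κ-def ρ-def)) (trans (σ-* _ _) (*-congˡ σ-1-k))))
        (solve 6 (λ q κ ρ A B C → let k = q :^ 5 :* κ ; x = q :* ρ in
          (A :+ q :* B :+ q :^ 3 :* C) :* (k :* x :^ 2)
          := q :^ 3 :* C :* (k :* x :^ 2 :+ k :* (𝟙 :- k) :+ (𝟙 :+ k) :* x :^ 4)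
            :+ q :^ 5 :* x :^ 2 :* (A :* κ :- C :* ρ :^ 2 :* (𝟙 :+ k))
            :+ q :^ 3 :* k :* (B :* ρ :^ 2 :- C :* (𝟙 :- k)))
          refl q (σ κ) (σ ρ) (σ (Θ 3 2)) (σ (Θ 4 1)) (σ ψ₅)))

      -- The perfect cube behind φ²ψ = f₁³. It is no polynomial identity in x and k̄; the bracket is
      -- the cofactor of the modular equation.
      VW² : V * W ^ 2 ≈ u ^ 3 * (k̄ * x * p ^ 2)
      VW² = combination₁
        (- (⟦ + 4 ⟧ * (x ^ 3 * (1# + k̄)) + x ^ 2 * (- ⟦ + 4 ⟧ + k̄ + ⟦ + 2 ⟧ * k̄ ^ 2 + k̄ ^ 3)
          + x * (1# - ⟦ + 2 ⟧ * k̄ + k̄ ^ 2 + ⟦ + 4 ⟧ * k̄ ^ 3) - ⟦ + 4 ⟧ * k̄ ^ 2 + ⟦ + 4 ⟧ * k̄ ^ 3)) relation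
        (solve 2 (λ x k → let p = (𝟙 :- k) :* (𝟙 :+ k) ; 𝟚 = con (+ 2) ; 𝟜 = con (+ 4) in
          (k :* x :^ 2 :+ k :* (𝟙 :- k) :+ (𝟙 :+ k) :* x :^ 4)
            :* (x :* p :- (𝟙 :+ 𝟙) :* (x :^ 2 :* (𝟙 :+ k)) :+ (𝟙 :+ 𝟙) :* (k :* (𝟙 :- k))) :^ 2
          := (𝟙 :- x :- x :^ 2) :^ 3 :* (k :* x :* p :^ 2)
            :+ (:- (𝟜 :* (x :^ 3 :* (𝟙 :+ k)) :+ x :^ 2 :* (:- 𝟜 :+ k :+ 𝟚 :* k :^ 2 :+ k :^ 3)
                 :+ x :* (𝟙 :- 𝟚 :* k :+ k :^ 2 :+ 𝟜 :* k :^ 3) :- 𝟜 :* k :^ 2 :+ 𝟜 :* k :^ 3))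
              :* (k :* (𝟙 :- k) :^ 2 :- x :^ 5 :* (𝟙 :+ k) :^ 2)) refl x k̄)

      regular-x : Regular x
      regular-x = regular-* regular-q (principal⇒regular (σ-principal principal-ρ))

      regular-k̄ : Regular k̄
      regular-k̄ = regular-* (regular-^ regular-q 5) (principal⇒regular (σ-principal principal-κ))

    -- Ramanujan's dissection of f₁ in terms of R(q⁵). Both sides are principal, so it suffices to
    -- compare cubes after multiplying by the cancellable q³ k̄ x p².
    f₁-dissected : f₁ * σ ρ ≈ σ f₅ * u
    f₁-dissected = cube-injective (principal-* (q^-principal 1 1) (σ-principal principal-ρ))
      (principal-* (σ-principal (q^-principal 5 5)) principal-u)
      (regular-* (regular-^ regular-q 3) (regular-* (regular-* regular-k̄ regular-x)
        (regular-^ (principal⇒regular (principal-* principal-1-k̄ principal-1+k̄)) 2)) (begin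
      q ^ 3 * (k̄ * x * p ^ 2) * (f₁ * σ ρ) ^ 3
        ≈⟨ solve 5 (λ q k p f r → let x = q :* r in q :^ 3 :* (k :* x :* p :^ 2) :* (f :* r) :^ 3
             := f :^ 3 :* ((x :* p) :^ 2 :* (k :* x :^ 2))) refl q k̄ p f₁ (σ ρ) ⟩
      f₁ ^ 3 * ((x * p) ^ 2 * (k̄ * x ^ 2))
        ≈⟨ *-congʳ f₁-cubed ⟩
      J 1 1 ^ 2 * ψ₁ * ((x * p) ^ 2 * (k̄ * x ^ 2))
        ≈⟨ solve 4 (λ φ ψ y z → φ :^ 2 :* ψ :* (y :^ 2 :* z) := (φ :* y) :^ 2 :* (ψ :* z)) refl (J 1 1) ψ₁ (x * p) (k̄ * x ^ 2) ⟩
      (J 1 1 * (x * p)) ^ 2 * (ψ₁ * (k̄ * x ^ 2))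
        ≈⟨ *-cong (^-congˡ 2 φ-parameter) ψ-parameter ⟩
      (F * W) ^ 2 * (q ^ 3 * σ ψ₅ * V)
        ≈⟨ solve 5 (λ F W Q C V → (F :* W) :^ 2 :* (Q :* C :* V) := Q :* (F :^ 2 :* C) :* (V :* W :^ 2)) refl F W (q ^ 3) (σ ψ₅) V ⟩
      q ^ 3 * (F ^ 2 * σ ψ₅) * (V * W ^ 2)
        ≈⟨ *-cong (*-congˡ (trans (sym (trans (σ-* _ _) (*-congʳ (σ-^ _ 2)))) (trans (σ-cong (sym f₅-cubed)) (σ-^ _ 3)))) VW² ⟩
      q ^ 3 * σ f₅ ^ 3 * (u ^ 3 * (k̄ * x * p ^ 2))
        ≈⟨ solve 4 (λ Q f u c → Q :* f :^ 3 :* (u :^ 3 :* c) := Q :* c :* (f :* u) :^ 3) refl (q ^ 3) (σ f₅) u (k̄ * x * p ^ 2) ⟩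
      q ^ 3 * (k̄ * x * p ^ 2) * (σ f₅ * u) ^ 3 ∎))

    private
      -- The series in q⁵. Such a factor passes through `U`, so for the terms that `U` annihilates
      -- membership is all that has to be known about the coefficient.
      Image : Carrier → Set
      Image y = ∃ λ z → y ≈ σ z

      image-σ : ∀ z → Image (σ z)
      image-σ z = z , refl

      image-const : ∀ n → Image ⟦ n ⟧
      image-const n = ⟦ n ⟧ , sym (σ-const n)

      image-1 : Image 1#
      image-1 = 1# , sym σ-1

      image-+ : ∀ {y z} → Image y → Image z → Image (y + z)
      image-+ (y , ey) (z , ez) = y + z , trans (+-cong ey ez) (sym (σ-+ y z))

      image-neg : ∀ {y} → Image y → Image (- y)
      image-neg (y , ey) = - y , trans (-‿cong ey) (sym (σ-neg y))

      image-* : ∀ {y z} → Image y → Image z → Image (y * z)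
      image-* (y , ey) (z , ez) = y * z , trans (*-cong ey ez) (sym (σ-* y z))

      image-^ : ∀ {y} → Image y → ∀ n → Image (y ^ n)
      image-^ iy zero    = image-1
      image-^ iy (suc n) = image-* iy (image-^ iy n)

      image-q⁵ : Image (q ^ 5)
      image-q⁵ = q , sym σ-q

      image-k̄ : Image k̄
      image-k̄ = image-* image-q⁵ (image-σ κ)

      image-1-k̄ : Image (1# - k̄)
      image-1-k̄ = image-+ image-1 (image-neg image-k̄)

      image-1+k̄ : Image (1# + k̄)
      image-1+k̄ = image-+ image-1 image-k̄

      U-image : ∀ {y} i → 0 < i → i < 5 → Image y → U (y * q ^ i) ≈ 0#
      U-image i 0<i i<5 (z , y≈) = trans (U-cong (*-congʳ y≈)) (trans (U-σ z (q ^ i)) (trans (*-congˡ (U-q^ i 0<i i<5)) (zeroʳ z)))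

      -- The coefficients of W² (1 + k - k²) / (1 - x - x²) as a polynomial in x of degree 4, up to the modular equation.
      c₀ c₁ c₂ c₃ c₄ : Carrier
      c₀ = - ((1# - ⟦ + 4 ⟧ * k̄ - k̄ ^ 2) * (1# - k̄) ^ 2 * ((1# + k̄) * k̄))
      c₁ = ⟦ + 5 ⟧ * (p ^ 2 * k̄)
      c₂ = (1# - ⟦ + 4 ⟧ * k̄ - k̄ ^ 2) * ((1# - k̄) * (1# + k̄) ^ 2)
      c₃ = - ((⟦ + 3 ⟧ + ⟦ + 3 ⟧ * k̄ + ⟦ + 2 ⟧ * k̄ ^ 2) * ((1# - k̄) * (1# + k̄) ^ 2))
      c₄ = (⟦ + 2 ⟧ - ⟦ + 3 ⟧ * k̄ + ⟦ + 3 ⟧ * k̄ ^ 2) * (1# + k̄) ^ 3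

      d̄ S : Carrier
      d̄ = 1# + k̄ - k̄ * k̄
      S = c₀ + c₁ * x + c₂ * x ^ 2 + c₃ * x ^ 3 + c₄ * x ^ 4

      image-δ : Image (1# - ⟦ + 4 ⟧ * k̄ - k̄ ^ 2)
      image-δ = image-+ (image-+ image-1 (image-neg (image-* (image-const (+ 4)) image-k̄))) (image-neg (image-^ image-k̄ 2))

      image-c₀ : Image c₀
      image-c₀ = image-neg (image-* (image-* image-δ (image-^ image-1-k̄ 2)) (image-* image-1+k̄ image-k̄))

      image-c₂ : Image c₂
      image-c₂ = image-* image-δ (image-* image-1-k̄ (image-^ image-1+k̄ 2))

      image-c₃ : Image c₃
      image-c₃ = image-neg (image-* (image-+ (image-+ (image-const (+ 3)) (image-* (image-const (+ 3)) image-k̄))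
        (image-* (image-const (+ 2)) (image-^ image-k̄ 2))) (image-* image-1-k̄ (image-^ image-1+k̄ 2)))

      image-c₄ : Image c₄
      image-c₄ = image-* (image-+ (image-+ (image-const (+ 2)) (image-neg (image-* (image-const (+ 3)) image-k̄)))
        (image-* (image-const (+ 3)) (image-^ image-k̄ 2))) (image-^ image-1+k̄ 3)

      -- Carries out the division by u modulo the modular equation; `d̄` is the part of the norm of
      -- u that W² does not absorb.
      uS : u * S ≈ W ^ 2 * d̄
      uS = combination₁ (- (- (⟦ + 2 ⟧ * x) + x * k̄ - ⟦ + 3 ⟧ * (x * k̄ ^ 3) + 1# + k̄ - k̄ ^ 2 - ⟦ + 5 ⟧ * k̄ ^ 3)) relation
        (solve 2 (λ x k → let p = (𝟙 :- k) :* (𝟙 :+ k) ; δ = 𝟙 :- con (+ 4) :* k :- k :^ 2 in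
          (𝟙 :- x :- x :^ 2)
            :* (:- (δ :* (𝟙 :- k) :^ 2 :* ((𝟙 :+ k) :* k)) :+ con (+ 5) :* (p :^ 2 :* k) :* x
              :+ δ :* ((𝟙 :- k) :* (𝟙 :+ k) :^ 2) :* x :^ 2
              :+ (:- ((con (+ 3) :+ con (+ 3) :* k :+ con (+ 2) :* k :^ 2) :* ((𝟙 :- k) :* (𝟙 :+ k) :^ 2))) :* x :^ 3
              :+ (con (+ 2) :- con (+ 3) :* k :+ con (+ 3) :* k :^ 2) :* (𝟙 :+ k) :^ 3 :* x :^ 4)
          := (x :* p :- (𝟙 :+ 𝟙) :* (x :^ 2 :* (𝟙 :+ k)) :+ (𝟙 :+ 𝟙) :* (k :* (𝟙 :- k))) :^ 2 :* (𝟙 :+ k :- k :* k)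
            :+ (:- (:- (con (+ 2) :* x) :+ x :* k :- con (+ 3) :* (x :* k :^ 3) :+ 𝟙 :+ k :- k :^ 2 :- con (+ 5) :* k :^ 3))
              :* (k :* (𝟙 :- k) :^ 2 :- x :^ 5 :* (𝟙 :+ k) :^ 2)) refl x k̄)

    module _ {G : Carrier} (G-def : G * f₁ ≈ J 1 1 ^ 2) where

      -- Of the x² needed for φ², one x is split as q σ ρ, and its σ ρ clears the denominator of f₁.
      -- This leaves q x in front.
      G-dissected : q * x * (σ f₅ * (p ^ 2 * d̄)) * G ≈ F ^ 2 * S
      G-dissected = principal⇒regular principal-u (begin
        u * (q * x * (σ f₅ * (p ^ 2 * d̄)) * G)
          ≈⟨ solve 7 (λ u q x f p d G → u :* (q :* x :* (f :* (p :^ 2 :* d)) :* G) := q :* x :* p :^ 2 :* d :* G :* (f :* u))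
               refl u q x (σ f₅) p d̄ G ⟩
        q * x * p ^ 2 * d̄ * G * (σ f₅ * u)
          ≈⟨ *-congˡ (sym f₁-dissected) ⟩
        q * x * p ^ 2 * d̄ * G * (f₁ * σ ρ)
          ≈⟨ solve 6 (λ q r p d G f → q :* (q :* r) :* p :^ 2 :* d :* G :* (f :* r) := G :* f :* (q :* r :* p) :^ 2 :* d)
               refl q (σ ρ) p d̄ G f₁ ⟩
        G * f₁ * (x * p) ^ 2 * d̄
          ≈⟨ *-congʳ (trans (*-congʳ G-def) (sym (^-distrib-* (J 1 1) (x * p) 2))) ⟩
        (J 1 1 * (x * p)) ^ 2 * d̄
          ≈⟨ *-congʳ (trans (^-congˡ 2 φ-parameter) (^-distrib-* F W 2)) ⟩
        F ^ 2 * W ^ 2 * d̄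
          ≈⟨ trans (*-assoc _ _ _) (*-congˡ (sym uS)) ⟩
        F ^ 2 * (u * S)
          ≈⟨ solve 3 (λ F u S → F :* (u :* S) := u :* (F :* S)) refl (F ^ 2) u S ⟩
        u * (F ^ 2 * S) ∎)

      private
        -- Preimages under σ: `n` of σ ρ times the multiplier of G, and `a` of the summand that
        -- comes from the term of S in x.
        P d n a : Carrier
        P = (1# - k) * (1# + k)
        d = 1# + k - k * k
        n = ρ * (f₅ * (P ^ 2 * d))
        a = q * (J₅ ^ 2 * (⟦ + 5 ⟧ * (P ^ 2 * k) * ρ))

        σ-P² : σ (P ^ 2) ≈ p ^ 2
        σ-P² = trans (σ-^ P 2) (^-congˡ 2 (trans (σ-* _ _) (*-cong σ-1-k σ-1+k)))

        σ-d : σ d ≈ d̄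
        σ-d = trans (σ-+ _ _) (+-cong σ-1+k (trans (σ-neg _) (-‿cong (trans (σ-* k k) (*-cong σ-k σ-k)))))

        σ-n : σ n ≈ σ ρ * (σ f₅ * (p ^ 2 * d̄))
        σ-n = trans (σ-* _ _) (*-congˡ (trans (σ-* _ _) (*-congˡ (trans (σ-* _ _) (*-cong σ-P² σ-d)))))

        σ-a : σ a ≈ q ^ 5 * (F ^ 2 * (c₁ * σ ρ))
        σ-a = trans (σ-* _ _) (*-cong σ-q (trans (σ-* _ _) (*-cong (σ-^ _ 2)
          (trans (σ-* _ _) (*-congʳ (trans (σ-* _ _) (*-cong (σ-const (+ 5)) (trans (σ-* _ _) (*-cong σ-P² σ-k)))))))))

        -- The powers q^(5n+4) of G become powers of q⁵ in q G. On the right, multiplication by q⁴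
        -- puts the term in x^i into the residue class i + 4, so only i = 1 lands in class 0.
        components : σ (q * n) * (q * G)
          ≈ F ^ 2 * c₀ * q ^ 4 + (σ a * 1# + (q ^ 5 * (F ^ 2 * (c₂ * σ ρ ^ 2)) * q ^ 1
            + (q ^ 5 * (F ^ 2 * (c₃ * σ ρ ^ 3)) * q ^ 2 + q ^ 5 * (F ^ 2 * (c₄ * σ ρ ^ 4)) * q ^ 3)))
        components = begin
          σ (q * n) * (q * G)
            ≈⟨ *-congʳ (trans (σ-* q n) (*-cong σ-q σ-n)) ⟩
          q ^ 5 * (σ ρ * (σ f₅ * (p ^ 2 * d̄))) * (q * G)
            ≈⟨ solve 4 (λ q r m G → q :^ 5 :* (r :* m) :* (q :* G) := q :^ 4 :* (q :* (q :* r) :* m :* G))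
                 refl q (σ ρ) (σ f₅ * (p ^ 2 * d̄)) G ⟩
          q ^ 4 * (q * x * (σ f₅ * (p ^ 2 * d̄)) * G)
            ≈⟨ *-congˡ G-dissected ⟩
          q ^ 4 * (F ^ 2 * S)
            ≈⟨ solve 8 (λ q r F c₀ c₁ c₂ c₃ c₄ → let x = q :* r in
                 q :^ 4 :* (F :* (c₀ :+ c₁ :* x :+ c₂ :* x :^ 2 :+ c₃ :* x :^ 3 :+ c₄ :* x :^ 4))
                 := F :* c₀ :* q :^ 4 :+ (q :^ 5 :* (F :* (c₁ :* r)) :* 𝟙 :+ (q :^ 5 :* (F :* (c₂ :* r :^ 2)) :* q :^ 1
                   :+ (q :^ 5 :* (F :* (c₃ :* r :^ 3)) :* q :^ 2 :+ q :^ 5 :* (F :* (c₄ :* r :^ 4)) :* q :^ 3))))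
                 refl q (σ ρ) (F ^ 2) c₀ c₁ c₂ c₃ c₄ ⟩
          F ^ 2 * c₀ * q ^ 4 + (q ^ 5 * (F ^ 2 * (c₁ * σ ρ)) * 1# + (q ^ 5 * (F ^ 2 * (c₂ * σ ρ ^ 2)) * q ^ 1
            + (q ^ 5 * (F ^ 2 * (c₃ * σ ρ ^ 3)) * q ^ 2 + q ^ 5 * (F ^ 2 * (c₄ * σ ρ ^ 4)) * q ^ 3)))
            ≈⟨ +-congˡ (+-congʳ (*-congʳ (sym σ-a))) ⟩
          F ^ 2 * c₀ * q ^ 4 + (σ a * 1# + (q ^ 5 * (F ^ 2 * (c₂ * σ ρ ^ 2)) * q ^ 1
            + (q ^ 5 * (F ^ 2 * (c₃ * σ ρ ^ 3)) * q ^ 2 + q ^ 5 * (F ^ 2 * (c₄ * σ ρ ^ 4)) * q ^ 3))) ∎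

        image-F² : Image (F ^ 2)
        image-F² = image-^ (image-σ J₅) 2

        image-later : ∀ {c} → Image c → ∀ i → Image (q ^ 5 * (F ^ 2 * (c * σ ρ ^ i)))
        image-later ic i = image-* image-q⁵ (image-* image-F² (image-* ic (image-^ (image-σ ρ) i)))

      U-G : q * n * U (q * G) ≈ a
      U-G = begin
        q * n * U (q * G)
          ≈⟨ U-σ (q * n) (q * G) ⟨
        U (σ (q * n) * (q * G))
          ≈⟨ U-cong components ⟩
        U (F ^ 2 * c₀ * q ^ 4 + (σ a * 1# + (q ^ 5 * (F ^ 2 * (c₂ * σ ρ ^ 2)) * q ^ 1
            + (q ^ 5 * (F ^ 2 * (c₃ * σ ρ ^ 3)) * q ^ 2 + q ^ 5 * (F ^ 2 * (c₄ * σ ρ ^ 4)) * q ^ 3))))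
          ≈⟨ trans (U-+ _ _) (+-congˡ (trans (U-+ _ _) (+-congˡ (trans (U-+ _ _) (+-congˡ (U-+ _ _)))))) ⟩
        U (F ^ 2 * c₀ * q ^ 4) + (U (σ a * 1#) + (U (q ^ 5 * (F ^ 2 * (c₂ * σ ρ ^ 2)) * q ^ 1)
            + (U (q ^ 5 * (F ^ 2 * (c₃ * σ ρ ^ 3)) * q ^ 2) + U (q ^ 5 * (F ^ 2 * (c₄ * σ ρ ^ 4)) * q ^ 3))))
          ≈⟨ +-cong (U-image 4 (s≤s z≤n) (s≤s (s≤s (s≤s (s≤s (s≤s z≤n))))) (image-* image-F² image-c₀))
               (+-cong (trans (U-σ a 1#) (trans (*-congˡ U-1) (*-identityʳ a)))
               (+-cong (U-image 1 (s≤s z≤n) (s≤s (s≤s z≤n)) (image-later image-c₂ 2))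
               (+-cong (U-image 2 (s≤s z≤n) (s≤s (s≤s (s≤s z≤n))) (image-later image-c₃ 3))
                       (U-image 3 (s≤s z≤n) (s≤s (s≤s (s≤s (s≤s z≤n)))) (image-later image-c₄ 4))))) ⟩
        0# + (a + (0# + (0# + 0#)))
          ≈⟨ trans (+-identityˡ _) (trans (+-congˡ (trans (+-identityˡ _) (+-identityˡ _))) (+-identityʳ a)) ⟩
        a ∎

      module _ {G₄ : Carrier} (G₄-def : U (q * G) ≈ q * G₄) where

        G₄-parameter : f₅ * d * G₄ ≈ ⟦ + 5 ⟧ * (J₅ ^ 2 * κ)
        G₄-parameter = regular-* (regular-* regular-q regular-q)
          (regular-* (principal⇒regular principal-ρ)
            (regular-^ (principal⇒regular (principal-* (principal-1-q κ) (principal-1+q κ))) 2)) (begin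
          q * q * (ρ * P ^ 2) * (f₅ * d * G₄)
            ≈⟨ solve 6 (λ q r P f d G → q :* q :* (r :* P) :* (f :* d :* G) := q :* (r :* (f :* (P :* d))) :* (q :* G))
                 refl q ρ (P ^ 2) f₅ d G₄ ⟩
          q * n * (q * G₄)
            ≈⟨ *-congˡ (sym G₄-def) ⟩
          q * n * U (q * G)
            ≈⟨ U-G ⟩
          q * (J₅ ^ 2 * (⟦ + 5 ⟧ * (P ^ 2 * (q * κ)) * ρ))
            ≈⟨ solve 5 (λ q r P J κ → q :* (J :* (con (+ 5) :* (P :* (q :* κ)) :* r)) := q :* q :* (r :* P) :* (con (+ 5) :* (J :* κ)))
                 refl q ρ (P ^ 2) (J₅ ^ 2) κ ⟩
          q * q * (ρ * P ^ 2) * (⟦ + 5 ⟧ * (J₅ ^ 2 * κ)) ∎)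

        private
          -- The quotient κ/(1 + k - k²) is the perfect square (J₁J₃/(J₂J₄))².
          J-form : G₄ * f₅ * (J₂ * J₄) ^ 2 ≈ ⟦ + 5 ⟧ * (J₅ ^ 2 * (J₁ * J₃) ^ 2)
          J-form = regular-J 2 8 (combination₃ (- (G₄ * f₅ * J₄)) (J₁ * (J₃ * J₃ * J₃) * J₄) (⟦ + 5 ⟧ * (J₅ ^ 2 * J₁ * J₃ ^ 2))
            (1+k-k² κ-def ρ-def) G₄-parameter κ-def
            (solve 9 (λ κ J₁ J₂ J₃ J₄ J₅ f d G →
              J₂ :* (G :* f :* (J₂ :* J₄) :^ 2) := J₂ :* (con (+ 5) :* (J₅ :^ 2 :* (J₁ :* J₃) :^ 2))
                :+ (:- (G :* f :* J₄)) :* (d :* (J₁ :* (J₃ :* J₃ :* J₃)) :- J₂ :* J₂ :* J₂ :* J₄)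
                :+ J₁ :* (J₃ :* J₃ :* J₃) :* J₄ :* (f :* d :* G :- con (+ 5) :* (J₅ :^ 2 :* κ))
                :+ con (+ 5) :* (J₅ :^ 2 :* J₁ :* J₃ :^ 2) :* (κ :* (J₃ :* J₄) :- J₁ :* J₂))
              refl κ J₁ J₂ J₃ J₄ J₅ f₅ d G₄))

        -- By `ψ₁-product` the quotient J₁J₃/(J₂J₄) is f₁₀/(g₅ψ₁), and J₅ = g₅f₅.
        G₄-product : G₄ * ψ₁ ^ 2 ≈ ⟦ + 5 ⟧ * (f₅ * f₁₀ ^ 2)
        G₄-product = regular-* (regular-^ (regular-* (regular-* (regular-J 1 9) (regular-J 3 7)) (principal⇒regular (q^-principal 5 10))) 2)
          (principal⇒regular (q^-principal 5 5)) (begin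
          (J₁ * J₃ * g₅) ^ 2 * f₅ * (G₄ * ψ₁ ^ 2)
            ≈⟨ solve 4 (λ y f G ψ → y :^ 2 :* f :* (G :* ψ :^ 2) := G :* f :* (ψ :* y) :^ 2) refl (J₁ * J₃ * g₅) f₅ G₄ ψ₁ ⟩
          G₄ * f₅ * (ψ₁ * (J₁ * J₃ * g₅)) ^ 2
            ≈⟨ *-congˡ (^-congˡ 2 ψ₁-product) ⟩
          G₄ * f₅ * (J₂ * J₄ * f₁₀) ^ 2
            ≈⟨ solve 4 (λ G f y F → G :* f :* (y :* F) :^ 2 := G :* f :* y :^ 2 :* F :^ 2) refl G₄ f₅ (J₂ * J₄) f₁₀ ⟩
          G₄ * f₅ * (J₂ * J₄) ^ 2 * f₁₀ ^ 2
            ≈⟨ *-congʳ J-form ⟩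
          ⟦ + 5 ⟧ * ((g₅ * g₅ * f₁₀) ^ 2 * (J₁ * J₃) ^ 2) * f₁₀ ^ 2
            ≈⟨ solve 3 (λ g F y → con (+ 5) :* ((g :* g :* F) :^ 2 :* y :^ 2) :* F :^ 2
                 := (y :* g) :^ 2 :* (g :* F) :* (con (+ 5) :* (g :* F :* F :^ 2))) refl g₅ f₁₀ (J₁ * J₃) ⟩
          (J₁ * J₃ * g₅) ^ 2 * (g₅ * f₁₀) * (⟦ + 5 ⟧ * (g₅ * f₁₀ * f₁₀ ^ 2))
            ≈⟨ *-cong (*-congˡ f₅≈g₅f₁₀) (*-congˡ (*-congʳ f₅≈g₅f₁₀)) ⟨
          (J₁ * J₃ * g₅) ^ 2 * f₅ * (⟦ + 5 ⟧ * (f₅ * f₁₀ ^ 2)) ∎)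

        -- By Euler's identity 1/ψ₁ = g₁/f₂; here I is 1/f₂².
        G₄-quotient : ∀ {I} → f₂ ^ 2 * I ≈ 1# → G₄ ≈ ⟦ + 5 ⟧ * g₁ ^ 2 * f₅ * f₁₀ ^ 2 * I
        G₄-quotient {I} f₂²I≈1 = regular-^ (regular-* (principal⇒regular principal-m₁) (principal⇒regular (q^-principal 2 2))) 2 (begin
          ψ₁ ^ 2 * G₄
            ≈⟨ trans (*-comm _ _) G₄-product ⟩
          ⟦ + 5 ⟧ * (f₅ * f₁₀ ^ 2)
            ≈⟨ combination₂ (⟦ + 5 ⟧ * (f₅ * f₁₀ ^ 2) * - (m₁ * g₁ + 1#)) (- (⟦ + 5 ⟧ * (f₅ * f₁₀ ^ 2) * (m₁ * g₁) ^ 2)) m₁g₁≈1 f₂²I≈1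
                 (solve 6 (λ m g f I f₅ F → con (+ 5) :* (f₅ :* F :^ 2)
                   := (m :* f) :^ 2 :* (con (+ 5) :* g :^ 2 :* f₅ :* F :^ 2 :* I)
                     :+ con (+ 5) :* (f₅ :* F :^ 2) :* (:- (m :* g :+ 𝟙)) :* (m :* g :- 𝟙)
                     :+ (:- (con (+ 5) :* (f₅ :* F :^ 2) :* (m :* g) :^ 2)) :* (f :^ 2 :* I :- 𝟙)) refl m₁ g₁ f₂ I f₅ f₁₀) ⟩
          ψ₁ ^ 2 * (⟦ + 5 ⟧ * g₁ ^ 2 * f₅ * f₁₀ ^ 2 * I) ∎)

-- The ring of power series with integer coefficients

module Series where
  open ℤ[[q]]
  open ≡.≡-Reasoning

  tail : Carrier → Carrier
  tail f n = f (suc n)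

  infixr 8 _•_
  _•_ : ℤ → Carrier → Carrier
  (c • f) n = c ℤ.* f n

  -- By computation the coefficient of index n + 1 in f * h is f 0 · h (n+1) plus the coefficient of
  -- index n in `tail f * h`. The ring laws follow by induction on the index, generalised over the
  -- left factor.
  *-cong : ∀ {f g h k} → f ≈ g → h ≈ k → f * h ≈ g * k
  *-cong f≈g h≈k zero    = ≡.cong₂ (λ a b → a ℤ.* b ℤ.+ 0ℤ) (f≈g 0) (h≈k 0)
  *-cong f≈g h≈k (suc n) = ≡.cong₂ ℤ._+_ (≡.cong₂ ℤ._*_ (f≈g 0) (h≈k (suc n))) (*-cong (λ m → f≈g (suc m)) h≈k n)

  zeroˡ : ∀ f → 0# * f ≈ 0#
  zeroˡ f zero    = ≡.refl
  zeroˡ f (suc n) = ≡.trans (ℤ.+-identityˡ _) (zeroˡ f n)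

  distribʳ : ∀ h f g → (f + g) * h ≈ f * h + g * h
  distribʳ h f g zero    = ℤS.solve 3 (λ h f g → (f :+ g) :* h :+ con 0ℤ := (f :* h :+ con 0ℤ) :+ (g :* h :+ con 0ℤ)) ≡.refl (h 0) (f 0) (g 0)
    where open ℤS
  distribʳ h f g (suc n) = ≡.trans (≡.cong (ℤ._+_ ((f 0 ℤ.+ g 0) ℤ.* h (suc n))) (distribʳ h (tail f) (tail g) n))
    (ℤS.solve 5 (λ f g h s t → (f :+ g) :* h :+ (s :+ t) := (f :* h :+ s) :+ (g :* h :+ t)) ≡.refl
      (f 0) (g 0) (h (suc n)) ((tail f * h) n) ((tail g * h) n))
    where open ℤS

  •-assoc : ∀ c f g → (c • f) * g ≈ c • (f * g)
  •-assoc c f g zero    = ℤS.solve 3 (λ c f g → c :* f :* g :+ con 0ℤ := c :* (f :* g :+ con 0ℤ)) ≡.refl c (f 0) (g 0)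
    where open ℤS
  •-assoc c f g (suc n) = ≡.trans (≡.cong (ℤ._+_ (c ℤ.* f 0 ℤ.* g (suc n))) (•-assoc c (tail f) g n))
    (ℤS.solve 4 (λ c f g s → c :* f :* g :+ c :* s := c :* (f :* g :+ s)) ≡.refl c (f 0) (g (suc n)) ((tail f * g) n))
    where open ℤS

  *-assoc : ∀ f g h → (f * g) * h ≈ f * (g * h)
  *-assoc f g h zero    = ℤS.solve 3 (λ f g h → (f :* g :+ con 0ℤ) :* h :+ con 0ℤ := f :* (g :* h :+ con 0ℤ) :+ con 0ℤ) ≡.refl (f 0) (g 0) (h 0)
    where open ℤS
  *-assoc f g h (suc n) = begin
    (f 0 ℤ.* g 0 ℤ.+ 0ℤ) ℤ.* h (suc n) ℤ.+ ((f 0 • tail g + tail f * g) * h) n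
      ≡⟨ ≡.cong (ℤ._+_ ((f 0 ℤ.* g 0 ℤ.+ 0ℤ) ℤ.* h (suc n))) (≡.trans (distribʳ h (f 0 • tail g) (tail f * g) n)
           (≡.cong₂ ℤ._+_ (•-assoc (f 0) (tail g) h n) (*-assoc (tail f) g h n))) ⟩
    (f 0 ℤ.* g 0 ℤ.+ 0ℤ) ℤ.* h (suc n) ℤ.+ (f 0 ℤ.* (tail g * h) n ℤ.+ (tail f * (g * h)) n)
      ≡⟨ ℤS.solve 5 (λ f g h s t → (f :* g :+ con 0ℤ) :* h :+ (f :* s :+ t) := f :* (g :* h :+ s) :+ t) ≡.refl
           (f 0) (g 0) (h (suc n)) ((tail g * h) n) ((tail f * (g * h)) n) ⟩
    f 0 ℤ.* (g 0 ℤ.* h (suc n) ℤ.+ (tail g * h) n) ℤ.+ (tail f * (g * h)) n ∎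
    where open ℤS

  -- The mirror image of the computational recursion, peeling the right factor; commutativity
  -- compares the two.
  *-sucʳ : ∀ f g n → (f * g) (suc n) ≡ (f * tail g) n ℤ.+ f (suc n) ℤ.* g 0
  *-sucʳ f g zero    = ℤS.solve 4 (λ f g f′ g′ → f :* g′ :+ (f′ :* g :+ con 0ℤ) := f :* g′ :+ con 0ℤ :+ f′ :* g) ≡.refl (f 0) (g 0) (f 1) (g 1)
    where open ℤS
  *-sucʳ f g (suc n) = ≡.trans (≡.cong (ℤ._+_ (f 0 ℤ.* g (suc (suc n)))) (*-sucʳ (tail f) g n))
    (≡.sym (ℤ.+-assoc (f 0 ℤ.* g (suc (suc n))) _ _))

  *-comm : ∀ f g → f * g ≈ g * f
  *-comm f g zero    = ≡.cong (ℤ._+ 0ℤ) (ℤ.*-comm (f 0) (g 0))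
  *-comm f g (suc n) = begin
    f 0 ℤ.* g (suc n) ℤ.+ (tail f * g) n   ≡⟨ ≡.cong₂ ℤ._+_ (ℤ.*-comm (f 0) (g (suc n))) (*-comm (tail f) g n) ⟩
    g (suc n) ℤ.* f 0 ℤ.+ (g * tail f) n   ≡⟨ ℤ.+-comm (g (suc n) ℤ.* f 0) _ ⟩
    (g * tail f) n ℤ.+ g (suc n) ℤ.* f 0   ≡⟨ *-sucʳ g f n ⟨
    (g * f) (suc n)                        ∎

  *-identityˡ : ∀ f → 1# * f ≈ f
  *-identityˡ f zero    = ≡.trans (ℤ.+-identityʳ _) (ℤ.*-identityˡ (f 0))
  *-identityˡ f (suc n) = ≡.trans (≡.cong₂ ℤ._+_ (ℤ.*-identityˡ (f (suc n))) (zeroˡ f n)) (ℤ.+-identityʳ _)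

  isCommutativeRing : IsCommutativeRing _≈_ _+_ _*_ -_ 0# 1#
  isCommutativeRing = record
    { isRing = record
      { +-isAbelianGroup = record
        { isGroup = record
          { isMonoid = record
            { isSemigroup = record
              { isMagma = record
                { isEquivalence = record
                  { refl  = λ _ → ≡.refl
                  ; sym   = λ e n → ≡.sym (e n)
                  ; trans = λ e e′ n → ≡.trans (e n) (e′ n)
                  }
                ; ∙-cong = λ e e′ n → ≡.cong₂ ℤ._+_ (e n) (e′ n)
                }
              ; assoc = λ f g h n → ℤ.+-assoc (f n) (g n) (h n)
              }
            ; identity = (λ f n → ℤ.+-identityˡ (f n)) , (λ f n → ℤ.+-identityʳ (f n))
            }
          ; inverse = (λ f n → ℤ.+-inverseˡ (f n)) , (λ f n → ℤ.+-inverseʳ (f n))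
          ; ⁻¹-cong = λ e n → ≡.cong ℤ.-_ (e n)
          }
        ; comm = λ f g n → ℤ.+-comm (f n) (g n)
        }
      ; *-cong     = *-cong
      ; *-assoc    = *-assoc
      ; *-identity = *-identityˡ , (λ f n → ≡.trans (*-comm f 1# n) (*-identityˡ f n))
      ; distrib    = (λ h f g n → ≡.trans (*-comm h (f + g) n) (≡.trans (distribʳ h f g n)
                       (≡.cong₂ ℤ._+_ (*-comm f h n) (*-comm g h n))))
                   , distribʳ
      }
    ; *-comm = *-comm
    }

  commutativeRing : CommutativeRing 0ℓ 0ℓ
  commutativeRing = record { isCommutativeRing = isCommutativeRing }

  constant-* : ∀ c f → constant c * f ≈ c • f
  constant-* c f zero    = ℤ.+-identityʳ _
  constant-* c f (suc n) = ≡.trans (≡.cong (ℤ._+_ (c ℤ.* f (suc n))) (zeroˡ f n)) (ℤ.+-identityʳ _)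

  fromℤ : ℤ.+-*-rawRing -Raw-AlmostCommutative⟶ fromCommutativeRing commutativeRing
  fromℤ = record
    { ⟦_⟧    = constant
    ; +-homo = λ { a b zero → ≡.refl ; a b (suc n) → ≡.refl }
    ; *-homo = λ { a b zero → ≡.sym (ℤ.+-identityʳ _) ; a b (suc n) → ≡.sym (≡.trans (constant-* a (constant b) (suc n)) (ℤ.*-zeroʳ a)) }
    ; -‿homo = λ { a zero → ≡.refl ; a (suc n) → ≡.refl }
    ; 0-homo = λ { zero → ≡.refl ; (suc n) → ≡.refl }
    ; 1-homo = λ { zero → ≡.refl ; (suc n) → ≡.refl }
    }

  q*-suc : ∀ f n → (q^ 1 * f) (suc n) ≡ f n
  q*-suc f n = ≡.trans (ℤ.+-identityˡ _) (*-identityˡ f n)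

  decompose : ∀ f → f ≈ constant (f 0) + q^ 1 * tail f
  decompose f zero    = ≡.sym (ℤ.+-identityʳ _)
  decompose f (suc n) = ≡.sym (≡.trans (ℤ.+-identityˡ _) (q*-suc (tail f) n))

  q^-low : ∀ N f n → n < N → (q^ 1 ^ N * f) n ≡ 0ℤ
  q^-low (suc N) f zero    _         = ≡.trans (*-assoc (q^ 1) (q^ 1 ^ N) f 0) ≡.refl
  q^-low (suc N) f (suc n) (s≤s n<N) = ≡.trans (*-assoc (q^ 1) (q^ 1 ^ N) f (suc n))
    (≡.trans (q*-suc (q^ 1 ^ N * f) n) (q^-low N f n n<N))

  monomial-pow : ∀ n → q^ 1 ^ n ≈ q^ n
  monomial-pow zero    zero    = ≡.refl
  monomial-pow zero    (suc m) = ≡.refl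
  monomial-pow (suc n) zero    = ≡.refl
  monomial-pow (suc n) (suc m) = ≡.trans (q*-suc (q^ 1 ^ n) m) (monomial-pow n m)

  adicRing : AdicRing
  adicRing = record
    { commutativeRing = commutativeRing
    ; fromℤ           = fromℤ
    ; q               = q^ 1
    ; q-cancel        = λ {f} {g} e n → ≡.trans (≡.sym (q*-suc f n)) (≡.trans (e (suc n)) (q*-suc g n))
    -- The coefficient of index n is fixed only modulo the power n + 1 of q.
    ; separated       = λ {f} {g} e n → let z , f≈ = e (suc n) in
        ≡.trans (f≈ n) (≡.trans (≡.cong (ℤ._+_ (g n)) (q^-low (suc n) z n ℕ.≤-refl)) (ℤ.+-identityʳ (g n)))
    }

  open Adic adicRing using (_≈_mod_; _by_)

  divisible : ∀ N f → (∀ n → n < N → f n ≡ 0ℤ) → f ≈ q^ 1 ^ N * (λ n → f (N ℕ.+ n))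
  divisible zero    f f≡0 n = ≡.sym (*-identityˡ f n)
  divisible (suc N) f f≡0 zero    = ≡.trans (f≡0 0 (s≤s z≤n)) (≡.sym (*-assoc (q^ 1) (q^ 1 ^ N) (λ m → f (suc N ℕ.+ m)) 0))
  divisible (suc N) f f≡0 (suc n) = ≡.trans (divisible N (tail f) (λ m m<N → f≡0 (suc m) (s≤s m<N)) n)
    (≡.sym (≡.trans (*-assoc (q^ 1) (q^ 1 ^ N) (λ m → f (suc N ℕ.+ m)) (suc n)) (q*-suc (q^ 1 ^ N * (λ m → f (suc N ℕ.+ m))) n)))

  coefficients⇒mod : ∀ {N f g} → (∀ n → n < N → f n ≡ g n) → f ≈ g mod N
  coefficients⇒mod {N} {f} {g} e = (λ n → (f + - g) (N ℕ.+ n)) by λ n → ≡.trans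
    (ℤS.solve 2 (λ a b → a ℤS.:= b ℤS.:+ (a ℤS.:- b)) ≡.refl (f n) (g n))
    (≡.cong (ℤ._+_ (g n)) (divisible N (f + - g)
      (λ m m<N → ≡.trans (≡.cong (ℤ._+ ℤ.- g m) (e m m<N)) (ℤ.+-inverseʳ (g m))) n))

  mod⇒coefficients : ∀ {N f g} → f ≈ g mod N → ∀ n → n < N → f n ≡ g n
  mod⇒coefficients {N} {f} {g} (z by e) n n<N = ≡.trans (e n) (≡.trans (≡.cong (ℤ._+_ (g n)) (q^-low N z n n<N)) (ℤ.+-identityʳ (g n)))

  q^-shift : ∀ N f n → (q^ 1 ^ N * f) (N ℕ.+ n) ≡ f n
  q^-shift zero    f n = *-identityˡ f n
  q^-shift (suc N) f n = ≡.trans (*-assoc (q^ 1) (q^ 1 ^ N) f (suc N ℕ.+ n))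
    (≡.trans (q*-suc (q^ 1 ^ N * f) (N ℕ.+ n)) (q^-shift N f n))

-- Infinite products and reciprocals of series

module SeriesProducts where
  open ℤ[[q]] using (⟨_⨾q^_⟩∞; _⁻¹; q^_; product)
  open Series using (adicRing; tail; *-sucʳ; monomial-pow; coefficients⇒mod; mod⇒coefficients)
  open AdicRing adicRing
  open Adic adicRing
  open RawSemiringDefs (RawRing.rawSemiring ℤ.+-*-rawRing) using (sum)

  product≈∏ : ∀ n t → product {n} (λ i → t (toℕ i)) ≈ ∏< n t
  product≈∏ zero    t = refl
  product≈∏ (suc n) t = trans (*-congˡ {t 0} (product≈∏ n (t ∘ suc))) (sym (∏-cons n t))

  module _ (z : Carrier) (k : ℕ) .{{_ : NonZero k}} where
    private
      factor : ℕ → Carrier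
      factor j = 1# - z * (q ^ k) ^ j

      factor≈ : ∀ j → 1# - z * q^ (k ℕ.* j) ≈ factor j
      factor≈ j = +-congˡ {1#} (-‿cong (*-congˡ {z} (trans (sym (monomial-pow (k ℕ.* j))) (sym (^-assocʳ q k j)))))

      factor-stable : ∀ {N} j → N ≤ j → factor j ≈ 1# mod N
      factor-stable {N} j N≤j = mod-trans (mod-+ (mod-refl {1#}) (mod-‿- (*-≈0ʳ (mod-trans (≈⇒mod N (^-assocʳ q k j))
          (q^≈0 (ℕ.≤-trans N≤j (ℕ.m≤n*m j k)))) z)))
        (≈⇒mod N (trans (sym (+-identityʳ _)) (solve 1 (λ z → 𝟙 :- z :+ z := 𝟙) refl 0#)))

    ⟨⨾⟩-hasProduct : HasProduct factor ⟨ z ⨾q^ k ⟩∞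
    -- The infinite product takes its coefficient of index n from n + 1 factors; as n < M, the
    -- product of M factors agrees with it modulo q^(n+1).
    ⟨⨾⟩-hasProduct M = coefficients⇒mod λ n n<M → ≡.trans
      (mod⇒coefficients (∏-stable factor n<M (λ j → factor-stable j)) n ℕ.≤-refl)
      (sym (trans (product≈∏ (suc n) (λ j → 1# - z * q^ (k ℕ.* j))) (∏-cong (suc n) factor≈)) n)

  qSeriesRing : QSeriesRing
  qSeriesRing = record
    { adicRing    = adicRing
    ; ⟨_⨾_⟩       = λ z k → ⟨ z ⨾q^ k ⟩∞
    ; ⟨⨾⟩-product = λ z k → ⟨⨾⟩-hasProduct z k
    }

  partialSum : ℕ → (ℕ → Carrier) → Carrier
  partialSum zero    s = 0#
  partialSum (suc M) s = s 0 + partialSum M (s ∘ suc)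

  partialSum-coefficient : ∀ M s n → sum {M} (λ i → s (toℕ i) n) ≡ partialSum M s n
  partialSum-coefficient zero    s n = ≡.refl
  partialSum-coefficient (suc M) s n = ≡.cong (ℤ._+_ (s 0 n)) (partialSum-coefficient M (s ∘ suc) n)

  partialSum-stable : ∀ {N} M s → N ≤ M → (∀ k → N ≤ k → s k ≈ 0# mod N) → partialSum M s ≈ partialSum N s mod N
  partialSum-stable {N} M s N≤M = go N M s N≤M
    where
    go : ∀ L M s → L ≤ M → (∀ k → L ≤ k → s k ≈ 0# mod N) → partialSum M s ≈ partialSum L s mod N
    go zero    zero    s _         s≈0 = mod-refl
    go zero    (suc M) s _         s≈0 = mod-trans (mod-+ (s≈0 0 z≤n) (go zero M (s ∘ suc) z≤n (λ k _ → s≈0 (suc k) z≤n)))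
      (≈⇒mod N (+-identityʳ 0#))
    go (suc L) (suc M) s (s≤s L≤M) s≈0 = mod-+ (mod-refl {s 0}) (go L M (s ∘ suc) L≤M (λ k L≤k → s≈0 (suc k) (s≤s L≤k)))

  telescope : ∀ e M s → (∀ k → s (suc k) ≈ e * s k) → (1# - e) * partialSum M s ≈ s 0 - s M
  telescope e zero    s step = trans (zeroʳ (1# - e)) (sym (-‿inverseʳ (s 0)))
  telescope e (suc M) s step = trans (distribˡ (1# - e) (s 0) _) (trans
    (+-congˡ {(1# - e) * s 0} (trans (telescope e M (s ∘ suc) (λ k → step (suc k))) (+-congʳ { - s (suc M)} (step 0))))
    (solve 3 (λ e a b → (𝟙 :- e) :* a :+ (e :* a :- b) := a :- b) refl e (s 0) (s (suc M))))

  -- The geometric series in 1 - f telescopes, and its remainder (1 - f)^N is divisible by q^N.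
  inverse : ∀ f → Principal f → f * f ⁻¹ ≈ 1#
  inverse f pf@(z by f≈) = mod-separated λ N → mod-trans
    (mod-* (≈⇒mod N (solve 1 (λ f → f := 𝟙 :- (𝟙 :- f)) refl f)) (inverse≈ N))
    (mod-trans (≈⇒mod N (telescope e N s (λ k → refl)))
    (mod-trans (mod-+ (mod-refl {1#}) (mod-‿- (power≈0 N N ℕ.≤-refl)))
    (≈⇒mod N (trans (sym (+-identityʳ _)) (solve 1 (λ z → 𝟙 :- z :+ z := 𝟙) refl 0#)))))
    where
    e : Carrier
    e = 1# - f

    s : ℕ → Carrier
    s k = e ^ k

    e≈ : e ≈ q * - z
    e≈ = trans (+-congˡ {1#} (-‿cong f≈)) (solve 2 (λ q z → 𝟙 :- (𝟙 :+ q :^ 1 :* z) := q :* :- z) refl q z)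

    power≈0 : ∀ N k → N ≤ k → s k ≈ 0# mod N
    power≈0 N k N≤k = mod-trans (≈⇒mod N (trans (^-congˡ k e≈) (^-distrib-* q (- z) k))) (*-≈0ˡ (q^≈0 N≤k) ((- z) ^ k))

    inverse≈ : ∀ N → f ⁻¹ ≈ partialSum N s mod N
    inverse≈ N = coefficients⇒mod λ n n<N → ≡.trans (partialSum-coefficient (suc n) s n)
      (mod⇒coefficients (mod-sym (partialSum-stable N s n<N (power≈0 (suc n)))) n ℕ.≤-refl)

  -- If u h = 0, then h 0 = 0 because the integers have no zero divisors; hence u · tail h = 0 and
  -- the argument repeats.
  regular-constantTerm : ∀ {u} n → u 0 ≡ + suc n → Regular u
  regular-constantTerm {u} n u₀ {f} {g} e = λ m → ℤ.i-j≡0⇒i≡j (f m) (g m) (vanishes (f - g)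
    (trans (solve 3 (λ u f g → u :* (f :- g) := u :* f :- u :* g) refl u f g)
      (trans (+-congʳ { - (u * g)} e) (-‿inverseʳ (u * g)))) m)
    where
    vanishes : ∀ h → u * h ≈ 0# → ∀ m → h m ≡ 0ℤ
    head-vanishes : ∀ h → u * h ≈ 0# → h 0 ≡ 0ℤ
    head-vanishes h e = ℤ.*-cancelˡ-≡ (+ suc n) (h 0) 0ℤ (≡.trans (≡.trans
      (≡.cong (ℤ._* h 0) (≡.sym u₀)) (≡.trans (≡.sym (ℤ.+-identityʳ _)) (e 0))) (≡.sym (ℤ.*-zeroʳ (+ suc n))))
    vanishes h e zero    = head-vanishes h e
    vanishes h e (suc m) = vanishes (tail h) (λ j → ≡.trans (≡.sym (≡.trans (*-sucʳ u h j)
      (≡.trans (≡.cong (λ c → (u * tail h) j ℤ.+ u (suc j) ℤ.* c) (head-vanishes h e))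
        (≡.trans (≡.cong (ℤ._+_ ((u * tail h) j)) (ℤ.*-zeroʳ (u (suc j)))) (ℤ.+-identityʳ _))))) (e (suc j))) m

-- The substitution q ↦ q⁵ and the extraction of powers of q⁵

module SeriesDissection where
  open ℤ[[q]] using (⟨_⨾q^_⟩∞; q^_; constant)
  open Series
    using (tail; _•_; constant-*; decompose; q*-suc; q^-low; q^-shift; monomial-pow; mod⇒coefficients)
  open SeriesProducts
  open QSeriesRing qSeriesRing hiding (⟨_⨾_⟩)

  -- Consuming five successors of the index for one step along the series avoids any test of
  -- divisibility.
  σ : Carrier → Carrier
  σ f 0 = f 0
  σ f 1 = 0ℤ
  σ f 2 = 0ℤ
  σ f 3 = 0ℤ
  σ f 4 = 0ℤ
  σ f (suc (suc (suc (suc (suc n))))) = σ (tail f) n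

  σ-pointwise : ∀ (_∙_ : ℤ → ℤ → ℤ) → 0ℤ ∙ 0ℤ ≡ 0ℤ → ∀ f g → σ (λ n → f n ∙ g n) ≈ (λ n → σ f n ∙ σ g n)
  σ-pointwise _∙_ e f g 0 = ≡.refl
  σ-pointwise _∙_ e f g 1 = ≡.sym e
  σ-pointwise _∙_ e f g 2 = ≡.sym e
  σ-pointwise _∙_ e f g 3 = ≡.sym e
  σ-pointwise _∙_ e f g 4 = ≡.sym e
  σ-pointwise _∙_ e f g (suc (suc (suc (suc (suc n))))) = σ-pointwise _∙_ e (tail f) (tail g) n

  σ-cong : ∀ {f g} → f ≈ g → σ f ≈ σ g
  σ-cong f≈g 0 = f≈g 0
  σ-cong f≈g 1 = ≡.refl
  σ-cong f≈g 2 = ≡.refl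
  σ-cong f≈g 3 = ≡.refl
  σ-cong f≈g 4 = ≡.refl
  σ-cong f≈g (suc (suc (suc (suc (suc n))))) = σ-cong (λ m → f≈g (suc m)) n

  σ-0 : σ 0# ≈ 0#
  σ-0 0 = ≡.refl
  σ-0 1 = ≡.refl
  σ-0 2 = ≡.refl
  σ-0 3 = ≡.refl
  σ-0 4 = ≡.refl
  σ-0 (suc (suc (suc (suc (suc n))))) = σ-0 n

  σ-+ : ∀ f g → σ (f + g) ≈ σ f + σ g
  σ-+ = σ-pointwise ℤ._+_ ≡.refl

  σ-neg : ∀ f → σ (- f) ≈ - σ f
  σ-neg f = σ-pointwise (λ a _ → ℤ.- a) ≡.refl f f

  σ-• : ∀ c f → σ (c • f) ≈ c • σ f
  σ-• c f = σ-pointwise (λ a _ → c ℤ.* a) (ℤ.*-zeroʳ c) f f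

  σ-decompose : ∀ f → σ f ≈ constant (f 0) + q ^ 5 * σ (tail f)
  σ-decompose f 0 = ≡.sym (≡.trans (≡.cong (ℤ._+_ (f 0)) (q^-low 5 (σ (tail f)) 0 (s≤s z≤n))) (ℤ.+-identityʳ (f 0)))
  σ-decompose f 1 = ≡.sym (≡.trans (ℤ.+-identityˡ _) (q^-low 5 (σ (tail f)) 1 (s≤s (s≤s z≤n))))
  σ-decompose f 2 = ≡.sym (≡.trans (ℤ.+-identityˡ _) (q^-low 5 (σ (tail f)) 2 (s≤s (s≤s (s≤s z≤n)))))
  σ-decompose f 3 = ≡.sym (≡.trans (ℤ.+-identityˡ _) (q^-low 5 (σ (tail f)) 3 (s≤s (s≤s (s≤s (s≤s z≤n))))))
  σ-decompose f 4 = ≡.sym (≡.trans (ℤ.+-identityˡ _) (q^-low 5 (σ (tail f)) 4 (s≤s (s≤s (s≤s (s≤s (s≤s z≤n)))))))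
  σ-decompose f (suc (suc (suc (suc (suc n))))) = ≡.sym (≡.trans (ℤ.+-identityˡ _) (q^-shift 5 (σ (tail f)) n))

  σ-const : ∀ c → σ (constant c) ≈ constant c
  σ-const c = trans (σ-decompose (constant c)) (trans
    (+-congˡ {constant c} (trans (*-congˡ {q ^ 5} σ-0) (zeroʳ (q ^ 5)))) (+-identityʳ (constant c)))

  σ-q* : ∀ f → σ (q * f) ≈ q ^ 5 * σ f
  σ-q* f = trans (σ-decompose (q * f)) (trans
    (+-cong {constant 0ℤ} {0#} {q ^ 5 * σ (tail (q * f))} {q ^ 5 * σ f} (λ { zero → ≡.refl ; (suc n) → ≡.refl })
      (*-congˡ {q ^ 5} (σ-cong (q*-suc f)))) (+-identityˡ (q ^ 5 * σ f)))

  σ-1 : σ 1# ≈ 1#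
  σ-1 = trans (σ-cong (sym 1-homo)) (trans (σ-const 1ℤ) 1-homo)

  σ-q : σ q ≈ q ^ 5
  σ-q = trans (σ-cong (sym (*-identityʳ q))) (trans (σ-q* 1#) (trans (*-congˡ {q ^ 5} σ-1) (*-identityʳ (q ^ 5))))

  q^*-mod : ∀ {x y N} i → x ≈ y mod N → q ^ i * x ≈ q ^ i * y mod i ℕ.+ N
  q^*-mod {x} {y} {N} i (z by x≈) = z by trans (*-congˡ {q ^ i} x≈) (trans
    (solve 4 (λ Q y P z → Q :* (y :+ P :* z) := Q :* y :+ Q :* P :* z) refl (q ^ i) y (q ^ N) z)
    (+-congˡ {q ^ i * y} (*-congʳ {z} (sym (^-homo-* q i N)))))

  *-decompose : ∀ f g → f * g ≈ f 0 • g + q * (tail f * g)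
  *-decompose f g = trans (*-congʳ {g} (decompose f)) (trans (distribʳ g (constant (f 0)) (q * tail f))
    (+-cong (constant-* (f 0) g) (*-assoc q (tail f) g)))

  σ*-decompose : ∀ f g → σ f * g ≈ f 0 • g + q ^ 5 * (σ (tail f) * g)
  σ*-decompose f g = trans (*-congʳ {g} (σ-decompose f)) (trans (distribʳ g (constant (f 0)) (q ^ 5 * σ (tail f)))
    (+-cong (constant-* (f 0) g) (*-assoc (q ^ 5) (σ (tail f)) g)))

  -- Splitting f into its constant term and q · tail f, both sides obey the same recursion, in which
  -- the unknown part is multiplied by q⁵; they agree modulo every power of q.
  σ-* : ∀ f g → σ (f * g) ≈ σ f * σ g
  σ-* f g = mod-separated λ N → go N f
    where
    go : ∀ N f → σ (f * g) ≈ σ f * σ g mod N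
    go zero    f = mod-0
    go (suc N) f = mod-trans
      (≈⇒mod (suc N) (trans (σ-cong (*-decompose f g)) (trans (σ-+ (f 0 • g) (q * (tail f * g))) (+-cong (σ-• (f 0) g) (σ-q* (tail f * g))))))
      -- Five powers of q are gained here, of which the induction needs only one.
      (mod-trans (mod-+ (mod-refl {f 0 • σ g}) (mod-≤ (s≤s (ℕ.m≤n+m N 4)) (q^*-mod 5 (go N (tail f)))))
      (≈⇒mod (suc N) (sym (σ*-decompose f (σ g)))))

  σ-q^ : ∀ i → σ (q ^ i) ≈ q ^ (5 ℕ.* i)
  σ-q^ zero    = σ-1
  σ-q^ (suc i) = trans (σ-q* (q ^ i)) (trans (*-congˡ {q ^ 5} (σ-q^ i)) (trans (sym (^-homo-* q 5 (5 ℕ.* i)))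
    (reflexive (≡.cong (q ^_) (≡.sym (ℕ.*-suc 5 i))))))

  σ-mod : ∀ {x y N} → x ≈ y mod N → σ x ≈ σ y mod N
  σ-mod {x} {y} {N} (z by x≈) = mod-trans (≈⇒mod N (trans (σ-cong x≈) (trans (σ-+ y (q ^ N * z))
      (+-congˡ {σ y} (trans (σ-* (q ^ N) z) (*-congʳ {σ z} (σ-q^ N)))))))
    (mod-trans (mod-+ (mod-refl {σ y}) (*-≈0ˡ (q^≈0 (ℕ.m≤n*m N 5)) (σ z))) (≈⇒mod N (+-identityʳ (σ y))))

  σ-⟨⨾⟩ : ∀ z k .{{_ : NonZero k}} .{{_ : NonZero (5 ℕ.* k)}} → σ ⟨ z ⨾q^ k ⟩∞ ≈ ⟨ σ z ⨾q^ 5 ℕ.* k ⟩∞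
  σ-⟨⨾⟩ z k = product-unique {s = λ j → σ (factor j)} factor≈
    (λ n → mod-trans (≈⇒mod n (sym (σ-∏ n))) (σ-mod (⟨⨾⟩-hasProduct z k n))) (⟨⨾⟩-hasProduct (σ z) (5 ℕ.* k))
    where
    factor : ℕ → Carrier
    factor j = 1# - z * (q ^ k) ^ j

    σ-∏ : ∀ n → σ (∏< n factor) ≈ ∏< n (λ j → σ (factor j))
    σ-∏ zero    = σ-1
    σ-∏ (suc n) = trans (σ-* (∏< n factor) (factor n)) (*-congʳ {σ (factor n)} (σ-∏ n))

    factor≈ : ∀ j → σ (factor j) ≈ 1# - σ z * (q ^ (5 ℕ.* k)) ^ j
    factor≈ j = trans (σ-+ 1# (- (z * (q ^ k) ^ j))) (+-cong σ-1 (trans (σ-neg (z * (q ^ k) ^ j)) (-‿cong (trans (σ-* z ((q ^ k) ^ j))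
      (*-congˡ {σ z} (trans (σ-cong (^-assocʳ q k j)) (trans (σ-q^ (k ℕ.* j))
        (trans (reflexive (≡.cong (q ^_) (≡.sym (ℕ.*-assoc 5 k j)))) (sym (^-assocʳ q (5 ℕ.* k) j))))))))))

  U : Carrier → Carrier
  U f n = f (5 ℕ.* n)

  U-q⁵* : ∀ f → U (q ^ 5 * f) ≈ q * U f
  U-q⁵* f zero    = q^-low 5 f 0 (s≤s z≤n)
  U-q⁵* f (suc n) = ≡.trans (≡.cong (q ^ 5 * f) (ℕ.*-suc 5 n)) (≡.trans (q^-shift 5 f (5 ℕ.* n)) (≡.sym (q*-suc (U f) n)))

  -- The same contraction argument: the remainder carries q⁵, and `U` converts it into q.
  U-σ : ∀ f g → U (σ f * g) ≈ f * U g
  U-σ f g = mod-separated λ N → go N f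
    where
    go : ∀ N f → U (σ f * g) ≈ f * U g mod N
    go zero    f = mod-0
    go (suc N) f = mod-trans
      (≈⇒mod (suc N) (trans (λ n → σ*-decompose f g (5 ℕ.* n)) (+-congˡ {f 0 • U g} (U-q⁵* (σ (tail f) * g)))))
      (mod-trans (mod-+ (mod-refl {f 0 • U g}) (q*-mod′ (go N (tail f))))
      (≈⇒mod (suc N) (sym (*-decompose f (U g)))))
      where
      q*-mod′ : ∀ {x y} → x ≈ y mod N → q * x ≈ q * y mod suc N
      q*-mod′ {x} {y} e = mod-trans (≈⇒mod (suc N) (*-congʳ {x} (sym (*-identityʳ q))))
        (mod-trans (q^*-mod 1 e) (≈⇒mod (suc N) (*-congʳ {y} (*-identityʳ q))))

  U-1 : U 1# ≈ 1#
  U-1 zero    = ≡.refl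
  U-1 (suc n) = ≡.refl

  U-q^ : ∀ i → 0 < i → i < 5 → U (q ^ i) ≈ 0#
  U-q^ i 0<i i<5 n = ≡.trans (monomial-pow i (5 ℕ.* n)) (vanishes i 0<i i<5 n)
    where
    vanishes : ∀ i → 0 < i → i < 5 → ∀ n → (q^ i) (5 ℕ.* n) ≡ 0ℤ
    vanishes (suc i) _ _ zero = ≡.refl
    vanishes 1 _ _ (suc n) = ≡.cong (q^ 1) (ℕ.*-suc 5 n)
    vanishes 2 _ _ (suc n) = ≡.cong (q^ 2) (ℕ.*-suc 5 n)
    vanishes 3 _ _ (suc n) = ≡.cong (q^ 3) (ℕ.*-suc 5 n)
    vanishes 4 _ _ (suc n) = ≡.cong (q^ 4) (ℕ.*-suc 5 n)
    vanishes (suc (suc (suc (suc (suc i))))) _ (s≤s (s≤s (s≤s (s≤s (s≤s ()))))) (suc n)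

  dissectionRing : DissectionRing
  dissectionRing = record
    { qSeriesRing     = qSeriesRing
    ; nonzero-regular = λ {u} n e {f} {g} → regular-constantTerm {u} n (mod⇒coefficients e 0 (s≤s z≤n)) {f} {g}
    ; σ               = σ
    ; σ-cong          = σ-cong
    ; σ-+             = σ-+
    ; σ-*             = σ-*
    ; σ-neg           = σ-neg
    ; σ-const         = σ-const
    ; σ-q             = σ-q
    ; σ-⟨⨾⟩           = λ z k → σ-⟨⨾⟩ z k
    ; U               = U
    ; U-cong          = λ e n → e (5 ℕ.* n)
    ; U-+             = λ f g n → ≡.refl
    ; U-σ             = U-σ
    ; U-1             = U-1
    ; U-q^            = U-q^
    }

-- The crank generating function at a = -1

module Evaluation where
  open RawSemiringDefs (RawRing.rawSemiring ℤ.+-*-rawRing) using (sum)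
  open Laurent using (Polynomial; coeff; a^_)
  open Crank using (even; M; Mₑ; Mₒ; generatingFunction)
  open ≡.≡-Reasoning

  alternating : ℕ → ℤ
  alternating zero    = 1ℤ
  alternating (suc n) = ℤ.- alternating n

  sign : ℤ → ℤ
  sign m = if even m then 1ℤ else -1ℤ

  sign≡alternating : ∀ n → (if does (2 ∣? n) then 1ℤ else -1ℤ) ≡ alternating n
  sign≡alternating 0 = ≡.refl
  sign≡alternating 1 = ≡.refl
  sign≡alternating (suc (suc n)) = begin
    (if does (2 ∣? suc (suc n)) then 1ℤ else -1ℤ)
      ≡⟨ ≡.cong (if_then 1ℤ else -1ℤ) (does-⇔ (mk⇔ (λ d → ∣m+n∣m⇒∣n d ∣-refl) (∣m∣n⇒∣m+n ∣-refl)) (2 ∣? suc (suc n)) (2 ∣? n)) ⟩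
    (if does (2 ∣? n) then 1ℤ else -1ℤ)
      ≡⟨ sign≡alternating n ⟩
    alternating n
      ≡⟨ ℤ.neg-involutive (alternating n) ⟨
    alternating (suc (suc n)) ∎

  alternating-+ : ∀ m n → alternating (m ℕ.+ n) ≡ alternating m ℤ.* alternating n
  alternating-+ zero    n = ≡.sym (ℤ.*-identityˡ _)
  alternating-+ (suc m) n = ≡.trans (≡.cong ℤ.-_ (alternating-+ m n)) (ℤ.neg-distribˡ-* (alternating m) (alternating n))

  alternating-⊖ : ∀ m n → alternating ∣ m ⊖ n ∣ ≡ alternating m ℤ.* alternating n
  alternating-⊖ zero    zero    = ≡.refl
  alternating-⊖ zero    (suc n) = ≡.sym (ℤ.*-identityˡ _)
  alternating-⊖ (suc m) zero    = ≡.sym (ℤ.*-identityʳ _)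
  alternating-⊖ (suc m) (suc n) = begin
    alternating ∣ suc m ⊖ suc n ∣                        ≡⟨ ≡.cong (alternating ∘ ∣_∣) (ℤ.[1+m]⊖[1+n]≡m⊖n m n) ⟩
    alternating ∣ m ⊖ n ∣                                ≡⟨ alternating-⊖ m n ⟩
    alternating m ℤ.* alternating n                      ≡⟨ ℤS.solve 2 (λ a b → a :* b := :- a :* :- b) ≡.refl (alternating m) (alternating n) ⟩
    (ℤ.- alternating m) ℤ.* (ℤ.- alternating n)          ∎
    where open ℤS

  alternating-abs-+ : ∀ m n → alternating ∣ m ℤ.+ n ∣ ≡ alternating ∣ m ∣ ℤ.* alternating ∣ n ∣
  alternating-abs-+ (+ m)    (+ n)    = alternating-+ m n
  alternating-abs-+ (+ m)    -[1+ n ] = alternating-⊖ m (suc n)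
  alternating-abs-+ -[1+ m ] (+ n)    = ≡.trans (alternating-⊖ n (suc m)) (ℤ.*-comm (alternating n) _)
  alternating-abs-+ -[1+ m ] -[1+ n ] = ≡.trans (≡.cong (alternating ∘ suc) (≡.sym (ℕ.+-suc m n))) (alternating-+ (suc m) (suc n))

  -- Divisibility by 2 is traded for `alternating`, which recurses one step at a time and is
  -- multiplicative by induction.
  sign-+ : ∀ m n → sign (m ℤ.+ n) ≡ sign m ℤ.* sign n
  sign-+ m n = ≡.trans (sign≡alternating ∣ m ℤ.+ n ∣) (≡.trans (alternating-abs-+ m n)
    (≡.sym (≡.cong₂ ℤ._*_ (sign≡alternating ∣ m ∣) (sign≡alternating ∣ n ∣))))

  -- Evaluation at a = -1.
  ev : Polynomial → ℤ
  ev []            = 0ℤ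
  ev ((c , e) ∷ p) = c ℤ.* sign e ℤ.+ ev p

  private
    module 𝕃 = RawRing Laurent.rawRing
    module 𝕃S where
      open RawSemiringDefs 𝕃.rawSemiring public using (sum)
    module 𝕃[[q]] = PowerSeries Laurent.rawRing

  ev-+ : ∀ p r → ev (p ++ r) ≡ ev p ℤ.+ ev r
  ev-+ []            r = ≡.sym (ℤ.+-identityˡ _)
  ev-+ ((c , e) ∷ p) r = ≡.trans (≡.cong (ℤ._+_ (c ℤ.* sign e)) (ev-+ p r)) (≡.sym (ℤ.+-assoc (c ℤ.* sign e) (ev p) (ev r)))

  ev-neg : ∀ p → ev (𝕃.- p) ≡ ℤ.- ev p
  ev-neg []            = ≡.refl
  ev-neg ((c , e) ∷ p) = ≡.trans (≡.cong (ℤ._+_ ((ℤ.- c) ℤ.* sign e)) (ev-neg p))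
    (ℤS.solve 3 (λ c s x → :- c :* s :+ :- x := :- (c :* s :+ x)) ≡.refl c (sign e) (ev p))
    where open ℤS

  ev-* : ∀ p r → ev (p 𝕃.* r) ≡ ev p ℤ.* ev r
  ev-* []            r = ≡.refl
  ev-* ((c , e) ∷ p) r = ≡.trans (ev-+ (map _ r) _) (≡.trans (≡.cong₂ ℤ._+_ (scale r) (ev-* p r))
    (≡.sym (ℤ.*-distribʳ-+ (ev r) (c ℤ.* sign e) (ev p))))
    where
    scale : ∀ r → ev (map (λ (d , f) → (c ℤ.* d , e ℤ.+ f)) r) ≡ c ℤ.* sign e ℤ.* ev r
    scale []            = ≡.sym (ℤ.*-zeroʳ (c ℤ.* sign e))
    scale ((d , f) ∷ r) = ≡.trans (≡.cong₂ (λ s x → c ℤ.* d ℤ.* s ℤ.+ x) (sign-+ e f) (scale r))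
      (ℤS.solve 5 (λ c d s t x → c :* d :* (s :* t) :+ c :* s :* x := c :* s :* (d :* t :+ x)) ≡.refl c d (sign e) (sign f) (ev r))
      where open ℤS

  ev-sum : ∀ n (t : Fin n → Polynomial) → ev (𝕃S.sum t) ≡ sum (λ i → ev (t i))
  ev-sum zero    t = ≡.refl
  ev-sum (suc n) t = ≡.trans (ev-+ (t zero) _) (≡.cong (ℤ._+_ (ev (t zero))) (ev-sum n (t ∘ suc)))

  sum-cong : ∀ n {s t : Fin n → ℤ} → (∀ i → s i ≡ t i) → sum s ≡ sum t
  sum-cong zero    e = ≡.refl
  sum-cong (suc n) e = ≡.cong₂ ℤ._+_ (e zero) (sum-cong n (e ∘ suc))

  open ℤ[[q]]

  -- Each coefficient of an infinite product or a reciprocal is a finite expression, so the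
  -- evaluation commutes with both without any convergence argument.
  evS : 𝕃[[q]].Carrier → Carrier
  evS f n = ev (f n)

  evS-* : ∀ f f′ g g′ → evS f ≈ f′ → evS g ≈ g′ → evS (f 𝕃[[q]].* g) ≈ f′ * g′
  evS-* f f′ g g′ ef eg n = ≡.trans (ev-sum (suc n) (λ i → f (toℕ i) 𝕃.* g (n ∸ toℕ i)))
    (sum-cong (suc n) (λ i → ≡.trans (ev-* (f (toℕ i)) (g (n ∸ toℕ i))) (≡.cong₂ ℤ._*_ (ef (toℕ i)) (eg (n ∸ toℕ i)))))

  ev-if : ∀ (b : Bool) p → ev (if b then p else []) ≡ (if b then ev p else 0ℤ)
  ev-if true  p = ≡.refl
  ev-if false p = ≡.refl

  evS-monomial : ∀ p k → evS (𝕃[[q]].monomial p k) ≈ monomial (ev p) k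
  evS-monomial p k n = ev-if (n ℕ.≡ᵇ k) p

  evS-product : ∀ n t s → (∀ (i : Fin n) → evS (t i) ≈ s i) → evS (𝕃[[q]].product t) ≈ product s
  evS-product zero    t s e = evS-monomial (a^ 0ℤ) 0
  evS-product (suc n) t s e = evS-* (t zero) (s zero) (𝕃[[q]].product (t ∘ suc)) (product (s ∘ suc))
    (e zero) (evS-product n (t ∘ suc) (s ∘ suc) (λ i → e (suc i)))

  evS-^ : ∀ f g → evS f ≈ g → ∀ n → evS (f 𝕃[[q]].^ n) ≈ g ^ n
  evS-^ f g e zero    = evS-monomial (a^ 0ℤ) 0
  evS-^ f g e (suc n) = evS-* f g (f 𝕃[[q]].^ n) (g ^ n) e (evS-^ f g e n)

  evS-1- : ∀ f g → evS f ≈ g → evS (𝕃[[q]].1# 𝕃[[q]].+ 𝕃[[q]].- f) ≈ 1# + - g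
  evS-1- f g e n = ≡.trans (ev-+ (𝕃[[q]].1# n) ((𝕃[[q]].- f) n)) (≡.cong₂ ℤ._+_ (evS-monomial (a^ 0ℤ) 0 n)
    (≡.trans (ev-neg (f n)) (≡.cong ℤ.-_ (e n))))

  evS-⁻¹ : ∀ f g → evS f ≈ g → evS (f 𝕃[[q]].⁻¹) ≈ g ⁻¹
  evS-⁻¹ f g e n = ≡.trans (ev-sum (suc n) (λ k → ((𝕃[[q]].1# 𝕃[[q]].+ 𝕃[[q]].- f) 𝕃[[q]].^ toℕ k) n))
    (sum-cong (suc n) (λ k → evS-^ (𝕃[[q]].1# 𝕃[[q]].+ 𝕃[[q]].- f) (1# + - g) (evS-1- f g e) (toℕ k) n))

  evS-⟨⨾⟩ : ∀ z w k .{{_ : NonZero k}} → evS z ≈ w → evS 𝕃[[q]].⟨ z ⨾q^ k ⟩∞ ≈ ⟨ w ⨾q^ k ⟩∞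
  evS-⟨⨾⟩ z w k e n = evS-product (suc n) (λ j → 𝕃[[q]].1# 𝕃[[q]].+ 𝕃[[q]].- (z 𝕃[[q]].* 𝕃[[q]].q^ (k ℕ.* toℕ j)))
    (λ j → 1# + - (w * q^ (k ℕ.* toℕ j)))
    (λ j → evS-1- (z 𝕃[[q]].* 𝕃[[q]].q^ (k ℕ.* toℕ j)) (w * q^ (k ℕ.* toℕ j))
      (evS-* z w (𝕃[[q]].q^ (k ℕ.* toℕ j)) (q^ (k ℕ.* toℕ j)) e (evS-monomial (a^ 0ℤ) (k ℕ.* toℕ j)))) n

  evS-generatingFunction : evS generatingFunction
    ≈ ⟨ q^ 1 ⨾q^ 1 ⟩∞ / (⟨ monomial -1ℤ 1 ⨾q^ 1 ⟩∞ * ⟨ monomial -1ℤ 1 ⨾q^ 1 ⟩∞)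
  evS-generatingFunction = evS-* 𝕃[[q]].⟨ 𝕃[[q]].q^ 1 ⨾q^ 1 ⟩∞ ⟨ q^ 1 ⨾q^ 1 ⟩∞ (D 𝕃[[q]].⁻¹) ((m * m) ⁻¹)
    (evS-⟨⨾⟩ (𝕃[[q]].q^ 1) (q^ 1) 1 (evS-monomial (a^ 0ℤ) 1))
    (evS-⁻¹ D (m * m) (evS-* 𝕃[[q]].⟨ z₊ ⨾q^ 1 ⟩∞ m 𝕃[[q]].⟨ z₋ ⨾q^ 1 ⟩∞ m
      (evS-⟨⨾⟩ z₊ (monomial -1ℤ 1) 1 (evS-monomial (a^ 1ℤ) 1)) (evS-⟨⨾⟩ z₋ (monomial -1ℤ 1) 1 (evS-monomial (a^ -1ℤ) 1))))
    where
    z₊ = 𝕃[[q]].monomial (a^ 1ℤ) 1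
    z₋ = 𝕃[[q]].monomial (a^ -1ℤ) 1
    D  = 𝕃[[q]].⟨ z₊ ⨾q^ 1 ⟩∞ 𝕃[[q]].* 𝕃[[q]].⟨ z₋ ⨾q^ 1 ⟩∞
    m  = ⟨ monomial -1ℤ 1 ⨾q^ 1 ⟩∞

  -- Bounds every exponent listed, even if its terms cancel, so that the condition follows the list
  -- operations. It guarantees that the window from -n to n of the crank counts misses nothing.
  Bounded : ℕ → Polynomial → Set
  Bounded n = All (λ (c , e) → ∣ e ∣ ≤ n)

  BoundedSeries : 𝕃[[q]].Carrier → Set
  BoundedSeries f = ∀ n → Bounded n (f n)

  bounded-* : ∀ {m n o} p r → m ℕ.+ n ≤ o → Bounded m p → Bounded n r → Bounded o (p 𝕃.* r)
  bounded-* []            r m+n≤o []         br = []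
  bounded-* ((c , e) ∷ p) r m+n≤o (be ∷ bp) br = All.++⁺
    (All.map⁺ (All.map (λ {(d , f)} bf → ℕ.≤-trans (ℤ.∣i+j∣≤∣i∣+∣j∣ e f) (ℕ.≤-trans (ℕ.+-mono-≤ be bf) m+n≤o)) br))
    (bounded-* p r m+n≤o bp br)

  bounded-sum : ∀ {o} n (t : Fin n → Polynomial) → (∀ i → Bounded o (t i)) → Bounded o (𝕃S.sum t)
  bounded-sum zero    t bt = []
  bounded-sum (suc n) t bt = All.++⁺ (bt zero) (bounded-sum n (t ∘ suc) (bt ∘ suc))

  boundedSeries-* : ∀ f g → BoundedSeries f → BoundedSeries g → BoundedSeries (f 𝕃[[q]].* g)
  boundedSeries-* f g bf bg n = bounded-sum (suc n) _ λ i → bounded-* (f (toℕ i)) (g (n ∸ toℕ i))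
    (ℕ.≤-reflexive (ℕ.m+[n∸m]≡n (Fin.toℕ≤pred[n] i))) (bf (toℕ i)) (bg (n ∸ toℕ i))

  boundedSeries-monomial : ∀ {p} k → Bounded k p → BoundedSeries (𝕃[[q]].monomial p k)
  boundedSeries-monomial {p} k bp n with n ℕ.≡ᵇ k in eq
  ... | false = []
  ... | true  = ≡.subst (λ m → Bounded m p) (≡.sym (ℕ.≡ᵇ⇒≡ n k (≡.subst Bool.T (≡.sym eq) _))) bp

  boundedSeries-1- : ∀ f → BoundedSeries f → BoundedSeries (𝕃[[q]].1# 𝕃[[q]].+ 𝕃[[q]].- f)
  boundedSeries-1- f bf n = All.++⁺ (boundedSeries-monomial 0 (z≤n ∷ []) n) (All.map⁺ (bf n))

  boundedSeries-product : ∀ n (t : Fin n → 𝕃[[q]].Carrier) → (∀ i → BoundedSeries (t i)) → BoundedSeries (𝕃[[q]].product t)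
  boundedSeries-product zero    t bt = boundedSeries-monomial 0 (z≤n ∷ [])
  boundedSeries-product (suc n) t bt = boundedSeries-* (t zero) (𝕃[[q]].product (t ∘ suc)) (bt zero)
    (boundedSeries-product n (t ∘ suc) (bt ∘ suc))

  boundedSeries-^ : ∀ f → BoundedSeries f → ∀ n → BoundedSeries (f 𝕃[[q]].^ n)
  boundedSeries-^ f bf zero    = boundedSeries-monomial 0 (z≤n ∷ [])
  boundedSeries-^ f bf (suc n) = boundedSeries-* f (f 𝕃[[q]].^ n) bf (boundedSeries-^ f bf n)

  boundedSeries-⁻¹ : ∀ f → BoundedSeries f → BoundedSeries (f 𝕃[[q]].⁻¹)
  boundedSeries-⁻¹ f bf n = bounded-sum (suc n) _ λ k → boundedSeries-^ _ (boundedSeries-1- f bf) (toℕ k) n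

  boundedSeries-⟨⨾⟩ : ∀ z k .{{_ : NonZero k}} → BoundedSeries z → BoundedSeries 𝕃[[q]].⟨ z ⨾q^ k ⟩∞
  boundedSeries-⟨⨾⟩ z k bz n = boundedSeries-product (suc n) _ (λ j → boundedSeries-1- _
    (boundedSeries-* z (𝕃[[q]].q^ (k ℕ.* toℕ j)) bz (boundedSeries-monomial (k ℕ.* toℕ j) (z≤n ∷ [])))) n

  bounded-generatingFunction : BoundedSeries generatingFunction
  bounded-generatingFunction = boundedSeries-* 𝕃[[q]].⟨ 𝕃[[q]].q^ 1 ⨾q^ 1 ⟩∞ _
    (boundedSeries-⟨⨾⟩ (𝕃[[q]].q^ 1) 1 (boundedSeries-monomial 1 (z≤n ∷ [])))
    (boundedSeries-⁻¹ _ (boundedSeries-* 𝕃[[q]].⟨ 𝕃[[q]].monomial (a^ 1ℤ) 1 ⨾q^ 1 ⟩∞ 𝕃[[q]].⟨ 𝕃[[q]].monomial (a^ -1ℤ) 1 ⨾q^ 1 ⟩∞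
      (boundedSeries-⟨⨾⟩ _ 1 (boundedSeries-monomial 1 (s≤s z≤n ∷ []))) (boundedSeries-⟨⨾⟩ _ 1 (boundedSeries-monomial 1 (s≤s z≤n ∷ [])))))

  sum-+ : ∀ n (s t : Fin n → ℤ) → sum (λ i → s i ℤ.+ t i) ≡ sum s ℤ.+ sum t
  sum-+ zero    s t = ≡.refl
  sum-+ (suc n) s t = ≡.trans (≡.cong (ℤ._+_ (s zero ℤ.+ t zero)) (sum-+ n (s ∘ suc) (t ∘ suc)))
    (ℤS.solve 4 (λ a b c d → (a :+ b) :+ (c :+ d) := (a :+ c) :+ (b :+ d)) ≡.refl (s zero) (t zero) (sum (s ∘ suc)) (sum (t ∘ suc)))
    where open ℤS

  sum-minus : ∀ n (s t : Fin n → ℤ) → sum (λ i → s i ℤ.- t i) ≡ sum s ℤ.- sum t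
  sum-minus zero    s t = ≡.refl
  sum-minus (suc n) s t = ≡.trans (≡.cong (ℤ._+_ (s zero ℤ.- t zero)) (sum-minus n (s ∘ suc) (t ∘ suc)))
    (ℤS.solve 4 (λ a b c d → (a :- b) :+ (c :- d) := (a :+ c) :- (b :+ d)) ≡.refl (s zero) (t zero) (sum (s ∘ suc)) (sum (t ∘ suc)))
    where open ℤS

  sum-zero : ∀ n (t : Fin n → ℤ) → (∀ i → t i ≡ 0ℤ) → sum t ≡ 0ℤ
  sum-zero zero    t e = ≡.refl
  sum-zero (suc n) t e = ≡.cong₂ ℤ._+_ (e zero) (sum-zero n (t ∘ suc) (e ∘ suc))

  sum-single : ∀ n (h : ℕ → ℤ) j → j < n → (∀ i → i ≢ j → h i ≡ 0ℤ) → sum {n} (λ i → h (toℕ i)) ≡ h j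
  sum-single (suc n) h zero    _         e = ≡.trans (≡.cong (ℤ._+_ (h 0)) (sum-zero n _ (λ i → e (suc (toℕ i)) (λ ())))) (ℤ.+-identityʳ (h 0))
  sum-single (suc n) h (suc j) (s≤s j<n) e = ≡.trans (≡.cong₂ ℤ._+_ (e 0 (λ ()))
    (sum-single n (h ∘ suc) j j<n (λ i i≢j → e (suc i) (i≢j ∘ ℕ.suc-injective)))) (ℤ.+-identityˡ (h (suc j)))

  ⊖-position : ∀ n e → ∣ e ∣ ≤ n → ∃ λ j → j < suc (2 ℕ.* n) × j ⊖ n ≡ e
  ⊖-position n (+ m)    m≤n = n ℕ.+ m
    , s≤s (ℕ.≤-trans (ℕ.+-monoʳ-≤ n m≤n) (ℕ.≤-reflexive (≡.cong (n ℕ.+_) (≡.sym (ℕ.+-identityʳ n)))))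
    , ≡.trans (≡.cong ((n ℕ.+ m) ⊖_) (≡.sym (ℕ.+-identityʳ n))) (ℤ.+-cancelˡ-⊖ n m 0)
  ⊖-position n -[1+ m ] m<n = n ∸ suc m
    , s≤s (ℕ.≤-trans (ℕ.m∸n≤m n (suc m)) (ℕ.m≤m+n n (n ℕ.+ 0)))
    , ≡.trans (ℤ.⊖-≤ (ℕ.m∸n≤m n (suc m))) (≡.cong (λ x → ℤ.- + x) (ℕ.m∸[m∸n]≡n m<n))

  ⊖-injectiveˡ : ∀ {i j} n → i ⊖ n ≡ j ⊖ n → i ≡ j
  ⊖-injectiveˡ {i} {j} n e = ℤ.+-injective (ℤ+.∙-cancelʳ (ℤ.- + n) (+ i) (+ j)
    (≡.trans (ℤ.m-n≡m⊖n i n) (≡.trans e (≡.sym (ℤ.m-n≡m⊖n j n)))))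

  -- Induction on the formal terms: a term c a^e is seen at exactly one position of the window, the
  -- one shifted to e.
  sum-coefficients : ∀ n p → Bounded n p → sum {suc (2 ℕ.* n)} (λ i → sign (toℕ i ⊖ n) ℤ.* coeff p (toℕ i ⊖ n)) ≡ ev p
  sum-coefficients n []            []         = sum-zero (suc (2 ℕ.* n)) _ (λ i → ℤ.*-zeroʳ (sign (toℕ i ⊖ n)))
  sum-coefficients n ((c , e) ∷ p) (be ∷ bp) with j , j<N , j⊖n≡e ← ⊖-position n e be = begin
    sum {suc (2 ℕ.* n)} (λ i → sign (toℕ i ⊖ n) ℤ.* (δ (toℕ i) ℤ.+ coeff p (toℕ i ⊖ n)))
      ≡⟨ sum-cong (suc (2 ℕ.* n)) (λ i → ℤ.*-distribˡ-+ (sign (toℕ i ⊖ n)) (δ (toℕ i)) (coeff p (toℕ i ⊖ n))) ⟩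
    sum {suc (2 ℕ.* n)} (λ i → sign (toℕ i ⊖ n) ℤ.* δ (toℕ i) ℤ.+ sign (toℕ i ⊖ n) ℤ.* coeff p (toℕ i ⊖ n))
      ≡⟨ sum-+ (suc (2 ℕ.* n)) (λ i → sign (toℕ i ⊖ n) ℤ.* δ (toℕ i)) (λ i → sign (toℕ i ⊖ n) ℤ.* coeff p (toℕ i ⊖ n)) ⟩
    sum {suc (2 ℕ.* n)} (λ i → sign (toℕ i ⊖ n) ℤ.* δ (toℕ i)) ℤ.+ sum {suc (2 ℕ.* n)} (λ i → sign (toℕ i ⊖ n) ℤ.* coeff p (toℕ i ⊖ n))
      ≡⟨ ≡.cong₂ ℤ._+_ (≡.trans (sum-single (suc (2 ℕ.* n)) (λ i → sign (i ⊖ n) ℤ.* δ i) j j<N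
           (λ i i≢j → ≡.trans (≡.cong (ℤ._*_ (sign (i ⊖ n))) (δ≡0 i (λ e≡ → i≢j (⊖-injectiveˡ n (≡.trans (≡.sym e≡) (≡.sym j⊖n≡e))))))
             (ℤ.*-zeroʳ (sign (i ⊖ n)))))
           (≡.trans (≡.cong₂ ℤ._*_ (≡.cong sign j⊖n≡e) (δ≡c j (≡.sym j⊖n≡e))) (ℤ.*-comm (sign e) c)))
         (sum-coefficients n p bp) ⟩
    c ℤ.* sign e ℤ.+ ev p ∎
    where
    δ : ℕ → ℤ
    δ i = if does (e ℤ.≟ i ⊖ n) then c else 0ℤ

    δ≡0 : ∀ i → e ≢ i ⊖ n → δ i ≡ 0ℤ
    δ≡0 i e≢ with e ℤ.≟ i ⊖ n
    ... | yes e≡ = contradiction e≡ e≢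
    ... | no _   = ≡.refl

    δ≡c : ∀ i → e ≡ i ⊖ n → δ i ≡ c
    δ≡c i e≡ with e ℤ.≟ i ⊖ n
    ... | yes _ = ≡.refl
    ... | no e≢ = contradiction e≡ e≢

  -- The difference of the two counts weighs each coefficient by the sign of its exponent, which is
  -- evaluation at a = -1.
  crank-parity : ∀ n → Mₑ n ℤ.- Mₒ n ≡ evS generatingFunction n
  crank-parity n = begin
    Mₑ n ℤ.- Mₒ n
      ≡⟨ sum-minus (suc (2 ℕ.* n)) (λ i → if even (toℕ i ⊖ n) then M (toℕ i ⊖ n) n else 0ℤ)
           (λ i → if not (even (toℕ i ⊖ n)) then M (toℕ i ⊖ n) n else 0ℤ) ⟨
    sum {suc (2 ℕ.* n)} (λ i → (if even (toℕ i ⊖ n) then M (toℕ i ⊖ n) n else 0ℤ) ℤ.- (if not (even (toℕ i ⊖ n)) then M (toℕ i ⊖ n) n else 0ℤ))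
      ≡⟨ sum-cong (suc (2 ℕ.* n)) (λ i → signed (even (toℕ i ⊖ n)) (M (toℕ i ⊖ n) n)) ⟩
    sum {suc (2 ℕ.* n)} (λ i → sign (toℕ i ⊖ n) ℤ.* M (toℕ i ⊖ n) n)
      ≡⟨ sum-coefficients n (generatingFunction n) (bounded-generatingFunction n) ⟩
    evS generatingFunction n ∎
    where
    signed : ∀ b x → (if b then x else 0ℤ) ℤ.- (if not b then x else 0ℤ) ≡ (if b then 1ℤ else -1ℤ) ℤ.* x
    signed true  x = ≡.trans (ℤ.+-identityʳ x) (≡.sym (ℤ.*-identityˡ x))
    signed false x = ≡.trans (ℤ.+-identityˡ (ℤ.- x)) (≡.sym (ℤ.-1*i≡-i x))

open import Data.Integer.Base using (_-_)
open ℤ[[q]]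
open Crank using (Mₑ; Mₒ; generatingFunction)

-- Translation between the quotients of the statement and cancellable factors

module SeriesQuotients where
  open DissectionRing SeriesDissection.dissectionRing using (Principal; U; qSeriesRing; ⟦_⟧)
  private
    module R = DissectionRing SeriesDissection.dissectionRing

  quotient : ∀ n d → Principal d → ∃ λ κ → κ R.* d R.≈ n
  quotient n d pd = n / d , R.trans {n / d * d} {n * (d ⁻¹ * d)} {n} (R.*-assoc n (d ⁻¹) d)
    (R.trans {n * (d ⁻¹ * d)} {n * 1#} {n}
      (R.*-congˡ {n} {d ⁻¹ * d} {1#} (R.trans {d ⁻¹ * d} {d * d ⁻¹} {1#} (R.*-comm (d ⁻¹) d) (SeriesProducts.inverse d pd)))
      (R.*-identityʳ n))

  square-quotient : ∀ {G f f′ m m′} → Principal m → f ≈ f′ → m ≈ m′ → G ≈ f′ / (m′ * m′) →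
    ∃ λ I → G R.≈ f R.* I × (m R.* m) R.* I R.≈ R.1#
  square-quotient {G} {f} {f′} {m} {m′} pm f≈ m≈ G≈ = I
    , R.trans {G} {f′ * I} {f * I} G≈ (R.*-congʳ {I} {f′} {f} (R.sym {f} {f′} f≈))
    , R.trans {m * m * I} {m′ * m′ * I} {1#} (R.*-congʳ {I} {m * m} {m′ * m′} m²≈)
        (SeriesProducts.inverse (m′ * m′) (R.mod-trans (R.≈⇒mod 1 (R.sym {m * m} {m′ * m′} m²≈)) (R.principal-* {m} {m} pm pm)))
    where
    I = (m′ * m′) ⁻¹
    m²≈ : m * m ≈ m′ * m′
    m²≈ = R.*-cong {m} {m′} {m} {m′} m≈ m≈

  quotient-formula : ∀ {X g g′ f f′ F F′ h h′} → Principal h → g ≈ g′ → f ≈ f′ → F ≈ F′ → h ≈ h′ →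
    (∀ {I} → h R.^ 2 R.* I R.≈ R.1# → X R.≈ ⟦ + 5 ⟧ R.* g R.^ 2 R.* f R.* F R.^ 2 R.* I) →
    X ≈ constant (+ 5) * g′ ^ 2 * f′ * F′ ^ 2 / h′ ^ 2
  quotient-formula {X} {g} {g′} {f} {f′} {F} {F′} {h} {h′} ph g≈ f≈ F≈ h≈ X≈ =
    R.trans {X} {c * g ^ 2 * f * F ^ 2 * I} {c * g′ ^ 2 * f′ * F′ ^ 2 * I}
    (X≈ {I} (R.trans {h ^ 2 * I} {h′ ^ 2 * I} {1#} (R.*-congʳ {I} {h ^ 2} {h′ ^ 2} h²≈)
      (SeriesProducts.inverse (h′ ^ 2) (R.mod-trans (R.≈⇒mod 1 (R.sym {h ^ 2} {h′ ^ 2} h²≈)) (R.principal-^ {h} ph 2)))))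
    (R.*-congʳ {I} {c * g ^ 2 * f * F ^ 2} {c * g′ ^ 2 * f′ * F′ ^ 2}
      (R.*-cong {c * g ^ 2 * f} {c * g′ ^ 2 * f′} {F ^ 2} {F′ ^ 2}
        (R.*-cong {c * g ^ 2} {c * g′ ^ 2} {f} {f′} (R.*-congˡ {c} {g ^ 2} {g′ ^ 2} (R.^-congˡ 2 {g} {g′} g≈)) f≈)
        (R.^-congˡ 2 {F} {F′} F≈)))
    where
    c = constant (+ 5)
    I = (h′ ^ 2) ⁻¹
    h²≈ : h ^ 2 ≈ h′ ^ 2
    h²≈ = R.^-congˡ 2 {h} {h′} h≈

  ⟨q^⟩ : ∀ i k .{{_ : NonZero k}} → R.⟨ R.q R.^ i ⨾ k ⟩ ≈ ⟨ q^ i ⨾q^ k ⟩∞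
  ⟨q^⟩ i k = Products.⟨⨾⟩-cong qSeriesRing {R.q R.^ i} {q^ i} k (Series.monomial-pow i)

  ⟨−q⟩ : R.⟨ R.- (R.q R.^ 1) ⨾ 1 ⟩ ≈ ⟨ monomial -1ℤ 1 ⨾q^ 1 ⟩∞
  ⟨−q⟩ = Products.⟨⨾⟩-cong qSeriesRing {R.- (R.q R.^ 1)} {monomial -1ℤ 1} 1 −q≈
    where
    −q≈ : R.- (R.q R.^ 1) ≈ monomial -1ℤ 1
    −q≈ 0             = ≡.refl
    −q≈ 1             = ≡.refl
    −q≈ (suc (suc n)) = ≡.cong ℤ.-_ (Series.monomial-pow 1 (suc (suc n)))

  -- Multiplication by q moves the exponent 5n + 4 to 5(n + 1); the shift by one is the factor q on
  -- the right.
  U-section : ∀ G → U (R.q R.* G) R.≈ R.q R.* (λ n → G (5 ℕ.* n ℕ.+ 4))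
  U-section G zero    = ≡.refl
  U-section G (suc n) = ≡.trans (≡.cong (q^ 1 * G) (≡.trans (ℕ.*-suc 5 n) (≡.cong suc (ℕ.+-comm 4 (5 ℕ.* n)))))
    (≡.trans (Series.q*-suc G (5 ℕ.* n ℕ.+ 4)) (≡.sym (Series.q*-suc (λ n → G (5 ℕ.* n ℕ.+ 4)) n)))

-- The ring of power series is made abstract here so that comparing two of its elements never
-- evaluates coefficients of concrete infinite products.
module CrankDissection where

  abstract
    seriesRing : DissectionRing
    seriesRing = SeriesDissection.dissectionRing

  private
    module R = DissectionRing seriesRing

  abstract
    -- This and its counterpart below are identity maps across the abstraction barrier, known as
    -- such only inside abstract blocks.
    ⌈_⌉ : Carrier → R.Carrier
    ⌈ f ⌉ = f

    ⌊_⌋ : R.Carrier → Carrier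
    ⌊ f ⌋ = f

    quotient : ∀ n d → R.Principal d → ∃ λ κ → κ R.* d R.≈ n
    quotient = SeriesQuotients.quotient

    square-quotient : ∀ {G f f′ m m′} → R.Principal m → ⌊ f ⌋ ≈ f′ → ⌊ m ⌋ ≈ m′ → G ≈ f′ / (m′ * m′) →
      ∃ λ I → ⌈ G ⌉ R.≈ f R.* I × (m R.* m) R.* I R.≈ R.1#
    square-quotient {G} {f} {f′} {m} {m′} = SeriesQuotients.square-quotient {G} {f} {f′} {m} {m′}

    quotient-formula : ∀ {X g g′ f f′ F F′ h h′} → R.Principal h → ⌊ g ⌋ ≈ g′ → ⌊ f ⌋ ≈ f′ → ⌊ F ⌋ ≈ F′ → ⌊ h ⌋ ≈ h′ →
      (∀ {I} → h R.^ 2 R.* I R.≈ R.1# → ⌈ X ⌉ R.≈ R.⟦ + 5 ⟧ R.* g R.^ 2 R.* f R.* F R.^ 2 R.* I) →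
      X ≈ constant (+ 5) * g′ ^ 2 * f′ * F′ ^ 2 / h′ ^ 2
    quotient-formula {X} {g} {g′} {f} {f′} {F} {F′} {h} {h′} =
      SeriesQuotients.quotient-formula {X} {g} {g′} {f} {f′} {F} {F′} {h} {h′}

    ⟨q^⟩ : ∀ i k .{{_ : NonZero k}} → ⌊ R.⟨ R.q R.^ i ⨾ k ⟩ ⌋ ≈ ⟨ q^ i ⨾q^ k ⟩∞
    ⟨q^⟩ i k = SeriesQuotients.⟨q^⟩ i k

    ⟨−q⟩ : ⌊ R.⟨ R.- (R.q R.^ 1) ⨾ 1 ⟩ ⌋ ≈ ⟨ monomial -1ℤ 1 ⨾q^ 1 ⟩∞
    ⟨−q⟩ = SeriesQuotients.⟨−q⟩

    U-section : ∀ G → R.U (R.q R.* ⌈ G ⌉) R.≈ R.q R.* ⌈ (λ n → G (5 ℕ.* n ℕ.+ 4)) ⌉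
    U-section = SeriesQuotients.U-section

  open Dissection seriesRing
  open Products R.qSeriesRing
  open Parametrisation R.qSeriesRing

  formula : ∀ {G} → G ≈ ⟨ q^ 1 ⨾q^ 1 ⟩∞ / (⟨ monomial -1ℤ 1 ⨾q^ 1 ⟩∞ * ⟨ monomial -1ℤ 1 ⨾q^ 1 ⟩∞) →
    (λ n → G (5 ℕ.* n ℕ.+ 4))
      ≈ constant (+ 5) * ⟨ q^ 1 ⨾q^ 2 ⟩∞ ^ 2 * ⟨ q^ 5 ⨾q^ 5 ⟩∞ * ⟨ q^ 10 ⨾q^ 10 ⟩∞ ^ 2 / ⟨ q^ 2 ⨾q^ 2 ⟩∞ ^ 2
  formula {G} G≈ =
    let κ , κ-def = quotient (J₁ R.* J₂) (J₃ R.* J₄) (R.principal-* (principal-J 3 7) (principal-J 4 6))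
        ρ , ρ-def = quotient (J₁ R.* J₄) (J₂ R.* J₃) (R.principal-* (principal-J 2 8) (principal-J 3 7))
        I , G≈′ , m²I≈1 = square-quotient {G} {f₁} {⟨ q^ 1 ⨾q^ 1 ⟩∞} {m₁} {⟨ monomial -1ℤ 1 ⨾q^ 1 ⟩∞} principal-m₁ (⟨q^⟩ 1 1) ⟨−q⟩ G≈
    in quotient-formula {λ n → G (5 ℕ.* n ℕ.+ 4)} {g₁} {⟨ q^ 1 ⨾q^ 2 ⟩∞} {f₅} {⟨ q^ 5 ⨾q^ 5 ⟩∞} {f₁₀} {⟨ q^ 10 ⨾q^ 10 ⟩∞} {f₂} {⟨ q^ 2 ⨾q^ 2 ⟩∞}
         (q^-principal 2 2) (⟨q^⟩ 1 2) (⟨q^⟩ 5 5) (⟨q^⟩ 10 10) (⟨q^⟩ 2 2)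
         (G₄-quotient {κ} {ρ} κ-def ρ-def {⌈ G ⌉} (φ²-quotient {⌈ G ⌉} {I} G≈′ m²I≈1) {⌈ (λ n → G (5 ℕ.* n ℕ.+ 4)) ⌉} (U-section G))

theorem1p4 : (λ n → Mₑ (5 ℕ.* n ℕ.+ 4) - Mₒ (5 ℕ.* n ℕ.+ 4))
    ≈ constant (+ 5) * ⟨ q^ 1 ⨾q^ 2 ⟩∞ ^ 2 * ⟨ q^ 5 ⨾q^ 5 ⟩∞ * ⟨ q^ 10 ⨾q^ 10 ⟩∞ ^ 2
    / ⟨ q^ 2 ⨾q^ 2 ⟩∞ ^ 2
theorem1p4 n = ≡.trans (Evaluation.crank-parity (5 ℕ.* n ℕ.+ 4)) (CrankDissection.formula {Evaluation.evS generatingFunction} Evaluation.evS-generatingFunction n)
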